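{- Let $q$ be a prime power. Suppose that $m\not\equiv3,5\pmod 6$ and $m\ge4$. Then there exists a (nondegenerate) minimal $[m+2,3]_{q^m/q}$ code.
   Context: Let $q$ be a prime power and $n,m,k$ positive integers. For $v\in\mathbb{F}_{q^m}^n$ and an ordered basis $\Gamma=(\gamma_1,\dots,\gamma_m)$ of $\mathbb{F}_{q^m}$ over $\mathbb{F}_q$, let $\Gamma(v)\in\mathbb{F}_q^{n\times m}$ be the matrix with $v_i=\sum_{j}\Gamma(v)_{ij}\gamma_j$. The rank support $\sigma^{\mathrm{rk}}(v)\subseteq\mathbb{F}_q^n$ is the column space of $\Gamma(v)$ (independent of $\Gamma$). An $[n,k]_{q^m/q}$ code is a $k$-dimensional $\mathbb{F}_{q^m}$-subspace $\mathcal{C}\subseteq\mathbb{F}_{q^m}^n$; it is nondegenerate if $\sum_{v\in\mathcal{C}}\sigma^{\mathrm{rk}}(v)=\mathbb{F}_q^n$, and minimal if for all $v,v'\in\mathcal{C}$, $\sigma^{\mathrm{rk}}(v')\subseteq\sigma^{\mathrm{rk}}(v)$ implies $v'=\alpha v$ for some $\alpha\in\mathbb{F}_{q^m}$. -}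

module Defs where

open import Algebra.Apartness.Bundles using (HeytingCommutativeRing; HeytingField)
open import Algebra.Bundles using (CommutativeRing; RawRing)
open import Algebra.Definitions.RawMonoid as RawMonoidDefinitions using ()
open import Algebra.Module.Bundles using (RawLeftModule)
open import Algebra.Morphism.Structures using (module RingMorphisms)
open import Data.Fin.Properties using (≡-setoid)
open import Data.Nat.Base using (ℕ; _^_; _≤_)
open import Data.Nat.Primality using (Prime)
open import Data.Product.Base using (∃-syntax; Σ-syntax; _×_; proj₁)
open import Data.Vec.Functional using (Vector; map; replicate; transpose; zipWith)
open import Data.Vec.Functional.Relation.Binary.Pointwise using (Pointwise)
open import Function.Bundles using (Inverse)
open import Level using (Level; _⊔_; suc)
open import Relation.Binary.Definitions using (_Respects_)
open import Relation.Binary.PropositionalEquality.Core using (_≡_)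
open import Relation.Unary using (Pred; _∈_; _⊆_; U)

IsPrimePower : ℕ → Set
IsPrimePower q = ∃[ p ] ∃[ e ] Prime p × 1 ≤ e × q ≡ p ^ e

-- Axioms of the scalars and vectors play no role in these definitions, so they
-- are stated for raw structures.
module LinearAlgebra
  {c ℓ m ℓm : Level} (R : RawRing c ℓ)
  (M : RawLeftModule (RawRing.Carrier R) m ℓm)
  where

  open RawRing R using (Carrier; _≈_; 0#)
  open RawLeftModule M
  open RawMonoidDefinitions +ᴹ-rawMonoid using (sum)

  linearCombination : ∀ {k} → Vector Carrier k → Vector Carrierᴹ k → Carrierᴹ
  linearCombination a b = sum (zipWith _*ₗ_ a b)

  Span : ∀ {k} → Vector Carrierᴹ k → Pred Carrierᴹ (c ⊔ ℓm)
  Span {k} b w = ∃[ a ] w ≈ᴹ linearCombination {k} a b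

  LinearlyIndependent : ∀ {k} → Vector Carrierᴹ k → Set (c ⊔ ℓ ⊔ ℓm)
  LinearlyIndependent {k} b =
    (a : Vector Carrier k) → linearCombination a b ≈ᴹ 0ᴹ → ∀ i → a i ≈ 0#

  record IsSubspace {p} (S : Pred Carrierᴹ p) : Set (c ⊔ m ⊔ ℓm ⊔ p) where
    field
      respects-≈ : S Respects _≈ᴹ_
      0-closed   : 0ᴹ ∈ S
      +-closed   : ∀ {x y} → x ∈ S → y ∈ S → x +ᴹ y ∈ S
      *-closed   : ∀ a {x} → x ∈ S → a *ₗ x ∈ S

  record IsBasis {p k} (S : Pred Carrierᴹ p) (b : Vector Carrierᴹ k)
         : Set (c ⊔ ℓ ⊔ m ⊔ ℓm ⊔ p) where
    field
      member      : ∀ i → b i ∈ S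
      independent : LinearlyIndependent b
      spans       : S ⊆ Span b

  HasDimension : ∀ {p} → Pred Carrierᴹ p → ℕ → Set (c ⊔ ℓ ⊔ m ⊔ ℓm ⊔ p)
  HasDimension S k = ∃[ b ] IsBasis {k = k} S b

  -- The sum of the family of subspaces (S i), for i ranging over the elements
  -- of I: all finite sums of vectors, each taken from some S i.
  FamilySum : ∀ {a p s} {A : Set a} → Pred A p → (A → Pred Carrierᴹ s) →
              Pred Carrierᴹ (a ⊔ p ⊔ s ⊔ m ⊔ ℓm)
  FamilySum {A = A} I S w = ∃[ r ] Σ[ i ∈ Vector A r ] Σ[ x ∈ Vector Carrierᴹ r ]
    (∀ t → i t ∈ I × x t ∈ S (i t)) × w ≈ᴹ sum x

coordinateSpace : ∀ {c ℓ} (R : RawRing c ℓ) → ℕ → RawLeftModule (RawRing.Carrier R) c ℓ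
coordinateSpace R n = record
  { Carrierᴹ = Vector Carrier n
  ; _≈ᴹ_     = Pointwise _≈_
  ; _+ᴹ_     = zipWith _+_
  ; _*ₗ_     = λ a → map (a *_)
  ; 0ᴹ       = replicate n 0#
  ; -ᴹ_      = map (-_)
  } where open RawRing R

restrictScalars : ∀ {c c′ ℓ′} {A : Set c} (R : RawRing c′ ℓ′) →
                  (A → RawRing.Carrier R) → RawLeftModule A c′ ℓ′
restrictScalars R ι = record
  { Carrierᴹ = Carrier
  ; _≈ᴹ_     = _≈_
  ; _+ᴹ_     = _+_
  ; _*ₗ_     = λ a x → ι a * x
  ; 0ᴹ       = 0#
  ; -ᴹ_      = -_
  } where open RawRing R

module _ {c ℓ₁ ℓ₂ : Level} (F : HeytingField c ℓ₁ ℓ₂) where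

  underlyingRing : CommutativeRing c ℓ₁
  underlyingRing =
    HeytingCommutativeRing.commutativeRing (HeytingField.heytingCommutativeRing F)

  -- A Heyting field with this property is a finite field in the usual sense:
  -- its equality is decidable, and every element other than 0 is invertible.
  HasCardinality : ℕ → Set (c ⊔ ℓ₁)
  HasCardinality q = Inverse (CommutativeRing.setoid underlyingRing) (≡-setoid q)

-- Finite fields F = 𝔽_q and K = 𝔽_{q^m}, with F embedded in K by ι (a ring
-- homomorphism between fields is injective).
record FiniteFieldExtension (q m : ℕ) (c ℓ₁ ℓ₂ c′ ℓ₁′ ℓ₂′ : Level)
       : Set (suc (c ⊔ ℓ₁ ⊔ ℓ₂ ⊔ c′ ⊔ ℓ₁′ ⊔ ℓ₂′)) where
  field
    F : HeytingField c ℓ₁ ℓ₂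
    K : HeytingField c′ ℓ₁′ ℓ₂′

  F-rawRing : RawRing c ℓ₁
  F-rawRing = CommutativeRing.rawRing (underlyingRing F)

  K-rawRing : RawRing c′ ℓ₁′
  K-rawRing = CommutativeRing.rawRing (underlyingRing K)

  open HeytingField F public using () renaming (Carrier to ∣F∣)
  open HeytingField K public using () renaming (Carrier to ∣K∣)

  field
    F-cardinality : HasCardinality F q
    K-cardinality : HasCardinality K (q ^ m)
    ι             : ∣F∣ → ∣K∣
    ι-isRingHomomorphism :
      RingMorphisms.IsRingHomomorphism F-rawRing K-rawRing ι

  module K/F = LinearAlgebra F-rawRing (restrictScalars K-rawRing ι)
  module F^ (n : ℕ) = LinearAlgebra F-rawRing (coordinateSpace F-rawRing n)
  module K^ (n : ℕ) = LinearAlgebra K-rawRing (coordinateSpace K-rawRing n)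

  -- The codes of type [n,k]_{q^m/q}.
  record Code (n k : ℕ) : Set (suc (c′ ⊔ ℓ₁′)) where
    field
      codewords    : Pred (Vector ∣K∣ n) (c′ ⊔ ℓ₁′)
      isSubspace   : K^.IsSubspace n codewords
      hasDimension : K^.HasDimension n codewords k

  record OrderedBasis : Set (c ⊔ ℓ₁ ⊔ c′ ⊔ ℓ₁′) where
    field
      γ       : Vector ∣K∣ m
      isBasis : K/F.IsBasis U γ

module RankSupport
  {q m : ℕ} {c ℓ₁ ℓ₂ c′ ℓ₁′ ℓ₂′ : Level}
  (E : FiniteFieldExtension q m c ℓ₁ ℓ₂ c′ ℓ₁′ ℓ₂′)
  (Γ : FiniteFieldExtension.OrderedBasis E)
  where

  open FiniteFieldExtension E
  open OrderedBasis Γ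

  -- The expansion Γ(v), one row for each entry of v.  Coordinates with respect
  -- to a basis are unique, so the choice made by isBasis is immaterial.
  expand : ∀ {n} → Vector ∣K∣ n → Vector (Vector ∣F∣ m) n
  expand v i = proj₁ (K/F.IsBasis.spans isBasis {v i} _)

  σ : ∀ {n} → Vector ∣K∣ n → Pred (Vector ∣F∣ n) (c ⊔ ℓ₁)
  σ {n} v = F^.Span n (transpose (expand v))

  module _ {n k : ℕ} (C : Code n k) where
    open Code C
    open RawLeftModule (coordinateSpace K-rawRing n) using (_≈ᴹ_; _*ₗ_)

    IsNondegenerate : Set (c ⊔ ℓ₁ ⊔ c′ ⊔ ℓ₁′)
    IsNondegenerate = ∀ w → w ∈ F^.FamilySum n codewords σ

    IsMinimal : Set (c ⊔ ℓ₁ ⊔ c′ ⊔ ℓ₁′)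
    IsMinimal = ∀ {v v′} → v ∈ codewords → v′ ∈ codewords →
                σ v′ ⊆ σ v → ∃[ α ] v′ ≈ᴹ α *ₗ v

{-# OPTIONS --safe #-}
module Submission where

-- Call an F-subspace U of K³ scattered if u = λu′ with u, u′ ∈ U and u′ ≠ 0
-- forces λ ∈ F.  If dim U = m + 2, every K-plane of K³ meets U in two vectors
-- independent over F, hence over K, and is therefore spanned by its
-- intersection with U.  If u₁, …, u_n is an F-basis of U, the F-relations of the
-- word (λ·u₁, …, λ·u_n) are the vectors of U in the plane λ^⊥, so σ(v′) ⊆ σ(v)
-- says that the plane of v meets U inside the plane of v′: the code is minimal.
-- It is nondegenerate because the uᵢ are independent over F.
--
-- For even m let L be the subfield of K of index 2, K = L ⊕ ωL, and let f be a
-- semilinear map of an L-form M of K³ with no invariant L-subspace of dimension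
-- 1 or 2.  Then { f(y) + ωy : y ∈ M } is scattered of dimension 3m/2.  If 6 | m,
-- f can be a twisted cyclic shift; otherwise M is the field of order q^{3m/2}
-- and f(y) = a y^{q³}, where the norm of a to the field E of order q³ is not in F.
--
-- For m ≡ 1 (mod 3) identify K³ with the field of order q^{3m}, which contains E.
-- A scattered E-subspace of E-dimension j can be extended as long as the bad
-- vectors, all of the form λu - u′ or u/(λ - θ) - u′ with λ ∈ K and a fixed
-- θ ∈ E \ F, do not fill the space; there are at most 2q^{m+6j} < q^{3m} of them.

open import Defs
open import Algebra.Apartness.Bundles using (HeytingField)
open import Algebra.Bundles using (CommutativeRing; RawRing)
import Algebra.Definitions.RawMonoid as RawMonoidDefinitions
open import Algebra.Module.Bundles using (RawLeftModule)
import Algebra.Morphism.RingMonomorphism as RingMonomorphism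
open import Algebra.Morphism.Structures using (module RingMorphisms)
import Algebra.Properties.CommutativeMonoid.Sum as Sum
import Algebra.Properties.CommutativeSemiring.Binomial as Binomial
import Algebra.Properties.CommutativeSemiring.Exp as Exp
import Algebra.Properties.Semiring.Mult as Mult
import Algebra.Properties.Semiring.Sum as SemiringSum
import Algebra.Solver.Ring as RingSolver
import Algebra.Solver.Ring.AlmostCommutativeRing as ACR
open import Algebra.Structures using (IsCommutativeRing)
open import Data.Empty using (⊥; ⊥-elim)
open import Data.Fin.Base as Fin using (Fin; zero; suc)
import Data.Fin.Properties as Fin
open import Data.Integer.Base as ℤ using (ℤ; -[1+_])
import Data.Integer.Properties as ℤ
open import Data.Maybe.Base as Maybe using (Maybe)
open import Data.Nat.Base as ℕ using (ℕ; zero; suc)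
open import Data.Nat.Combinatorics using (_C_; nCn≡1; k![n∸k]!∣n!)
open import Data.Nat.Combinatorics.Specification using (nCk≡n!/k![n-k]!)
open import Data.Nat.Divisibility using (_∣_; divides; ∣⇒≤; m∣m*n; ∣1⇒≡1)
open import Data.Nat.DivMod using (m*[n/m]≡n; m%n<n; m≡m%n+[m/n]*n)
open import Data.Nat.Primality using (Prime; euclidsLemma; prime⇒nonZero; prime⇒nonTrivial)
import Data.Nat.Properties as ℕ
open import Data.Nat.Solver using (module +-*-Solver)
open import Data.Product.Base using (Σ-syntax; ∃; ∃-syntax; _×_; _,_; proj₁; proj₂)
open import Data.Product.Function.NonDependent.Propositional using (_×-↔_)
open import Data.Sum.Base using (_⊎_; inj₁; inj₂)
open import Data.Vec.Base as Vec using (Vec; []; _∷_)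
open import Function.Base using (_∘_; id)
open import Function.Bundles using (Inverse; _↔_; mk↔ₛ′)
open import Function.Definitions using (Injective)
open import Function.Properties.Inverse using (↔-refl; ↔-sym; ↔-trans)
open import Level using (Level; 0ℓ)
open import Relation.Binary.PropositionalEquality
  using (_≡_; _≢_; _≗_; refl; sym; trans; cong; cong₂; subst; module ≡-Reasoning; isEquivalence)
open import Relation.Nullary using (¬_; Dec; yes; no)
import Relation.Nullary.Decidable as Dec

-- A scattered subspace needs F-dimension m + 2, and this fixes the case split. A graph over an
-- L-form has dimension 3m/2, which reaches m + 2 exactly when m ≥ 4. For odd m there is no subfield
-- of index 2; an E-subspace has dimension divisible by 3, and m + 2 is divisible by 3 just when m ≡
-- 1 (mod 3). The residues 3 and 5 modulo 6 satisfy neither condition. In the greedy step a new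
-- vector v creates ratios of bv + u and b′v + u′ for every ρ = b/b′ in E. Excluding the bad vectors
-- of each ρ separately would cost a factor of about q³, more than the count allows: with j = (m -
-- 1)/3 the bound 2q^(m+6j) is already 2q^(3m-2). Because E has degree 3, all elements of E outside
-- F are images of one θ under fractional linear maps over F, so θ can stand for all of them. K and
-- E meet only in F, as 3 does not divide m. Subfields are not types of their own but sets of fixed
-- points of x ↦ x^(q^j), and most dimension arguments are counts of elements: a map into a smaller
-- set has a collision, a polynomial has few roots.

module IntegerSolver {r ℓ} (R : CommutativeRing r ℓ) where
  open CommutativeRing R hiding (zero; refl; sym; trans)
  private
    module ≈ = CommutativeRing R
  open import Algebra.Properties.Semiring.Mult.TCOptimised semiring using (1+×; ×-homo-+; ×1-homo-*) renaming (_×_ to _·_)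
  open import Algebra.Properties.Ring ring using (-‿involutive; -0#≈0#; -‿distribˡ-*; -‿distribʳ-*; -‿+-comm)
  open import Relation.Binary.Reasoning.Setoid setoid

  -- With the optimised multiples `1 · 1#` reduces to `1#`, so goals that mention `1#` match the
  -- polynomials of the solver by computation.
  fromℤ : ℤ → Carrier
  fromℤ (ℤ.+ n)    = n · 1#
  fromℤ -[1+ n ] = - (suc n · 1#)

  private
    ⊖-homo : ∀ a b → fromℤ (a ℤ.⊖ b) ≈ a · 1# - b · 1#
    ⊖-homo zero    zero    = ≈.sym (-‿inverseʳ 0#)
    ⊖-homo zero    (suc b) = ≈.sym (+-identityˡ _)
    ⊖-homo (suc a) zero    = ≈.trans (≈.sym (+-identityʳ _)) (+-congˡ (≈.sym -0#≈0#))
    ⊖-homo (suc a) (suc b) = begin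
      fromℤ (suc a ℤ.⊖ suc b)                      ≡⟨ cong fromℤ (ℤ.[1+m]⊖[1+n]≡m⊖n a b) ⟩
      fromℤ (a ℤ.⊖ b)                              ≈⟨ ⊖-homo a b ⟩
      a · 1# - b · 1#                              ≈⟨ +-congˡ (+-identityˡ _) ⟨
      a · 1# + (0# - b · 1#)                       ≈⟨ +-congˡ (+-congʳ (-‿inverseʳ 1#)) ⟨
      a · 1# + ((1# - 1#) - b · 1#)                ≈⟨ +-congˡ (+-assoc _ _ _) ⟩
      a · 1# + (1# + (- 1# - b · 1#))              ≈⟨ +-assoc _ _ _ ⟨
      (a · 1# + 1#) + (- 1# - b · 1#)              ≈⟨ +-cong (+-comm _ _) (-‿+-comm _ _) ⟩
      (1# + a · 1#) - (1# + b · 1#)                ≈⟨ +-cong (1+× a 1#) (-‿cong (1+× b 1#)) ⟨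
      suc a · 1# - suc b · 1#                      ∎

    +-homo : ∀ i j → fromℤ (i ℤ.+ j) ≈ fromℤ i + fromℤ j
    +-homo (ℤ.+ a)    (ℤ.+ b)    = ×-homo-+ 1# a b
    +-homo (ℤ.+ a)    -[1+ b ] = ⊖-homo a (suc b)
    +-homo -[1+ a ] (ℤ.+ b)    = ≈.trans (⊖-homo b (suc a)) (+-comm _ _)
    +-homo -[1+ a ] -[1+ b ] = begin
      - (suc (suc (a ℕ.+ b)) · 1#)        ≡⟨ cong (λ k → - (suc k · 1#)) (ℕ.+-suc a b) ⟨
      - ((suc a ℕ.+ suc b) · 1#)          ≈⟨ -‿cong (×-homo-+ 1# (suc a) (suc b)) ⟩
      - (suc a · 1# + suc b · 1#)         ≈⟨ -‿+-comm _ _ ⟨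
      - (suc a · 1#) - (suc b · 1#)       ∎

    neg-homo : ∀ i → fromℤ (ℤ.- i) ≈ - fromℤ i
    neg-homo (ℤ.+ zero)  = ≈.sym -0#≈0#
    neg-homo (ℤ.+ suc n) = ≈.refl
    neg-homo -[1+ n ]  = ≈.sym (-‿involutive _)

    *-homo⁺ : ∀ i b → fromℤ (i ℤ.* ℤ.+ b) ≈ fromℤ i * fromℤ (ℤ.+ b)
    *-homo⁺ (ℤ.+ a) b = begin
      fromℤ (ℤ.+ a ℤ.* ℤ.+ b)       ≡⟨ cong fromℤ (ℤ.pos-* a b) ⟨
      (a ℕ.* b) · 1#            ≈⟨ ×1-homo-* a b ⟩
      (a · 1#) * (b · 1#)       ∎
    *-homo⁺ -[1+ a ] b = begin
      fromℤ (-[1+ a ] ℤ.* ℤ.+ b)         ≡⟨ cong fromℤ (ℤ.neg-distribˡ-* (ℤ.+ suc a) (ℤ.+ b)) ⟨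
      fromℤ (ℤ.- (ℤ.+ suc a ℤ.* ℤ.+ b))    ≈⟨ neg-homo (ℤ.+ suc a ℤ.* ℤ.+ b) ⟩
      - fromℤ (ℤ.+ suc a ℤ.* ℤ.+ b)        ≈⟨ -‿cong (*-homo⁺ (ℤ.+ suc a) b) ⟩
      - ((suc a · 1#) * (b · 1#))      ≈⟨ -‿distribˡ-* _ _ ⟩
      - (suc a · 1#) * (b · 1#)        ∎

    *-homo : ∀ i j → fromℤ (i ℤ.* j) ≈ fromℤ i * fromℤ j
    *-homo i (ℤ.+ b)    = *-homo⁺ i b
    *-homo i -[1+ b ] = begin
      fromℤ (i ℤ.* -[1+ b ])         ≡⟨ cong fromℤ (ℤ.neg-distribʳ-* i (ℤ.+ suc b)) ⟨
      fromℤ (ℤ.- (i ℤ.* ℤ.+ suc b))    ≈⟨ neg-homo (i ℤ.* ℤ.+ suc b) ⟩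
      - fromℤ (i ℤ.* ℤ.+ suc b)        ≈⟨ -‿cong (*-homo⁺ i (suc b)) ⟩
      - (fromℤ i * (suc b · 1#))     ≈⟨ -‿distribʳ-* _ _ ⟩
      fromℤ i * - (suc b · 1#)       ∎

    homomorphism : CommutativeRing.rawRing ℤ.+-*-commutativeRing
                   ACR.-Raw-AlmostCommutative⟶ ACR.fromCommutativeRing R
    homomorphism = record
      { ⟦_⟧    = fromℤ
      ; +-homo = +-homo
      ; *-homo = *-homo
      ; -‿homo = neg-homo
      ; 0-homo = ≈.refl
      ; 1-homo = ≈.refl
      }

    -- Distinct integers may have equal images in positive characteristic, so only a positive answer
    -- is ever given.
    coefficient≟ : ∀ i j → Maybe (fromℤ i ≈ fromℤ j)
    coefficient≟ i j = Maybe.map (λ { refl → ≈.refl }) (Dec.dec⇒maybe (i ℤ.≟ j))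

  open RingSolver (CommutativeRing.rawRing ℤ.+-*-commutativeRing) (ACR.fromCommutativeRing R)
    homomorphism coefficient≟ public
    using (Polynomial; solve; _:=_; _:+_; _:*_; _:-_; :-_; _:^_; con)

  :0 :1 : ∀ {n} → Polynomial n
  :0 = con (ℤ.+ 0)
  :1 = con (ℤ.+ 1)

-- Counting in finite types

module Finite {A : Set} {n : ℕ} (A↔ : A ↔ Fin n) where
  open Inverse A↔ using (to; from; strictlyInverseˡ; strictlyInverseʳ)

  to-injective : ∀ {x y} → to x ≡ to y → x ≡ y
  to-injective {x} {y} eq = trans (sym (strictlyInverseʳ x)) (trans (cong from eq) (strictlyInverseʳ y))

  from-injective : ∀ {i j} → from i ≡ from j → i ≡ j
  from-injective {i} {j} eq = trans (sym (strictlyInverseˡ i)) (trans (cong to eq) (strictlyInverseˡ j))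

  _≟_ : (x y : A) → Dec (x ≡ y)
  x ≟ y = Dec.map′ to-injective (cong to) (to x Fin.≟ to y)

  any? : ∀ {p} {P : A → Set p} → (∀ x → Dec (P x)) → Dec (∃ P)
  any? {P = P} P? = Dec.map′ (λ (i , p) → from i , p)
    (λ (x , p) → to x , subst P (sym (strictlyInverseʳ x)) p) (Fin.any? (λ i → P? (from i)))

  collision : ∀ {m} → n ℕ.< m → (f : Fin m → A) → ∃[ i ] ∃[ j ] i ≢ j × f i ≡ f j
  collision n<m f with i , j , i<j , eq ← Fin.pigeonhole n<m (to ∘ f) =
    i , j , Fin.<⇒≢ i<j , to-injective eq

  injective⇒≤ : ∀ {m} {f : Fin m → A} → Injective _≡_ _≡_ f → m ℕ.≤ n
  injective⇒≤ inj = Fin.injective⇒≤ (inj ∘ to-injective)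

  embedding⇒≤ : ∀ {m} {f : A → Fin m} → Injective _≡_ _≡_ f → n ℕ.≤ m
  embedding⇒≤ inj = Fin.injective⇒≤ (from-injective ∘ inj)

  preimage? : ∀ {m} (f : Fin m → A) x → Dec (∃[ i ] f i ≡ x)
  preimage? f x = Fin.any? (λ i → f i ≟ x)

  -- If every `g j` were hit, a choice of preimages would embed `Fin k` into `Fin m`. Vectors
  -- outside a span or outside a bad set are found in this way.
  escape : ∀ {m k} (g : Fin k → A) → Injective _≡_ _≡_ g → (f : Fin m → A) → m ℕ.< k →
           ∃[ j ] ∀ i → f i ≢ g j
  escape {m} {k} g g-injective f m<k with Fin.any? (λ j → Dec.¬? (preimage? f (g j)))
  ... | yes (j , no-preimage) = j , λ i eq → no-preimage (i , eq)
  ... | no  all-hit           = ⊥-elim (ℕ.<⇒≱ m<k (Fin.injective⇒≤ {f = section} section-injective))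
    where
    hit : ∀ j → ∃[ i ] f i ≡ g j
    hit j = Dec.decidable-stable (preimage? f (g j)) (λ none → all-hit (j , none))

    section : Fin k → Fin m
    section j = proj₁ (hit j)

    section-injective : Injective _≡_ _≡_ section
    section-injective {x} {y} eq = g-injective (trans (sym (proj₂ (hit x))) (trans (cong f eq) (proj₂ (hit y))))

  missed : ∀ {m} (f : Fin m → A) → m ℕ.< n → ∃[ x ] ∀ i → f i ≢ x
  missed f m<n with j , avoids ← escape from from-injective f m<n = from j , avoids

  -- If f were onto, `section` would be an injective self-map, hence a bijection with inverse f, and
  -- f could not identify x with y. The cubic extension rests on this.
  not-surjective : (f : A → A) {x y : A} → x ≢ y → f x ≡ f y → ∃[ z ] ∀ w → f w ≢ z
  not-surjective f {x} {y} x≢y fx≡fy with any? (λ z → Dec.¬? (any? (λ w → f w ≟ z)))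
  ... | yes (z , no-preimage) = z , λ w eq → no-preimage (w , eq)
  ... | no  all-hit           = ⊥-elim (x≢y (trans (sym (at-section x)) (trans (cong section fx≡fy) (at-section y))))
    where
    hit : ∀ z → ∃[ w ] f w ≡ z
    hit z = Dec.decidable-stable (any? (λ w → f w ≟ z)) (λ none → all-hit (z , none))

    section : A → A
    section z = proj₁ (hit z)

    section-injective : ∀ {z w} → section z ≡ section w → z ≡ w
    section-injective {z} {w} eq = trans (sym (proj₂ (hit z))) (trans (cong f eq) (proj₂ (hit w)))

    -- An injective self-map of a finite set hits every w: otherwise adding w
    -- to its values would embed n + 1 elements.
    at-section : ∀ w → section (f w) ≡ w
    at-section w with any? (λ z → section z ≟ w)
    ... | yes (z , eq) = trans (cong (section ∘ f) (sym eq)) (trans (cong section (proj₂ (hit z))) eq)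
    ... | no  missing  = ⊥-elim (ℕ.<-irrefl refl (injective⇒≤ {f = extended} extended-injective))
      where
      extended : Fin (suc n) → A
      extended zero    = w
      extended (suc i) = section (from i)

      extended-injective : Injective _≡_ _≡_ extended
      extended-injective {zero}  {zero}  _  = refl
      extended-injective {zero}  {suc j} eq = ⊥-elim (missing (from j , sym eq))
      extended-injective {suc i} {zero}  eq = ⊥-elim (missing (from i , eq))
      extended-injective {suc i} {suc j} eq = cong suc (from-injective (section-injective eq))

-- Subfields appear as predicates on a larger field, and this record counts them. `index` may depend
-- on the proof of `P x`; `complete` and `injective` make the dependence harmless.
record Enumeration {A : Set} (P : A → Set) : Set where
  field
    count     : ℕ
    element   : Fin count → A
    injective : Injective _≡_ _≡_ element
    sound     : ∀ i → P (element i)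
    index     : ∀ x → P x → Fin count
    complete  : ∀ x p → element (index x p) ≡ x

enumerateFin : ∀ n {P : Fin n → Set} → (∀ i → Dec (P i)) → Enumeration P
enumerateFin zero    P? = record
  { count = 0 ; element = λ () ; injective = λ { {()} } ; sound = λ () ; index = λ () ; complete = λ () }
enumerateFin (suc n) {P} P? with enumerateFin n (λ i → P? (suc i)) | P? zero
... | tail | no ¬p = record
  { count     = count
  ; element   = suc ∘ element
  ; injective = injective ∘ Fin.suc-injective
  ; sound     = sound
  ; index     = λ { zero p → ⊥-elim (¬p p) ; (suc i) p → index i p }
  ; complete  = λ { zero p → ⊥-elim (¬p p) ; (suc i) p → cong suc (complete i p) }
  } where open Enumeration tail
... | tail | yes p₀ = record
  { count     = suc count
  ; element   = λ { zero → zero ; (suc i) → suc (element i) }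
  ; injective = λ { {zero} {zero} _ → refl ; {suc i} {suc j} eq → cong suc (injective (Fin.suc-injective eq)) }
  ; sound     = λ { zero → p₀ ; (suc i) → sound i }
  ; index     = λ { zero p → zero ; (suc i) p → suc (index i p) }
  ; complete  = λ { zero p → refl ; (suc i) p → cong suc (complete i p) }
  } where open Enumeration tail

enumerate : ∀ {A : Set} {n} → A ↔ Fin n → {P : A → Set} → (∀ x → Dec (P x)) → Enumeration P
enumerate A↔ {P} P? = record
  { count     = count
  ; element   = from ∘ element
  ; injective = injective ∘ Finite.from-injective A↔
  ; sound     = sound
  ; index     = λ x p → index (to x) (subst P (sym (strictlyInverseʳ x)) p)
  ; complete  = λ x p → trans (cong from (complete (to x) _)) (strictlyInverseʳ x)
  }
  where
  open Inverse A↔ using (to; from; strictlyInverseʳ)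
  open Enumeration (enumerateFin _ (λ i → P? (from i)))

-- The pair of indices embeds A into count² codes. With real and imaginary parts for f and g this
-- bounds the subfield of index 2 from below.
pair-bound : ∀ {A B : Set} {n} → A ↔ Fin n → {P : B → Set} (E : Enumeration P) →
             {f g : A → B} → (∀ x → P (f x)) → (∀ x → P (g x)) →
             (∀ {x y} → f x ≡ f y → g x ≡ g y → x ≡ y) →
             n ℕ.≤ Enumeration.count E ℕ.* Enumeration.count E
pair-bound A↔ {P} E {f} {g} Pf Pg injective-pair = Finite.embedding⇒≤ A↔ {f = code} code-injective
  where
  open Enumeration E

  code : _ → Fin (count ℕ.* count)
  code x = Fin.combine (index (f x) (Pf x)) (index (g x) (Pg x))

  index-injective : ∀ {x y} (px : P x) (py : P y) → index x px ≡ index y py → x ≡ y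
  index-injective px py eq = trans (sym (complete _ px)) (trans (cong element eq) (complete _ py))

  code-injective : Injective _≡_ _≡_ code
  code-injective {x} {y} eq = injective-pair
    (index-injective (Pf x) (Pf y) (Fin.combine-injectiveˡ (index (f x) _) (index (g x) (Pg x)) (index (f y) _) (index (g y) (Pg y)) eq))
    (index-injective (Pg x) (Pg y) (Fin.combine-injectiveʳ (index (f x) (Pf x)) (index (g x) _) (index (f y) (Pf y)) (index (g y) _) eq))

-- Sums and products over the whole field run over indices, so a permutation of the field is carried
-- over to `Fin n` before reindexing.
conjugate : ∀ {A : Set} {n} → A ↔ Fin n → (f g : A → A) →
            (∀ x → f (g x) ≡ x) → (∀ x → g (f x) ≡ x) → Fin n ↔ Fin n
conjugate A↔ f g fg gf = mk↔ₛ′ (to ∘ f ∘ from) (to ∘ g ∘ from)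
  (λ i → trans (cong (to ∘ f) (strictlyInverseʳ _)) (trans (cong to (fg _)) (strictlyInverseˡ i)))
  (λ i → trans (cong (to ∘ g) (strictlyInverseʳ _)) (trans (cong to (gf _)) (strictlyInverseˡ i)))
  where open Inverse A↔ using (to; from; strictlyInverseˡ; strictlyInverseʳ)

funToFin-cong : ∀ {m n} {f g : Fin m → Fin n} → f ≗ g → Fin.funToFin f ≡ Fin.funToFin g
funToFin-cong {zero}  eq = refl
funToFin-cong {suc m} eq = cong₂ Fin.combine (eq zero) (funToFin-cong (eq ∘ suc))

-- Finite fields

prime∤! : ∀ {p} → Prime p → ∀ k → k ℕ.< p → ¬ p ∣ k ℕ.!
prime∤! pr zero    _   p∣1 = ℕ.<-irrefl (sym (∣1⇒≡1 p∣1)) (ℕ.nonTrivial⇒n>1 _ {{prime⇒nonTrivial pr}})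
prime∤! pr (suc k) k<p p∣k! with euclidsLemma (suc k) (k ℕ.!) pr p∣k!
... | inj₁ p∣k = ℕ.<⇒≱ k<p (∣⇒≤ p∣k)
... | inj₂ p∣  = prime∤! pr k (ℕ.<-trans (ℕ.n<1+n k) k<p) p∣

-- p divides p!, the product of the binomial coefficient with k! and (p - k)!, but neither of these
-- factorials, whose factors are all below p.
prime∣binomial : ∀ {p} → Prime p → ∀ k → 0 ℕ.< k → k ℕ.< p → p ∣ p C k
prime∣binomial {p} pr k 0<k k<p = from-factorial (euclidsLemma (p C k) _ pr p∣product)
  where
  instance
    p≢0 : ℕ.NonZero p
    p≢0 = prime⇒nonZero pr

    k!≢0 : ℕ.NonZero (k ℕ.! ℕ.* (p ℕ.∸ k) ℕ.!)
    k!≢0 = k ℕ.!* (p ℕ.∸ k) !≢0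

  product≡p! : (p C k) ℕ.* (k ℕ.! ℕ.* (p ℕ.∸ k) ℕ.!) ≡ p ℕ.!
  product≡p! = trans (ℕ.*-comm (p C k) _)
    (trans (cong (λ c → k ℕ.! ℕ.* (p ℕ.∸ k) ℕ.! ℕ.* c) (nCk≡n!/k![n-k]! (ℕ.<⇒≤ k<p)))
      (m*[n/m]≡n (k![n∸k]!∣n! (ℕ.<⇒≤ k<p))))

  p∣! : ∀ n .{{_ : ℕ.NonZero n}} → n ∣ n ℕ.!
  p∣! (suc n) = m∣m*n (n ℕ.!)

  p∣product : p ∣ (p C k) ℕ.* (k ℕ.! ℕ.* (p ℕ.∸ k) ℕ.!)
  p∣product = subst (p ∣_) (sym product≡p!) (p∣! p)

  from-factorial : p ∣ p C k ⊎ p ∣ k ℕ.! ℕ.* (p ℕ.∸ k) ℕ.! → p ∣ p C k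
  from-factorial (inj₁ p∣C) = p∣C
  from-factorial (inj₂ p∣!!) with euclidsLemma (k ℕ.!) _ pr p∣!!
  ... | inj₁ p∣k! = ⊥-elim (prime∤! pr k k<p p∣k!)
  ... | inj₂ p∣r! = ⊥-elim (prime∤! pr (p ℕ.∸ k) (ℕ.∸-monoʳ-< 0<k (ℕ.<⇒≤ k<p)) p∣r!)

-- Equality is `_≡_` rather than a setoid relation, so that equations can be substituted and matched
-- on; the bijection with `Fin size` makes it decidable.
record FiniteField : Set₁ where
  infixl 7 _*_
  infixl 6 _+_
  infix  8 -_
  field
    Carrier           : Set
    _+_ _*_           : Carrier → Carrier → Carrier
    -_                : Carrier → Carrier
    0# 1#             : Carrier
    isCommutativeRing : IsCommutativeRing _≡_ _+_ _*_ -_ 0# 1#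
    0≢1               : 0# ≢ 1#
    inverse           : ∀ x → x ≢ 0# → ∃[ y ] x * y ≡ 1#
    size              : ℕ
    finite            : Carrier ↔ Fin size

  commutativeRing : CommutativeRing 0ℓ 0ℓ
  commutativeRing = record { isCommutativeRing = isCommutativeRing }

  open CommutativeRing commutativeRing public
    using (_-_; +-assoc; +-comm; +-identityˡ; +-identityʳ; *-assoc; *-comm; *-identityˡ; *-identityʳ;
           distribˡ; distribʳ; zeroˡ; zeroʳ; -‿inverseˡ; -‿inverseʳ; commutativeSemiring; semiring;
           +-commutativeMonoid; *-commutativeMonoid)
  open Finite finite public
  open IntegerSolver commutativeRing public
  open Exp commutativeSemiring public using (_^_; ^-homo-*; ^-assocʳ; ^-distrib-*)

module FieldTheory (𝔽 : FiniteField) where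
  open FiniteField 𝔽
  open ≡-Reasoning
  open Inverse finite using (to; from; strictlyInverseˡ; strictlyInverseʳ)

  x-y≡0⇒x≡y : ∀ {x y} → x - y ≡ 0# → x ≡ y
  x-y≡0⇒x≡y {x} {y} eq = begin
    x            ≡⟨ solve 2 (λ x y → x := (x :- y) :+ y) refl x y ⟩
    (x - y) + y  ≡⟨ cong (_+ y) eq ⟩
    0# + y       ≡⟨ +-identityˡ y ⟩
    y            ∎

  x≡y⇒x-y≡0 : ∀ {x y} → x ≡ y → x - y ≡ 0#
  x≡y⇒x-y≡0 {x} refl = -‿inverseʳ x

  nonzero-*-≡0 : ∀ {x y} → x ≢ 0# → x * y ≡ 0# → y ≡ 0#
  nonzero-*-≡0 {x} {y} x≢0 xy≡0 with x⁻¹ , inv ← inverse x x≢0 = begin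
    y                ≡⟨ *-identityˡ y ⟨
    1# * y           ≡⟨ cong (_* y) inv ⟨
    (x * x⁻¹) * y    ≡⟨ solve 3 (λ x i y → (x :* i) :* y := i :* (x :* y)) refl x x⁻¹ y ⟩
    x⁻¹ * (x * y)    ≡⟨ cong (x⁻¹ *_) xy≡0 ⟩
    x⁻¹ * 0#         ≡⟨ zeroʳ x⁻¹ ⟩
    0#               ∎

  *-nonzero : ∀ {x y} → x ≢ 0# → y ≢ 0# → x * y ≢ 0#
  *-nonzero x≢0 y≢0 xy≡0 = y≢0 (nonzero-*-≡0 x≢0 xy≡0)

  *-cancelˡ : ∀ {x y z} → x ≢ 0# → x * y ≡ x * z → y ≡ z
  *-cancelˡ {x} {y} {z} x≢0 eq = x-y≡0⇒x≡y (nonzero-*-≡0 x≢0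
    (trans (solve 3 (λ x y z → x :* (y :- z) := x :* y :- x :* z) refl x y z) (x≡y⇒x-y≡0 eq)))

  x*y≡1⇒x≢0 : ∀ {x y} → x * y ≡ 1# → x ≢ 0#
  x*y≡1⇒x≢0 {y = y} xy≡1 refl = 0≢1 (trans (sym (zeroˡ y)) xy≡1)

  -- 0 ⁻¹ is 0.
  infix 9 _⁻¹
  _⁻¹ : Carrier → Carrier
  x ⁻¹ with x ≟ 0#
  ... | yes _   = 0#
  ... | no  x≢0 = proj₁ (inverse x x≢0)

  *-inverseʳ : ∀ {x} → x ≢ 0# → x * x ⁻¹ ≡ 1#
  *-inverseʳ {x} x≢0 with x ≟ 0#
  ... | yes x≡0  = ⊥-elim (x≢0 x≡0)
  ... | no  x≢0′ = proj₂ (inverse x x≢0′)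

  ⁻¹-nonzero : ∀ {x} → x ≢ 0# → x ⁻¹ ≢ 0#
  ⁻¹-nonzero {x} x≢0 = x*y≡1⇒x≢0 {y = x} (trans (*-comm (x ⁻¹) x) (*-inverseʳ x≢0))

  *-⁻¹-cancel : ∀ {x} y → x ≢ 0# → x * (x ⁻¹ * y) ≡ y
  *-⁻¹-cancel {x} y x≢0 = trans (sym (*-assoc x (x ⁻¹) y)) (trans (cong (_* y) (*-inverseʳ x≢0)) (*-identityˡ y))

  ^-nonzero : ∀ {x} n → x ≢ 0# → x ^ n ≢ 0#
  ^-nonzero zero    x≢0 = 0≢1 ∘ sym
  ^-nonzero (suc n) x≢0 = *-nonzero x≢0 (^-nonzero n x≢0)

  1^ : ∀ n → 1# ^ n ≡ 1#
  1^ zero    = refl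
  1^ (suc n) = trans (*-identityˡ _) (1^ n)

  1<size : 1 ℕ.< size
  1<size = injective⇒≤ {f = λ { zero → 0# ; (suc _) → 1# }}
    λ { {zero} {zero} _ → refl ; {zero} {suc zero} eq → ⊥-elim (0≢1 eq)
      ; {suc zero} {zero} eq → ⊥-elim (0≢1 (sym eq)) ; {suc zero} {suc zero} _ → refl }

  0^ : ∀ n → 0 ℕ.< n → 0# ^ n ≡ 0#
  0^ (suc n) _ = zeroˡ _

  private
    module Σ+ = Sum +-commutativeMonoid
    module Π* = Sum *-commutativeMonoid

    Π-nonzero : ∀ {n} (f : Fin n → Carrier) → (∀ i → f i ≢ 0#) → Π*.sum f ≢ 0#
    Π-nonzero {zero}  f _   = 0≢1 ∘ sym
    Π-nonzero {suc n} f f≢0 = *-nonzero (f≢0 zero) (Π-nonzero (f ∘ suc) (f≢0 ∘ suc))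

    Π-single : ∀ {n} (f : Fin n → Carrier) i → (∀ j → i ≢ j → f j ≡ 1#) → Π*.sum f ≡ f i
    Π-single {suc n} f i f≡1 = begin
      Π*.sum f                                    ≡⟨ Π*.sum-remove {i = i} f ⟩
      f i * Π*.sum (f ∘ Fin.punchIn i)            ≡⟨ cong (f i *_) (Π*.sum-cong-≗ λ j → f≡1 _ (Fin.punchInᵢ≢i i j ∘ sym)) ⟩
      f i * Π*.sum (λ (_ : Fin n) → 1#)           ≡⟨ cong (f i *_) (Π*.sum-replicate-zero n) ⟩
      f i * 1#                                    ≡⟨ *-identityʳ (f i) ⟩
      f i                                         ∎

    0<size : 0 ℕ.< size
    0<size = ℕ.<-trans ℕ.z<s 1<size

  module _ {x : Carrier} (x≢0 : x ≢ 0#) where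
    private
      at-zero : Carrier → Carrier → Carrier → Carrier
      at-zero u v y with y ≟ 0#
      ... | yes _ = u
      ... | no  _ = v

      at-zero-yes : ∀ u v → at-zero u v 0# ≡ u
      at-zero-yes u v with 0# ≟ 0#
      ... | yes _   = refl
      ... | no  0≢0 = ⊥-elim (0≢0 refl)

      at-zero-no : ∀ u v {y} → y ≢ 0# → at-zero u v y ≡ v
      at-zero-no u v {y} y≢0 with y ≟ 0#
      ... | yes y≡0 = ⊥-elim (y≢0 y≡0)
      ... | no  _   = refl

      -- The product of all units is taken over the whole field with 0 replaced by 1. `scale` is the
      -- factor that each term gains under multiplication by x, and `correct` supplies the x missing
      -- at 0, which leads to x^size = x instead of x^(size - 1) = 1.
      units scale correct : Carrier → Carrier
      units y   = at-zero 1# y y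
      scale y   = at-zero 1# x y
      correct y = at-zero x 1# y

      units-nonzero : ∀ y → units y ≢ 0#
      units-nonzero y with y ≟ 0#
      ... | yes _   = 0≢1 ∘ sym
      ... | no  y≢0 = y≢0

      units-scale : ∀ y → units (x * y) ≡ scale y * units y
      units-scale y with y ≟ 0#
      ... | yes refl = trans (cong units (zeroʳ x)) (trans (at-zero-yes 1# 0#) (sym (*-identityˡ 1#)))
      ... | no  y≢0  = at-zero-no 1# (x * y) (*-nonzero x≢0 y≢0)

      scale-correct : ∀ y → scale y * correct y ≡ x
      scale-correct y with y ≟ 0#
      ... | yes _ = *-identityˡ x
      ... | no  _ = *-identityʳ x

      Π : (Carrier → Carrier) → Carrier
      Π f = Π*.sum (f ∘ from)

      -- Multiplication by x permutes the field, so the product of all units equals itself times the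
      -- product of the factors.
      Π-scale : Π scale ≡ 1#
      Π-scale = sym (*-cancelˡ (Π-nonzero (units ∘ from) (units-nonzero ∘ from)) (begin
        Π units * 1#              ≡⟨ *-identityʳ _ ⟩
        Π units                   ≡⟨ Π*.sum-permute (units ∘ from) (conjugate finite (x *_) (x ⁻¹ *_)
                                       (λ y → *-⁻¹-cancel y x≢0)
                                       (λ y → trans (solve 3 (λ i x y → i :* (x :* y) := x :* (i :* y)) refl (x ⁻¹) x y) (*-⁻¹-cancel y x≢0))) ⟩
        Π*.sum (λ i → units (from (to (x * from i))))
                                  ≡⟨ Π*.sum-cong-≗ (λ i → trans (cong units (strictlyInverseʳ _)) (units-scale (from i))) ⟩
        Π (λ y → scale y * units y)  ≡⟨ Π*.∑-distrib-+ (scale ∘ from) (units ∘ from) ⟩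
        Π scale * Π units         ≡⟨ *-comm _ _ ⟩
        Π units * Π scale         ∎))

    ^-size-nonzero : x ^ size ≡ x
    ^-size-nonzero = begin
      x ^ size                       ≡⟨ Π*.sum-replicate size ⟨
      Π (λ _ → x)                    ≡⟨ Π*.sum-cong-≗ (scale-correct ∘ from) ⟨
      Π (λ y → scale y * correct y)  ≡⟨ Π*.∑-distrib-+ (scale ∘ from) (correct ∘ from) ⟩
      Π scale * Π correct            ≡⟨ cong₂ _*_ Π-scale (Π-single (correct ∘ from) (to 0#) λ j ≢j →
                                          at-zero-no x 1# λ eq → ≢j (trans (cong to (sym eq)) (strictlyInverseˡ j))) ⟩
      1# * correct (from (to 0#))    ≡⟨ *-identityˡ _ ⟩
      correct (from (to 0#))         ≡⟨ cong correct (strictlyInverseʳ 0#) ⟩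
      correct 0#                     ≡⟨ at-zero-yes x 1# ⟩
      x                              ∎

  ^-size : ∀ x → x ^ size ≡ x
  ^-size x with x ≟ 0#
  ... | yes refl = 0^ size 0<size
  ... | no  x≢0  = ^-size-nonzero x≢0

  open Mult semiring using (×1-homo-*; ×-assoc-*; ×-assocˡ) renaming (_×_ to _·_) public

  -- Adding 1 permutes the field and therefore fixes the sum of all its elements.
  size·1≡0 : size · 1# ≡ 0#
  size·1≡0 = begin
    size · 1#                                ≡⟨ solve 2 (λ s t → t := (s :+ t) :- s) refl total (size · 1#) ⟩
    (total + size · 1#) - total              ≡⟨ cong (_- total) (sym shifted) ⟩
    total - total                            ≡⟨ -‿inverseʳ total ⟩
    0#                                       ∎
    where
    total : Carrier
    total = Σ+.sum from

    shifted : total ≡ total + size · 1#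
    shifted = begin
      total                                  ≡⟨ Σ+.sum-permute from (conjugate finite (_+ 1#) (_- 1#)
                                                  (λ y → solve 1 (λ y → y :- :1 :+ :1 := y) refl y)
                                                  (λ y → solve 1 (λ y → y :+ :1 :- :1 := y) refl y)) ⟩
      Σ+.sum (λ i → from (to (from i + 1#)))  ≡⟨ Σ+.sum-cong-≗ {size} (λ i → strictlyInverseʳ _) ⟩
      Σ+.sum (λ i → from i + 1#)             ≡⟨ Σ+.∑-distrib-+ from (λ _ → 1#) ⟩
      total + Σ+.sum (λ (_ : Fin size) → 1#)  ≡⟨ cong (total +_) (Σ+.sum-replicate size) ⟩
      total + size · 1#                      ∎

  -- Coefficients are listed from degree 0 on, below a leading coefficient 1.
  evalMonic : ∀ {d} → Vec Carrier d → Carrier → Carrier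
  evalMonic []       x = 1#
  evalMonic (c ∷ cs) x = c + x * evalMonic cs x

  -- Synthetic division by X - r: the coefficients of the quotient are the Horner tails evaluated at
  -- r.
  divide : ∀ {d} → Carrier → Vec Carrier (suc d) → Vec Carrier d
  divide {zero}  r (c ∷ [])  = []
  divide {suc d} r (c ∷ cs) = evalMonic cs r ∷ divide r cs

  divide-correct : ∀ {d} r (cs : Vec Carrier (suc d)) x →
                   evalMonic cs x - evalMonic cs r ≡ (x - r) * evalMonic (divide r cs) x
  divide-correct {zero}  r (c ∷ [])  x =
    solve 3 (λ c x r → c :+ x :* :1 :- (c :+ r :* :1) := (x :- r) :* :1) refl c x r
  divide-correct {suc d} r (c ∷ cs) x = begin
    (c + x * gx) - (c + r * gr)     ≡⟨ solve 5 (λ c x r gx gr → (c :+ x :* gx) :- (c :+ r :* gr) := (x :- r) :* gr :+ x :* (gx :- gr)) refl c x r gx gr ⟩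
    (x - r) * gr + x * (gx - gr)    ≡⟨ cong (λ h → (x - r) * gr + x * h) (divide-correct r cs x) ⟩
    (x - r) * gr + x * ((x - r) * h) ≡⟨ solve 4 (λ x r gr h → (x :- r) :* gr :+ x :* ((x :- r) :* h) := (x :- r) :* (gr :+ x :* h)) refl x r gr h ⟩
    (x - r) * (gr + x * h)          ∎
    where
    gx gr h : Carrier
    gx = evalMonic cs x
    gr = evalMonic cs r
    h  = evalMonic (divide r cs) x

  -- Dividing by X - r for the first root r lowers the degree, and the other roots survive in the
  -- quotient because they differ from r.
  root-bound : ∀ {d} (cs : Vec Carrier d) {n} (root : Fin n → Carrier) → Injective _≡_ _≡_ root →
               (∀ i → evalMonic cs (root i) ≡ 0#) → n ℕ.≤ d
  root-bound cs       {zero}  root inj vanish = ℕ.z≤n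
  root-bound []       {suc n} root inj vanish = ⊥-elim (0≢1 (sym (vanish zero)))
  root-bound (c ∷ cs) {suc n} root inj vanish =
    ℕ.s≤s (root-bound (divide (root zero) (c ∷ cs)) (root ∘ suc) (Fin.suc-injective ∘ inj) λ i →
      nonzero-*-≡0 (λ eq → Fin.0≢1+n (sym (inj (x-y≡0⇒x≡y eq))))
        (trans (sym (divide-correct (root zero) (c ∷ cs) (root (suc i))))
          (trans (cong₂ _-_ (vanish (suc i)) (vanish zero)) (-‿inverseʳ 0#))))

  private
    -- The polynomial X^(e+1+k) - X^e, its leading coefficient being implicit.
    binomialCoefficients : ∀ e k → Vec Carrier (e ℕ.+ suc k)
    binomialCoefficients e k = Vec.replicate e 0# Vec.++ (- 1#) ∷ Vec.replicate k 0#

    eval-zeros : ∀ e {d} (cs : Vec Carrier d) x → evalMonic (Vec.replicate e 0# Vec.++ cs) x ≡ x ^ e * evalMonic cs x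
    eval-zeros zero    cs x = sym (*-identityˡ _)
    eval-zeros (suc e) cs x = trans (+-identityˡ _)
      (trans (cong (x *_) (eval-zeros e cs x)) (sym (*-assoc x (x ^ e) _)))

    eval-power : ∀ k x → evalMonic (Vec.replicate k 0#) x ≡ x ^ k
    eval-power zero    x = refl
    eval-power (suc k) x = trans (+-identityˡ _) (cong (x *_) (eval-power k x))

    eval-binomial : ∀ e k x → evalMonic (binomialCoefficients e k) x ≡ x ^ (e ℕ.+ suc k) - x ^ e
    eval-binomial e k x = begin
      evalMonic (binomialCoefficients e k) x               ≡⟨ eval-zeros e _ x ⟩
      x ^ e * (- 1# + x * evalMonic (Vec.replicate k 0#) x) ≡⟨ cong (λ y → x ^ e * (- 1# + x * y)) (eval-power k x) ⟩
      x ^ e * (- 1# + x ^ suc k)                           ≡⟨ solve 2 (λ a b → a :* (:- :1 :+ b) := a :* b :- a) refl (x ^ e) (x ^ suc k) ⟩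
      x ^ e * x ^ suc k - x ^ e                            ≡⟨ cong (_- x ^ e) (^-homo-* x e (suc k)) ⟨
      x ^ (e ℕ.+ suc k) - x ^ e                            ∎

  -- The elements are roots of X^D - X^e. With e = 1 and D = q^j this bounds the number of fixed
  -- points of `φ j`.
  power-bound : ∀ {e D n} → e ℕ.< D → (root : Fin n → Carrier) → Injective _≡_ _≡_ root →
                (∀ i → root i ^ D ≡ root i ^ e) → n ℕ.≤ D
  power-bound {e} {D} {n} e<D root inj same with k , eq ← ℕ.m≤n⇒∃[o]m+o≡n e<D =
    subst (n ℕ.≤_) e+1+k≡D (root-bound (binomialCoefficients e k) root inj λ i →
      trans (eval-binomial e k (root i)) (x≡y⇒x-y≡0 (trans (cong (root i ^_) e+1+k≡D) (same i))))
    where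
    e+1+k≡D : e ℕ.+ suc k ≡ D
    e+1+k≡D = trans (ℕ.+-suc e k) eq

  -- The source of ω, of elements whose norm leaves F and of the constant in the twisted shift: each
  -- has to violate one equation x^D = x^e whose degree is below the number of candidates.
  distinct-powers : ∀ {e D n} → e ℕ.< D → D ℕ.< n → (el : Fin n → Carrier) → Injective _≡_ _≡_ el →
                    ∃[ i ] el i ^ D ≢ el i ^ e
  distinct-powers {e} {D} {n} e<D D<n el inj =
    Fin.¬∀⟶∃¬ n _ (λ i → (el i ^ D) ≟ (el i ^ e)) λ same → ℕ.<⇒≱ D<n (power-bound e<D el inj same)

-- Field embeddings, Frobenius powers and their fixed points

record Embedding (F K : FiniteField) : Set where
  private
    module F = FiniteField F
    module K = FiniteField K
  field
    ι      : F.Carrier → K.Carrier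
    ι-+    : ∀ x y → ι (x F.+ y) ≡ ι x K.+ ι y
    ι-*    : ∀ x y → ι (x F.* y) ≡ ι x K.* ι y
    ι-1    : ι F.1# ≡ K.1#

  open FieldTheory K using (x*y≡1⇒x≢0)
  private
    module FT = FieldTheory F
    module KT = FieldTheory K

  ι-0 : ι F.0# ≡ K.0#
  ι-0 = trans (K.solve 1 (λ x → x K.:= (x K.:+ x) K.:- x) refl (ι F.0#))
    (trans (cong (K._- ι F.0#) (trans (sym (ι-+ F.0# F.0#)) (cong ι (F.+-identityˡ F.0#)))) (K.-‿inverseʳ _))

  ι-neg : ∀ x → ι (F.- x) ≡ K.- ι x
  ι-neg x = trans (K.solve 2 (λ x y → y K.:= (x K.:+ y) K.:- x) refl (ι x) (ι (F.- x)))
    (trans (cong (K._- ι x) (trans (sym (ι-+ x (F.- x))) (trans (cong ι (F.-‿inverseʳ x)) ι-0))) (K.+-identityˡ _))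

  ι-nonzero : ∀ {x} → x ≢ F.0# → ι x ≢ K.0#
  ι-nonzero {x} x≢0 with y , xy≡1 ← F.inverse x x≢0 =
    x*y≡1⇒x≢0 {y = ι y} (trans (sym (ι-* x y)) (trans (cong ι xy≡1) ι-1))

  ι-injective : ∀ {x y} → ι x ≡ ι y → x ≡ y
  ι-injective {x} {y} eq with (x F.- y) F.≟ F.0#
  ... | yes x-y≡0 = FT.x-y≡0⇒x≡y x-y≡0
  ... | no  x-y≢0 = ⊥-elim (ι-nonzero x-y≢0
    (trans (ι-+ x (F.- y)) (trans (cong (ι x K.+_) (ι-neg y)) (KT.x≡y⇒x-y≡0 eq))))

  ι-^ : ∀ x n → ι (x F.^ n) ≡ ι x K.^ n
  ι-^ x zero    = ι-1
  ι-^ x (suc n) = trans (ι-* x (x F.^ n)) (cong (ι x K.*_) (ι-^ x n))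

-- The prime and its exponent are carried for the additivity of x ↦ x^q, which comes from the
-- binomial coefficients modulo p.
record Extension (m : ℕ) : Set₁ where
  field
    {p}    : ℕ
    prime  : Prime p
    e      : ℕ
    F K    : FiniteField
    size-F : FiniteField.size F ≡ p ℕ.^ e
    size-K : FiniteField.size K ≡ FiniteField.size F ℕ.^ m
    F→K    : Embedding F K

module Frobenius {m : ℕ} (X : Extension m) where
  open Extension X
  open FiniteField K
  open FieldTheory K
  open Embedding F→K
  open ≡-Reasoning
  private
    module F = FiniteField F
    module FT = FieldTheory F
    module Σ+ = Sum +-commutativeMonoid

  q : ℕ
  q = F.size

  private
    power·1 : ∀ n k → (n ℕ.^ k) · 1# ≡ (n · 1#) ^ k
    power·1 n zero    = +-identityʳ 1#
    power·1 n (suc k) = trans (×1-homo-* n (n ℕ.^ k)) (cong (n · 1# *_) (power·1 n k))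

    ^-zero : ∀ x k → x ^ k ≡ 0# → x ≡ 0#
    ^-zero x k eq with x ≟ 0#
    ... | yes x≡0 = x≡0
    ... | no  x≢0 = ⊥-elim (^-nonzero k x≢0 eq)

    size≡p^ : size ≡ p ℕ.^ (e ℕ.* m)
    size≡p^ = trans size-K (trans (cong (ℕ._^ m) size-F) (ℕ.^-*-assoc p e m))

    -- The size of the field is a power of p, so `size·1≡0` says that a power of p · 1 vanishes, and
    -- a field has no nilpotent elements.
    p·1≡0 : p · 1# ≡ 0#
    p·1≡0 = ^-zero _ (e ℕ.* m) (trans (sym (power·1 p (e ℕ.* m))) (trans (cong (_· 1#) (sym size≡p^)) size·1≡0))

    p∣⇒·≡0 : ∀ {n} x → p ∣ n → n · x ≡ 0#
    p∣⇒·≡0 x (divides c refl) = begin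
      (c ℕ.* p) · x      ≡⟨ cong (_· x) (ℕ.*-comm c p) ⟩
      (p ℕ.* c) · x      ≡⟨ ×-assocˡ x p c ⟨
      p · (c · x)        ≡⟨ cong (p ·_) (*-identityˡ _) ⟨
      p · (1# * (c · x)) ≡⟨ ×-assoc-* p 1# (c · x) ⟨
      (p · 1#) * (c · x) ≡⟨ cong (_* (c · x)) p·1≡0 ⟩
      0# * (c · x)       ≡⟨ zeroˡ _ ⟩
      0#                 ∎

    -- p divides the inner binomial coefficients, so only the two outer terms remain. The exponent
    -- has the form `suc n` to let the last summand be split off.
    ^-p-+′ : ∀ {n} → p ≡ suc n → ∀ x y → (x + y) ^ suc n ≡ x ^ suc n + y ^ suc n
    ^-p-+′ {n} refl x y = begin
      (x + y) ^ suc n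
        ≡⟨ Binomial.theorem commutativeSemiring (suc n) x y ⟩
      term zero + Σ+.sum (term ∘ suc)
        ≡⟨ cong (term zero +_) (Σ+.sum-init-last (term ∘ suc)) ⟩
      term zero + (Σ+.sum (term ∘ suc ∘ Fin.inject₁) + term (suc (Fin.fromℕ n)))
        ≡⟨ cong₂ (λ s t → term zero + (s + t)) (trans (Σ+.sum-cong-≗ middle) (Σ+.sum-replicate-zero n)) last ⟩
      term zero + (0# + x ^ suc n)
        ≡⟨ cong (_+ (0# + x ^ suc n)) (+-identityʳ _) ⟩
      1# * y ^ suc n + (0# + x ^ suc n)
        ≡⟨ solve 2 (λ a b → :1 :* b :+ (:0 :+ a) := a :+ b) refl (x ^ suc n) (y ^ suc n) ⟩
      x ^ suc n + y ^ suc n ∎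
      where
      term : Fin (suc (suc n)) → Carrier
      term = Binomial.binomialTerm commutativeSemiring x y (suc n)

      middle : ∀ (i : Fin n) → term (suc (Fin.inject₁ i)) ≡ 0#
      middle i = p∣⇒·≡0 _ (prime∣binomial prime _ ℕ.z<s (ℕ.s<s (subst (ℕ._< n) (sym (Fin.toℕ-inject₁ i)) (Fin.toℕ<n i))))

      last : term (suc (Fin.fromℕ n)) ≡ x ^ suc n
      last = begin
        term (suc (Fin.fromℕ n))
          ≡⟨ cong (λ k → (suc n C suc k) · (x ^ suc k * y ^ (n ℕ.∸ k))) (Fin.toℕ-fromℕ n) ⟩
        (suc n C suc n) · (x ^ suc n * y ^ (n ℕ.∸ n))
          ≡⟨ cong₂ (λ c k → c · (x ^ suc n * y ^ k)) (nCn≡1 (suc n)) (ℕ.n∸n≡0 n) ⟩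
        x ^ suc n * 1# + 0#
          ≡⟨ trans (+-identityʳ _) (*-identityʳ _) ⟩
        x ^ suc n ∎

    ^-p-+ : ∀ x y → (x + y) ^ p ≡ x ^ p + y ^ p
    ^-p-+ x y = subst (λ r → (x + y) ^ r ≡ x ^ r + y ^ r) suc-pred (^-p-+′ (sym suc-pred) x y)
      where
      suc-pred : suc (ℕ.pred p) ≡ p
      suc-pred = ℕ.suc-pred p {{prime⇒nonZero prime}}

    ^-p^-+ : ∀ k x y → (x + y) ^ (p ℕ.^ k) ≡ x ^ (p ℕ.^ k) + y ^ (p ℕ.^ k)
    ^-p^-+ zero    x y = solve 2 (λ x y → (x :+ y) :* :1 := x :* :1 :+ y :* :1) refl x y
    ^-p^-+ (suc k) x y = begin
      (x + y) ^ (p ℕ.* p ℕ.^ k)                   ≡⟨ ^-assocʳ (x + y) p (p ℕ.^ k) ⟨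
      ((x + y) ^ p) ^ (p ℕ.^ k)                   ≡⟨ cong (_^ (p ℕ.^ k)) (^-p-+ x y) ⟩
      (x ^ p + y ^ p) ^ (p ℕ.^ k)                 ≡⟨ ^-p^-+ k (x ^ p) (y ^ p) ⟩
      (x ^ p) ^ (p ℕ.^ k) + (y ^ p) ^ (p ℕ.^ k)   ≡⟨ cong₂ _+_ (^-assocʳ x p _) (^-assocʳ y p _) ⟩
      x ^ (p ℕ.* p ℕ.^ k) + y ^ (p ℕ.* p ℕ.^ k)   ∎

  φ : ℕ → Carrier → Carrier
  φ j x = x ^ (q ℕ.^ j)

  φ-+ : ∀ j x y → φ j (x + y) ≡ φ j x + φ j y
  φ-+ j x y = subst (λ r → (x + y) ^ r ≡ x ^ r + y ^ r)
    (trans (sym (ℕ.^-*-assoc p e j)) (cong (ℕ._^ j) (sym size-F))) (^-p^-+ (e ℕ.* j) x y)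

  φ-* : ∀ j x y → φ j (x * y) ≡ φ j x * φ j y
  φ-* j x y = ^-distrib-* x y (q ℕ.^ j)

  φ-1 : ∀ j → φ j 1# ≡ 1#
  φ-1 j = 1^ (q ℕ.^ j)

  φ-0 : ∀ j → φ j 0# ≡ 0#
  φ-0 j = 0^ (q ℕ.^ j) (ℕ.m^n>0 q {{ℕ.>-nonZero (ℕ.<-trans ℕ.z<s FT.1<size)}} j)

  φ-neg : ∀ j x → φ j (- x) ≡ - φ j x
  φ-neg j x = begin
    φ j (- x)                       ≡⟨ solve 2 (λ x y → y := (y :+ x) :- x) refl (φ j x) (φ j (- x)) ⟩
    (φ j (- x) + φ j x) - φ j x     ≡⟨ cong (_- φ j x) (φ-+ j (- x) x) ⟨
    φ j (- x + x) - φ j x           ≡⟨ cong (λ y → φ j y - φ j x) (-‿inverseˡ x) ⟩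
    φ j 0# - φ j x                  ≡⟨ cong (_- φ j x) (φ-0 j) ⟩
    0# - φ j x                      ≡⟨ +-identityˡ _ ⟩
    - φ j x                         ∎

  φ-sub : ∀ j x y → φ j (x - y) ≡ φ j x - φ j y
  φ-sub j x y = trans (φ-+ j x (- y)) (cong (φ j x +_) (φ-neg j y))

  φ-^ : ∀ j x n → φ j (x ^ n) ≡ φ j x ^ n
  φ-^ j x n = trans (^-assocʳ x n (q ℕ.^ j))
    (trans (cong (x ^_) (ℕ.*-comm n (q ℕ.^ j))) (sym (^-assocʳ x (q ℕ.^ j) n)))

  φ-compose : ∀ i j x → φ i (φ j x) ≡ φ (i ℕ.+ j) x
  φ-compose i j x = trans (^-assocʳ x (q ℕ.^ j) (q ℕ.^ i))
    (cong (x ^_) (trans (ℕ.*-comm (q ℕ.^ j) (q ℕ.^ i)) (sym (ℕ.^-distribˡ-+-* q i j))))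

  φ-period : ∀ x → φ m x ≡ x
  φ-period x = trans (cong (x ^_) (sym size-K)) (^-size x)

  φ-nonzero : ∀ j {x} → x ≢ 0# → φ j x ≢ 0#
  φ-nonzero j = ^-nonzero (q ℕ.^ j)

  φ-injective : ∀ j {x y} → φ j x ≡ φ j y → x ≡ y
  φ-injective j {x} {y} eq with (x - y) ≟ 0#
  ... | yes x-y≡0 = x-y≡0⇒x≡y x-y≡0
  ... | no  x-y≢0 = ⊥-elim (φ-nonzero j x-y≢0 (trans (φ-sub j x y) (x≡y⇒x-y≡0 eq)))

  -- In a field of order q^m these are the elements of the subfield of order q^gcd(j, m).
  -- Intersections of subfields become arithmetic of Frobenius exponents.
  Fixed : ℕ → Carrier → Set
  Fixed j x = φ j x ≡ x

  fixed-+ : ∀ {j x y} → Fixed j x → Fixed j y → Fixed j (x + y)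
  fixed-+ {j} fx fy = trans (φ-+ j _ _) (cong₂ _+_ fx fy)

  fixed-* : ∀ {j x y} → Fixed j x → Fixed j y → Fixed j (x * y)
  fixed-* {j} fx fy = trans (φ-* j _ _) (cong₂ _*_ fx fy)

  fixed-neg : ∀ {j x} → Fixed j x → Fixed j (- x)
  fixed-neg {j} fx = trans (φ-neg j _) (cong -_ fx)

  fixed-^ : ∀ {j x} n → Fixed j x → Fixed j (x ^ n)
  fixed-^ {j} n fx = trans (φ-^ j _ n) (cong (_^ n) fx)

  fixed-φ : ∀ {j x} i → Fixed j x → Fixed j (φ i x)
  fixed-φ {j} {x} i fx = fixed-^ {j} (q ℕ.^ i) fx

  fixed-⁻¹ : ∀ {j x} → Fixed j x → Fixed j (x ⁻¹)
  fixed-⁻¹ {j} {x} fx with x ≟ 0#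
  ... | yes _   = φ-0 j
  ... | no  x≢0 with y , xy≡1 ← inverse x x≢0 = *-cancelˡ x≢0
    (trans (cong (_* φ j y) (sym fx)) (trans (sym (φ-* j x y)) (trans (cong (φ j) xy≡1) (trans (φ-1 j) (sym xy≡1)))))

  fixed-multiple : ∀ {j x} c → Fixed j x → Fixed (c ℕ.* j) x
  fixed-multiple {j} {x} zero    fx = *-identityʳ x
  fixed-multiple {j} {x} (suc c) fx =
    trans (sym (φ-compose j (c ℕ.* j) x)) (trans (cong (φ j) (fixed-multiple c fx)) fx)

  -- One division step of the Euclidean algorithm on the exponents of Frobenius.
  fixed-remainder : ∀ {j x} r c → Fixed j x → Fixed (r ℕ.+ c ℕ.* j) x → Fixed r x
  fixed-remainder {j} {x} r c fx frc =
    trans (cong (φ r) (sym (fixed-multiple c fx))) (trans (φ-compose r (c ℕ.* j) x) frc)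

  fixed-2-3⇒1 : ∀ {x} → Fixed 3 x → Fixed 2 x → Fixed 1 x
  fixed-2-3⇒1 {x} f3 f2 = trans (cong (φ 1) (sym f2)) (trans (φ-compose 1 2 x) f3)

  ι-fixed : ∀ x → Fixed 1 (ι x)
  ι-fixed x = trans (cong (ι x ^_) (ℕ.*-identityʳ q)) (trans (sym (ι-^ x q)) (cong ι (FT.^-size x)))

  -- An x outside the image would give, together with the q images, q + 1 roots of X^q - X.
  fixed⇒ι : ∀ {x} → Fixed 1 x → ∃[ f ] ι f ≡ x
  fixed⇒ι {x} fx with F.any? (λ f → ι f ≟ x)
  ... | yes found = found
  ... | no  none  = ⊥-elim (ℕ.<-irrefl refl (power-bound FT.1<size roots roots-injective roots-fixed))
    where
    roots : Fin (suc q) → Carrier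
    roots zero    = x
    roots (suc i) = ι (Inverse.from F.finite i)

    roots-injective : Injective _≡_ _≡_ roots
    roots-injective {zero}  {zero}  _  = refl
    roots-injective {zero}  {suc j} eq = ⊥-elim (none (_ , sym eq))
    roots-injective {suc i} {zero}  eq = ⊥-elim (none (_ , eq))
    roots-injective {suc i} {suc j} eq = cong suc (F.from-injective (ι-injective eq))

    roots-fixed : ∀ i → roots i ^ q ≡ roots i ^ 1
    roots-fixed zero    = trans (cong (x ^_) (sym (ℕ.*-identityʳ q))) (trans fx (sym (*-identityʳ x)))
    roots-fixed (suc i) = trans (cong (_ ^_) (sym (ℕ.*-identityʳ q))) (trans (ι-fixed _) (sym (*-identityʳ _)))

-- The cubic extension of a finite field

module Space (K : FiniteField) where
  open FiniteField K

  V : Set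
  V = Carrier × Carrier × Carrier

  infixl 6 _⊕_
  infixl 7 _⊙_

  _⊕_ : V → V → V
  (a₀ , a₁ , a₂) ⊕ (b₀ , b₁ , b₂) = a₀ + b₀ , a₁ + b₁ , a₂ + b₂

  ⊖_ : V → V
  ⊖ (a₀ , a₁ , a₂) = - a₀ , - a₁ , - a₂

  _⊙_ : Carrier → V → V
  c ⊙ (a₀ , a₁ , a₂) = c * a₀ , c * a₁ , c * a₂

  𝟎 : V
  𝟎 = 0# , 0# , 0#

  triple : ∀ {a₀ a₁ a₂ b₀ b₁ b₂ : Carrier} → a₀ ≡ b₀ → a₁ ≡ b₁ → a₂ ≡ b₂ → (a₀ , a₁ , a₂) ≡ (b₀ , b₁ , b₂)
  triple refl refl refl = refl

  at₀ : ∀ {x y : V} → x ≡ y → proj₁ x ≡ proj₁ y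
  at₀ = cong proj₁

  at₁ : ∀ {x y : V} → x ≡ y → proj₁ (proj₂ x) ≡ proj₁ (proj₂ y)
  at₁ = cong (proj₁ ∘ proj₂)

  at₂ : ∀ {x y : V} → x ≡ y → proj₂ (proj₂ x) ≡ proj₂ (proj₂ y)
  at₂ = cong (proj₂ ∘ proj₂)

  V-finite : V ↔ Fin (size ℕ.* (size ℕ.* size))
  V-finite = Fin.*↔× ⟨∘⟩ (finite ×-↔ (Fin.*↔× ⟨∘⟩ (finite ×-↔ finite)))
    where
    _⟨∘⟩_ : ∀ {A B C : Set} → C ↔ B → A ↔ B → A ↔ C
    f ⟨∘⟩ g = ↔-trans g (↔-sym f)

module CubicExtension (K : FiniteField) where
  open FiniteField K
  open FieldTheory K
  open Space K
  open ≡-Reasoning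

  private
    -- x³ - x takes the value 0 at both 0 and 1, so it is not onto. For a missed value α the cubic
    -- X³ - X - α has no root and is therefore irreducible, whatever the characteristic.
    artinSchreier : ∃[ z ] ∀ x → x * x * x - x ≢ z
    artinSchreier = not-surjective (λ x → x * x * x - x) 0≢1
      (solve 0 (:0 :* :0 :* :0 :- :0 := :1 :* :1 :* :1 :- :1) refl)

    α : Carrier
    α = proj₁ artinSchreier

    x³-x≢α : ∀ x → x * x * x - x ≢ α
    x³-x≢α = proj₂ artinSchreier

    Triple : ℕ → Set
    Triple n = Polynomial n × Polynomial n × Polynomial n

    infixl 7 _⟨_⟩_
    -- The product `_⊗_` repeated on solver polynomials, so that ring laws of the extension can be
    -- given to the solver one coordinate at a time.
    _⟨_⟩_ : ∀ {n} → Triple n → Polynomial n → Triple n → Triple n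
    (a₀ , a₁ , a₂) ⟨ α ⟩ (b₀ , b₁ , b₂) =
      a₀ :* b₀ :+ α :* (a₁ :* b₂ :+ a₂ :* b₁) ,
      a₀ :* b₁ :+ a₁ :* b₀ :+ (a₁ :* b₂ :+ a₂ :* b₁) :+ α :* (a₂ :* b₂) ,
      a₀ :* b₂ :+ a₁ :* b₁ :+ a₂ :* b₀ :+ a₂ :* b₂

    first second third : ∀ {n} → Triple n → Polynomial n
    first  = proj₁
    second = proj₁ ∘ proj₂
    third  = proj₂ ∘ proj₂

  infixl 7 _⊗_

  -- (a₀ , a₁ , a₂) stands for a₀ + a₁X + a₂X² modulo X³ = X + α.
  _⊗_ : V → V → V
  (a₀ , a₁ , a₂) ⊗ (b₀ , b₁ , b₂) =
    a₀ * b₀ + α * (a₁ * b₂ + a₂ * b₁) ,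
    a₀ * b₁ + a₁ * b₀ + (a₁ * b₂ + a₂ * b₁) + α * (a₂ * b₂) ,
    a₀ * b₂ + a₁ * b₁ + a₂ * b₀ + a₂ * b₂

  𝟏 : V
  𝟏 = 1# , 0# , 0#

  private
    ⊗-assoc : ∀ a b c → (a ⊗ b) ⊗ c ≡ a ⊗ (b ⊗ c)
    ⊗-assoc (a₀ , a₁ , a₂) (b₀ , b₁ , b₂) (c₀ , c₁ , c₂) = triple
      (solve 10 (λ α a₀ a₁ a₂ b₀ b₁ b₂ c₀ c₁ c₂ → let a = (a₀ , a₁ , a₂); b = (b₀ , b₁ , b₂); c = (c₀ , c₁ , c₂) in first (a ⟨ α ⟩ b ⟨ α ⟩ c) := first (a ⟨ α ⟩ (b ⟨ α ⟩ c)))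
        refl α a₀ a₁ a₂ b₀ b₁ b₂ c₀ c₁ c₂)
      (solve 10 (λ α a₀ a₁ a₂ b₀ b₁ b₂ c₀ c₁ c₂ → let a = (a₀ , a₁ , a₂); b = (b₀ , b₁ , b₂); c = (c₀ , c₁ , c₂) in second (a ⟨ α ⟩ b ⟨ α ⟩ c) := second (a ⟨ α ⟩ (b ⟨ α ⟩ c)))
        refl α a₀ a₁ a₂ b₀ b₁ b₂ c₀ c₁ c₂)
      (solve 10 (λ α a₀ a₁ a₂ b₀ b₁ b₂ c₀ c₁ c₂ → let a = (a₀ , a₁ , a₂); b = (b₀ , b₁ , b₂); c = (c₀ , c₁ , c₂) in third (a ⟨ α ⟩ b ⟨ α ⟩ c) := third (a ⟨ α ⟩ (b ⟨ α ⟩ c)))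
        refl α a₀ a₁ a₂ b₀ b₁ b₂ c₀ c₁ c₂)

    ⊗-comm : ∀ a b → a ⊗ b ≡ b ⊗ a
    ⊗-comm (a₀ , a₁ , a₂) (b₀ , b₁ , b₂) = triple
      (solve 7 (λ α a₀ a₁ a₂ b₀ b₁ b₂ → let a = (a₀ , a₁ , a₂); b = (b₀ , b₁ , b₂) in first (a ⟨ α ⟩ b) := first (b ⟨ α ⟩ a))
        refl α a₀ a₁ a₂ b₀ b₁ b₂)
      (solve 7 (λ α a₀ a₁ a₂ b₀ b₁ b₂ → let a = (a₀ , a₁ , a₂); b = (b₀ , b₁ , b₂) in second (a ⟨ α ⟩ b) := second (b ⟨ α ⟩ a))
        refl α a₀ a₁ a₂ b₀ b₁ b₂)
      (solve 7 (λ α a₀ a₁ a₂ b₀ b₁ b₂ → let a = (a₀ , a₁ , a₂); b = (b₀ , b₁ , b₂) in third (a ⟨ α ⟩ b) := third (b ⟨ α ⟩ a))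
        refl α a₀ a₁ a₂ b₀ b₁ b₂)

    ⊗-distribˡ : ∀ a b c → a ⊗ (b ⊕ c) ≡ a ⊗ b ⊕ a ⊗ c
    ⊗-distribˡ (a₀ , a₁ , a₂) (b₀ , b₁ , b₂) (c₀ , c₁ , c₂) = triple
      (solve 10 (λ α a₀ a₁ a₂ b₀ b₁ b₂ c₀ c₁ c₂ → let a = (a₀ , a₁ , a₂); b = (b₀ , b₁ , b₂); c = (c₀ , c₁ , c₂) in 
        first (a ⟨ α ⟩ (b₀ :+ c₀ , b₁ :+ c₁ , b₂ :+ c₂)) := first (a ⟨ α ⟩ b) :+ first (a ⟨ α ⟩ c))
        refl α a₀ a₁ a₂ b₀ b₁ b₂ c₀ c₁ c₂)
      (solve 10 (λ α a₀ a₁ a₂ b₀ b₁ b₂ c₀ c₁ c₂ → let a = (a₀ , a₁ , a₂); b = (b₀ , b₁ , b₂); c = (c₀ , c₁ , c₂) in 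
        second (a ⟨ α ⟩ (b₀ :+ c₀ , b₁ :+ c₁ , b₂ :+ c₂)) := second (a ⟨ α ⟩ b) :+ second (a ⟨ α ⟩ c))
        refl α a₀ a₁ a₂ b₀ b₁ b₂ c₀ c₁ c₂)
      (solve 10 (λ α a₀ a₁ a₂ b₀ b₁ b₂ c₀ c₁ c₂ → let a = (a₀ , a₁ , a₂); b = (b₀ , b₁ , b₂); c = (c₀ , c₁ , c₂) in 
        third (a ⟨ α ⟩ (b₀ :+ c₀ , b₁ :+ c₁ , b₂ :+ c₂)) := third (a ⟨ α ⟩ b) :+ third (a ⟨ α ⟩ c))
        refl α a₀ a₁ a₂ b₀ b₁ b₂ c₀ c₁ c₂)

    embed-⊗ : ∀ c a → (c , 0# , 0#) ⊗ a ≡ c ⊙ a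
    embed-⊗ c (a₀ , a₁ , a₂) = triple
      (solve 5 (λ α c a₀ a₁ a₂ → first ((c , :0 , :0) ⟨ α ⟩ (a₀ , a₁ , a₂)) := c :* a₀) refl α c a₀ a₁ a₂)
      (solve 5 (λ α c a₀ a₁ a₂ → second ((c , :0 , :0) ⟨ α ⟩ (a₀ , a₁ , a₂)) := c :* a₁) refl α c a₀ a₁ a₂)
      (solve 5 (λ α c a₀ a₁ a₂ → third ((c , :0 , :0) ⟨ α ⟩ (a₀ , a₁ , a₂)) := c :* a₂) refl α c a₀ a₁ a₂)

    ⊗-identityˡ : ∀ a → 𝟏 ⊗ a ≡ a
    ⊗-identityˡ a@(a₀ , a₁ , a₂) = trans (embed-⊗ 1# a) (triple (*-identityˡ a₀) (*-identityˡ a₁) (*-identityˡ a₂))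

    ⊕-identityˡ : ∀ a → 𝟎 ⊕ a ≡ a
    ⊕-identityˡ (a₀ , a₁ , a₂) = triple (+-identityˡ a₀) (+-identityˡ a₁) (+-identityˡ a₂)

    ⊕-comm : ∀ a b → a ⊕ b ≡ b ⊕ a
    ⊕-comm (a₀ , a₁ , a₂) (b₀ , b₁ , b₂) = triple (+-comm a₀ b₀) (+-comm a₁ b₁) (+-comm a₂ b₂)

    ⊕-assoc : ∀ a b c → (a ⊕ b) ⊕ c ≡ a ⊕ (b ⊕ c)
    ⊕-assoc (a₀ , a₁ , a₂) (b₀ , b₁ , b₂) (c₀ , c₁ , c₂) = triple (+-assoc a₀ b₀ c₀) (+-assoc a₁ b₁ c₁) (+-assoc a₂ b₂ c₂)

    ⊖-inverseˡ : ∀ a → (⊖ a) ⊕ a ≡ 𝟎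
    ⊖-inverseˡ (a₀ , a₁ , a₂) = triple (-‿inverseˡ a₀) (-‿inverseˡ a₁) (-‿inverseˡ a₂)

  isCommutativeRing-V : IsCommutativeRing _≡_ _⊕_ _⊗_ ⊖_ 𝟎 𝟏
  isCommutativeRing-V = record
    { isRing = record
      { +-isAbelianGroup = record
        { isGroup = record
          { isMonoid = record
            { isSemigroup = record
              { isMagma = record { isEquivalence = isEquivalence ; ∙-cong = cong₂ _⊕_ }
              ; assoc   = ⊕-assoc
              }
            ; identity = ⊕-identityˡ , λ a → trans (⊕-comm a 𝟎) (⊕-identityˡ a)
            }
          ; inverse = ⊖-inverseˡ , λ a → trans (⊕-comm a (⊖ a)) (⊖-inverseˡ a)
          ; ⁻¹-cong = cong ⊖_
          }
        ; comm = ⊕-comm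
        }
      ; *-cong     = cong₂ _⊗_
      ; *-assoc    = ⊗-assoc
      ; *-identity = ⊗-identityˡ , λ a → trans (⊗-comm a 𝟏) (⊗-identityˡ a)
      ; distrib    = ⊗-distribˡ , λ a b c → trans (⊗-comm (b ⊕ c) a)
                       (trans (⊗-distribˡ a b c) (cong₂ _⊕_ (⊗-comm a b) (⊗-comm a c)))
      }
    ; *-comm = ⊗-comm
    }

  private
    Invertible : V → Set
    Invertible a = ∃[ b ] a ⊗ b ≡ 𝟏

    scale-assoc : ∀ c a b → (c ⊙ a) ⊗ b ≡ c ⊙ (a ⊗ b)
    scale-assoc c a b = trans (cong (_⊗ b) (sym (embed-⊗ c a)))
      (trans (⊗-assoc (c , 0# , 0#) a b) (embed-⊗ c (a ⊗ b)))

    scalar-invertible : ∀ {c} → c ≢ 0# → Invertible (c , 0# , 0#)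
    scalar-invertible {c} c≢0 = (c ⁻¹ , 0# , 0#) ,
      trans (embed-⊗ c _) (triple (*-inverseʳ c≢0) (zeroʳ c) (zeroʳ c))

    ⊗-invertible : ∀ {a b} → Invertible a → Invertible b → Invertible (a ⊗ b)
    ⊗-invertible {a} {b} (a′ , aa′) (b′ , bb′) = a′ ⊗ b′ , (begin
      (a ⊗ b) ⊗ (a′ ⊗ b′)    ≡⟨ cong (_⊗ (a′ ⊗ b′)) (⊗-comm a b) ⟩
      (b ⊗ a) ⊗ (a′ ⊗ b′)    ≡⟨ ⊗-assoc b a _ ⟩
      b ⊗ (a ⊗ (a′ ⊗ b′))    ≡⟨ cong (b ⊗_) (⊗-assoc a a′ b′) ⟨
      b ⊗ ((a ⊗ a′) ⊗ b′)    ≡⟨ cong (λ u → b ⊗ (u ⊗ b′)) aa′ ⟩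
      b ⊗ (𝟏 ⊗ b′)           ≡⟨ cong (b ⊗_) (⊗-identityˡ b′) ⟩
      b ⊗ b′                 ≡⟨ bb′ ⟩
      𝟏                      ∎)

    scale-invertible : ∀ {c a} → c ≢ 0# → Invertible a → Invertible (c ⊙ a)
    scale-invertible {c} {a} c≢0 inv-a =
      subst Invertible (embed-⊗ c a) (⊗-invertible (scalar-invertible c≢0) inv-a)

    -- The cofactor is the quotient of X³ - X - α by X + c. The product r is, up to sign, the value
    -- of X³ - X - α at -c, nonzero by the choice of α.
    monicLinear-invertible : ∀ c → Invertible (c , 1# , 0#)
    monicLinear-invertible c = r ⁻¹ ⊙ cofactor , (begin
      (c , 1# , 0#) ⊗ (r ⁻¹ ⊙ cofactor)     ≡⟨ ⊗-comm _ _ ⟩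
      (r ⁻¹ ⊙ cofactor) ⊗ (c , 1# , 0#)     ≡⟨ scale-assoc (r ⁻¹) cofactor _ ⟩
      r ⁻¹ ⊙ (cofactor ⊗ (c , 1# , 0#))     ≡⟨ cong (r ⁻¹ ⊙_) (triple
        (solve 2 (λ α c → first ((c :* c :- :1 , :- c , :1) ⟨ α ⟩ (c , :1 , :0)) := α :- ((:- c) :* (:- c) :* (:- c) :- (:- c))) refl α c)
        (solve 2 (λ α c → second ((c :* c :- :1 , :- c , :1) ⟨ α ⟩ (c , :1 , :0)) := :0) refl α c)
        (solve 2 (λ α c → third ((c :* c :- :1 , :- c , :1) ⟨ α ⟩ (c , :1 , :0)) := :0) refl α c)) ⟩
      r ⁻¹ ⊙ (r , 0# , 0#)                  ≡⟨ triple (trans (*-comm _ r) (*-inverseʳ r≢0)) (zeroʳ _) (zeroʳ _) ⟩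
      𝟏                                     ∎)
      where
      r : Carrier
      r = α - ((- c) * (- c) * (- c) - (- c))

      r≢0 : r ≢ 0#
      r≢0 eq = x³-x≢α (- c) (sym (x-y≡0⇒x≡y eq))

      cofactor : V
      cofactor = c * c - 1# , - c , 1#

    linear-invertible : ∀ b₀ b₁ → (b₀ , b₁ , 0#) ≢ 𝟎 → Invertible (b₀ , b₁ , 0#)
    linear-invertible b₀ b₁ b≢0 with b₁ ≟ 0#
    ... | yes refl = scalar-invertible (λ { refl → b≢0 refl })
    ... | no  b₁≢0 = subst Invertible
      (triple (*-⁻¹-cancel b₀ b₁≢0) (*-identityʳ b₁) (zeroʳ b₁))
      (scale-invertible b₁≢0 (monicLinear-invertible (b₁ ⁻¹ * b₀)))

    -- Multiplying X² + a₁X + a₀ by X - a₁ kills the quadratic term.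
    monicQuadratic-invertible : ∀ a₀ a₁ → Invertible (a₀ , a₁ , 1#)
    monicQuadratic-invertible a₀ a₁ = from-product (linear-invertible (α - a₀ * a₁) (1# + a₀ - a₁ * a₁) product≢0)
      where
      a ℓ : V
      a = a₀ , a₁ , 1#
      ℓ = - a₁ , 1# , 0#

      product : a ⊗ ℓ ≡ (α - a₀ * a₁ , 1# + a₀ - a₁ * a₁ , 0#)
      product = triple
        (solve 3 (λ α a₀ a₁ → first ((a₀ , a₁ , :1) ⟨ α ⟩ (:- a₁ , :1 , :0)) := α :- a₀ :* a₁) refl α a₀ a₁)
        (solve 3 (λ α a₀ a₁ → second ((a₀ , a₁ , :1) ⟨ α ⟩ (:- a₁ , :1 , :0)) := :1 :+ a₀ :- a₁ :* a₁) refl α a₀ a₁)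
        (solve 3 (λ α a₀ a₁ → third ((a₀ , a₁ , :1) ⟨ α ⟩ (:- a₁ , :1 , :0)) := :0) refl α a₀ a₁)

      cancel : ∀ w → (a ⊗ ℓ) ⊗ w ≡ a ⊗ (ℓ ⊗ w)
      cancel w = ⊗-assoc a ℓ w

      -- If the product vanished, cancelling the invertible ℓ would give a = 0, against the leading
      -- coefficient 1.
      product≢0 : (α - a₀ * a₁ , 1# + a₀ - a₁ * a₁ , 0#) ≢ 𝟎
      product≢0 eq = vanish (monicLinear-invertible (- a₁))
        where
        a≡0 : ∀ w → ℓ ⊗ w ≡ 𝟏 → a ≡ 𝟎
        a≡0 w ℓw≡1 = begin
          a             ≡⟨ trans (⊗-comm a 𝟏) (⊗-identityˡ a) ⟨
          a ⊗ 𝟏         ≡⟨ cong (a ⊗_) ℓw≡1 ⟨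
          a ⊗ (ℓ ⊗ w)   ≡⟨ cancel w ⟨
          (a ⊗ ℓ) ⊗ w   ≡⟨ cong (_⊗ w) (trans product eq) ⟩
          𝟎 ⊗ w         ≡⟨ embed-⊗ 0# w ⟩
          0# ⊙ w        ≡⟨ triple (zeroˡ _) (zeroˡ _) (zeroˡ _) ⟩
          𝟎             ∎

        vanish : Invertible ℓ → ⊥
        vanish (w , ℓw≡1) = 0≢1 (sym (at₂ (a≡0 w ℓw≡1)))

      from-product : Invertible (α - a₀ * a₁ , 1# + a₀ - a₁ * a₁ , 0#) → Invertible a
      from-product (w , eq) = ℓ ⊗ w , trans (sym (cancel w)) (trans (cong (_⊗ w) product) eq)

    nonzero-invertible : ∀ a → a ≢ 𝟎 → Invertible a
    nonzero-invertible a@(a₀ , a₁ , a₂) a≢0 with a₂ ≟ 0#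
    ... | yes refl = linear-invertible a₀ a₁ a≢0
    ... | no  a₂≢0 = subst Invertible
      (triple (*-⁻¹-cancel a₀ a₂≢0) (*-⁻¹-cancel a₁ a₂≢0) (*-identityʳ a₂))
      (scale-invertible a₂≢0 (monicQuadratic-invertible (a₂ ⁻¹ * a₀) (a₂ ⁻¹ * a₁)))

  N : FiniteField
  N = record
    { Carrier           = V
    ; _+_               = _⊕_
    ; _*_               = _⊗_
    ; -_                = ⊖_
    ; 0#                = 𝟎
    ; 1#                = 𝟏
    ; isCommutativeRing = isCommutativeRing-V
    ; 0≢1               = λ eq → 0≢1 (at₀ eq)
    ; inverse           = nonzero-invertible
    ; size              = size ℕ.* (size ℕ.* size)
    ; finite            = V-finite
    }

  κ : Embedding K N
  κ = record
    { ι   = λ x → x , 0# , 0#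
    ; ι-+ = λ x y → triple refl (sym (+-identityʳ 0#)) (sym (+-identityʳ 0#))
    ; ι-* = λ x y → sym (trans (embed-⊗ x _) (triple refl (zeroʳ x) (zeroʳ x)))
    ; ι-1 = refl
    }

  κ-scale : ∀ c v → Embedding.ι κ c ⊗ v ≡ c ⊙ v
  κ-scale = embed-⊗

-- The degree is given by an equation because N occurs both with degree 3m and with degree t + t for
-- t = 3s, the form in which the subfield of index 2 is described.
cubicExtension : ∀ {m n} → 3 ℕ.* m ≡ n → Extension m → Extension n
cubicExtension {m} {n} 3*m≡n X = record
  { prime  = prime
  ; e      = e
  ; F      = F
  ; K      = N
  ; size-F = size-F
  ; size-K = begin
      k ℕ.* (k ℕ.* k)                      ≡⟨ cong (λ j → k ℕ.* (k ℕ.* j)) (ℕ.*-identityʳ k) ⟨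
      k ℕ.^ 3                              ≡⟨ cong (ℕ._^ 3) size-K ⟩
      (FiniteField.size F ℕ.^ m) ℕ.^ 3     ≡⟨ ℕ.^-*-assoc (FiniteField.size F) m 3 ⟩
      FiniteField.size F ℕ.^ (m ℕ.* 3)     ≡⟨ cong (FiniteField.size F ℕ.^_) (trans (ℕ.*-comm m 3) 3*m≡n) ⟩
      FiniteField.size F ℕ.^ n             ∎
  ; F→K    = record
      { ι   = λ x → κ.ι (ι.ι x)
      ; ι-+ = λ x y → trans (cong κ.ι (ι.ι-+ x y)) (κ.ι-+ _ _)
      ; ι-* = λ x y → trans (cong κ.ι (ι.ι-* x y)) (κ.ι-* _ _)
      ; ι-1 = trans (cong κ.ι ι.ι-1) κ.ι-1
      }
  }
  where
  open Extension X
  open CubicExtension K using (N; κ)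
  open ≡-Reasoning
  module κ = Embedding κ
  module ι = Embedding F→K
  k = FiniteField.size K

-- Scattered subspaces of K³

module CrossProduct (K : FiniteField) where
  open FiniteField K
  open FieldTheory K
  open Space K
  open ≡-Reasoning

  ⊙-assoc : ∀ c d v → c ⊙ (d ⊙ v) ≡ (c * d) ⊙ v
  ⊙-assoc c d (v₀ , v₁ , v₂) = triple (sym (*-assoc c d v₀)) (sym (*-assoc c d v₁)) (sym (*-assoc c d v₂))

  ⊙-cancel : ∀ {c v} → c ≢ 0# → c ⊙ v ≡ 𝟎 → v ≡ 𝟎
  ⊙-cancel c≢0 eq = triple (nonzero-*-≡0 c≢0 (at₀ eq))
    (nonzero-*-≡0 c≢0 (at₁ eq)) (nonzero-*-≡0 c≢0 (at₂ eq))

  0⊙ : ∀ v → 0# ⊙ v ≡ 𝟎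
  0⊙ (v₀ , v₁ , v₂) = triple (zeroˡ v₀) (zeroˡ v₁) (zeroˡ v₂)

  ⊕-identityʳ : ∀ v → v ⊕ 𝟎 ≡ v
  ⊕-identityʳ (v₀ , v₁ , v₂) = triple (+-identityʳ v₀) (+-identityʳ v₁) (+-identityʳ v₂)

  infix 7 _∙_
  _∙_ : V → V → Carrier
  (x₀ , x₁ , x₂) ∙ (y₀ , y₁ , y₂) = x₀ * y₀ + x₁ * y₁ + x₂ * y₂

  cross : V → V → V
  cross (x₀ , x₁ , x₂) (y₀ , y₁ , y₂) = x₁ * y₂ - x₂ * y₁ , x₂ * y₀ - x₀ * y₂ , x₀ * y₁ - x₁ * y₀

  ∙-𝟎 : ∀ x → x ∙ 𝟎 ≡ 0#
  ∙-𝟎 (x₀ , x₁ , x₂) = solve 3 (λ a b c → a :* :0 :+ b :* :0 :+ c :* :0 := :0) refl x₀ x₁ x₂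

  ∙-scale-⊕ : ∀ x c y z → x ∙ (c ⊙ y ⊕ z) ≡ c * (x ∙ y) + x ∙ z
  ∙-scale-⊕ (x₀ , x₁ , x₂) c (y₀ , y₁ , y₂) (z₀ , z₁ , z₂) =
    solve 10 (λ x₀ x₁ x₂ c y₀ y₁ y₂ z₀ z₁ z₂ →
      x₀ :* (c :* y₀ :+ z₀) :+ x₁ :* (c :* y₁ :+ z₁) :+ x₂ :* (c :* y₂ :+ z₂) :=
      c :* (x₀ :* y₀ :+ x₁ :* y₁ :+ x₂ :* y₂) :+ (x₀ :* z₀ :+ x₁ :* z₁ :+ x₂ :* z₂)) refl x₀ x₁ x₂ c y₀ y₁ y₂ z₀ z₁ z₂

  private
    ratio : ∀ {a b x y} → b ≢ 0# → a * y ≡ x * b → x ≡ (a * b ⁻¹) * y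
    ratio {a} {b} {x} {y} b≢0 eq = *-cancelˡ b≢0 (begin
      b * x                   ≡⟨ *-comm b x ⟩
      x * b                   ≡⟨ eq ⟨
      a * y                   ≡⟨ *-⁻¹-cancel (a * y) b≢0 ⟨
      b * (b ⁻¹ * (a * y))    ≡⟨ solve 4 (λ a b i y → b :* (i :* (a :* y)) := b :* (a :* i :* y)) refl a b (b ⁻¹) y ⟩
      b * (a * b ⁻¹ * y)      ∎)

    self-ratio : ∀ {a b} → b ≢ 0# → a ≡ (a * b ⁻¹) * b
    self-ratio b≢0 = ratio b≢0 refl

  cross≡𝟎⇒proportional : ∀ x y → y ≢ 𝟎 → cross x y ≡ 𝟎 → ∃[ c ] x ≡ c ⊙ y
  cross≡𝟎⇒proportional x@(x₀ , x₁ , x₂) y@(y₀ , y₁ , y₂) y≢𝟎 eq = by-cases (y₀ ≟ 0#) (y₁ ≟ 0#) (y₂ ≟ 0#)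
    where
    e₀ : x₁ * y₂ ≡ x₂ * y₁
    e₀ = x-y≡0⇒x≡y (at₀ eq)
    e₁ : x₂ * y₀ ≡ x₀ * y₂
    e₁ = x-y≡0⇒x≡y (at₁ eq)
    e₂ : x₀ * y₁ ≡ x₁ * y₀
    e₂ = x-y≡0⇒x≡y (at₂ eq)

    by-cases : Dec (y₀ ≡ 0#) → Dec (y₁ ≡ 0#) → Dec (y₂ ≡ 0#) → ∃[ c ] x ≡ c ⊙ y
    by-cases (no y₀≢0) _ _ = x₀ * y₀ ⁻¹ , triple (self-ratio y₀≢0) (ratio y₀≢0 e₂) (ratio y₀≢0 (sym e₁))
    by-cases (yes _) (no y₁≢0) _ = x₁ * y₁ ⁻¹ , triple (ratio y₁≢0 (sym e₂)) (self-ratio y₁≢0) (ratio y₁≢0 e₀)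
    by-cases (yes _) (yes _) (no y₂≢0) = x₂ * y₂ ⁻¹ , triple (ratio y₂≢0 e₁) (ratio y₂≢0 (sym e₀)) (self-ratio y₂≢0)
    by-cases (yes y₀≡0) (yes y₁≡0) (yes y₂≡0) = ⊥-elim (y≢𝟎 (triple y₀≡0 y₁≡0 y₂≡0))

  triple-product : ∀ x y z → cross x (cross y z) ≡ (x ∙ z) ⊙ y ⊕ (- (x ∙ y)) ⊙ z
  triple-product (x₀ , x₁ , x₂) (y₀ , y₁ , y₂) (z₀ , z₁ , z₂) = triple
    (solve 9 (λ x₀ x₁ x₂ y₀ y₁ y₂ z₀ z₁ z₂ →
      x₁ :* (y₀ :* z₁ :- y₁ :* z₀) :- x₂ :* (y₂ :* z₀ :- y₀ :* z₂) :=
      (x₀ :* z₀ :+ x₁ :* z₁ :+ x₂ :* z₂) :* y₀ :+ (:- (x₀ :* y₀ :+ x₁ :* y₁ :+ x₂ :* y₂)) :* z₀)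
      refl x₀ x₁ x₂ y₀ y₁ y₂ z₀ z₁ z₂)
    (solve 9 (λ x₀ x₁ x₂ y₀ y₁ y₂ z₀ z₁ z₂ →
      x₂ :* (y₁ :* z₂ :- y₂ :* z₁) :- x₀ :* (y₀ :* z₁ :- y₁ :* z₀) :=
      (x₀ :* z₀ :+ x₁ :* z₁ :+ x₂ :* z₂) :* y₁ :+ (:- (x₀ :* y₀ :+ x₁ :* y₁ :+ x₂ :* y₂)) :* z₁)
      refl x₀ x₁ x₂ y₀ y₁ y₂ z₀ z₁ z₂)
    (solve 9 (λ x₀ x₁ x₂ y₀ y₁ y₂ z₀ z₁ z₂ →
      x₀ :* (y₂ :* z₀ :- y₀ :* z₂) :- x₁ :* (y₁ :* z₂ :- y₂ :* z₁) :=
      (x₀ :* z₀ :+ x₁ :* z₁ :+ x₂ :* z₂) :* y₂ :+ (:- (x₀ :* y₀ :+ x₁ :* y₁ :+ x₂ :* y₂)) :* z₂)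
      refl x₀ x₁ x₂ y₀ y₁ y₂ z₀ z₁ z₂)

  -- By the triple product formula x × (y × z) is a combination with coefficients x · z and -(x ·
  -- y), hence zero: the linear forms that kill a plane are proportional.
  orthogonal⇒proportional : ∀ {x y z} → cross y z ≢ 𝟎 → x ∙ y ≡ 0# → x ∙ z ≡ 0# → ∃[ c ] x ≡ c ⊙ cross y z
  orthogonal⇒proportional {x} {y} {z} yz≢𝟎 xy≡0 xz≡0 = cross≡𝟎⇒proportional x (cross y z) yz≢𝟎 (begin
    cross x (cross y z)                ≡⟨ triple-product x y z ⟩
    (x ∙ z) ⊙ y ⊕ (- (x ∙ y)) ⊙ z      ≡⟨ cong₂ (λ s t → s ⊙ y ⊕ (- t) ⊙ z) xz≡0 xy≡0 ⟩
    0# ⊙ y ⊕ (- 0#) ⊙ z                ≡⟨ cong (λ t → 0# ⊙ y ⊕ t ⊙ z) (solve 0 (:- :0 := :0) refl) ⟩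
    0# ⊙ y ⊕ 0# ⊙ z                    ≡⟨ cong₂ _⊕_ (0⊙ y) (0⊙ z) ⟩
    𝟎 ⊕ 𝟎                              ≡⟨ ⊕-identityʳ 𝟎 ⟩
    𝟎                                  ∎)

module Scattered {F K : FiniteField} (F→K : Embedding F K) (m : ℕ)
                 (size-K : FiniteField.size K ≡ FiniteField.size F ℕ.^ m) where
  open FiniteField K
  open FieldTheory K
  open Space K
  open CrossProduct K
  open Embedding F→K
  open ≡-Reasoning
  private
    module F = FiniteField F
    module FT = FieldTheory F

  q : ℕ
  q = F.size

  1<q : 1 ℕ.< q
  1<q = FT.1<size

  coefficients : ∀ n → Fin (q ℕ.^ n) → Fin n → F.Carrier
  coefficients n i j = Inverse.from F.finite (Fin.finToFun i j)

  coefficients-surjective : ∀ {n} (a : Fin n → F.Carrier) → ∃[ i ] coefficients n i ≗ a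
  coefficients-surjective {n} a = Fin.funToFin (Inverse.to F.finite ∘ a) , λ j →
    trans (cong (Inverse.from F.finite) (Fin.finToFun-funToFin _ j)) (Inverse.strictlyInverseʳ F.finite (a j))

  coefficients-injective : ∀ n {i j : Fin (q ℕ.^ n)} → coefficients n i ≗ coefficients n j → i ≡ j
  coefficients-injective n {i} {j} eq = trans (sym (Fin.funToFin-finToFin {n} {q} i))
    (trans (funToFin-cong (F.from-injective ∘ eq)) (Fin.funToFin-finToFin {n} {q} j))

  -- Pigeonhole in place of a dimension count: for additive h the difference of a and b is a nonzero
  -- kernel vector.
  collapse : ∀ {A : Set} {k n} → A ↔ Fin k → k ℕ.< q ℕ.^ n → (h : (Fin n → F.Carrier) → A) →
             ∃[ a ] ∃[ b ] (∃[ i ] a i ≢ b i) × h a ≡ h b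
  collapse {n = n} A↔ k<q^n h with i , j , i≢j , eq ← Finite.collision A↔ k<q^n (h ∘ coefficients n) =
    coefficients n i , coefficients n j ,
    Fin.¬∀⟶∃¬ n _ (λ t → coefficients n i t F.≟ coefficients n j t) (i≢j ∘ coefficients-injective n) , eq

  lin : ∀ {n} → (Fin n → F.Carrier) → (Fin n → Carrier) → Carrier
  lin {zero}  a g = 0#
  lin {suc n} a g = ι (a zero) * g zero + lin (a ∘ suc) (g ∘ suc)

  lin-difference : ∀ {n} (a b : Fin n → F.Carrier) g → lin (λ i → a i F.- b i) g ≡ lin a g - lin b g
  lin-difference {zero}  a b g = sym (-‿inverseʳ 0#)
  lin-difference {suc n} a b g = begin
    ι (a zero F.- b zero) * g zero + lin (λ i → a (suc i) F.- b (suc i)) (g ∘ suc)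
      ≡⟨ cong₂ (λ s t → s * g zero + t) (trans (ι-+ _ _) (cong (λ t → ι _ + t) (ι-neg _))) (lin-difference (a ∘ suc) (b ∘ suc) (g ∘ suc)) ⟩
    (ι (a zero) - ι (b zero)) * g zero + (lin (a ∘ suc) (g ∘ suc) - lin (b ∘ suc) (g ∘ suc))
      ≡⟨ solve 5 (λ a b g l m → (a :- b) :* g :+ (l :- m) := (a :* g :+ l) :- (b :* g :+ m)) refl _ _ _ _ _ ⟩
    lin a g - lin b g ∎

  comb : ∀ {n} → (Fin n → F.Carrier) → (Fin n → V) → V
  comb {zero}  a u = 𝟎
  comb {suc n} a u = ι (a zero) ⊙ u zero ⊕ comb (a ∘ suc) (u ∘ suc)

  comb-cong : ∀ {n} {a b : Fin n → F.Carrier} → a ≗ b → ∀ u → comb a u ≡ comb b u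
  comb-cong {zero}  eq u = refl
  comb-cong {suc n} eq u = cong₂ (λ c v → ι c ⊙ u zero ⊕ v) (eq zero) (comb-cong (eq ∘ suc) (u ∘ suc))

  ∙-comb : ∀ {n} x (a : Fin n → F.Carrier) u → x ∙ comb a u ≡ lin a (λ i → x ∙ u i)
  ∙-comb {zero}  x a u = ∙-𝟎 x
  ∙-comb {suc n} x a u = trans (∙-scale-⊕ x (ι (a zero)) (u zero) _) (cong (λ t → ι (a zero) * (x ∙ u zero) + t) (∙-comb x (a ∘ suc) (u ∘ suc)))

  comb-affine : ∀ {n} c (a b : Fin n → F.Carrier) u →
                comb (λ i → a i F.+ c F.* b i) u ≡ comb a u ⊕ ι c ⊙ comb b u
  comb-affine {zero}  c a b u = triple zero-case zero-case zero-case
    where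
    zero-case : 0# ≡ 0# + ι c * 0#
    zero-case = solve 1 (λ c → :0 := :0 :+ c :* :0) refl (ι c)
  comb-affine {suc n} c a b u = begin
    ι (a zero F.+ c F.* b zero) ⊙ u zero ⊕ comb (λ i → a (suc i) F.+ c F.* b (suc i)) (u ∘ suc)
      ≡⟨ cong₂ (λ s v → s ⊙ u zero ⊕ v) (trans (ι-+ _ _) (cong (λ t → ι (a zero) + t) (ι-* _ _))) (comb-affine c (a ∘ suc) (b ∘ suc) (u ∘ suc)) ⟩
    (ι (a zero) + ι c * ι (b zero)) ⊙ u zero ⊕ (comb (a ∘ suc) (u ∘ suc) ⊕ ι c ⊙ comb (b ∘ suc) (u ∘ suc))
      ≡⟨ triple (rearrange _ _ _ _ _ _) (rearrange _ _ _ _ _ _) (rearrange _ _ _ _ _ _) ⟩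
    comb a u ⊕ ι c ⊙ comb b u ∎
    where
    rearrange : ∀ a c b u x y → (a + c * b) * u + (x + c * y) ≡ (a * u + x) + c * (b * u + y)
    rearrange = solve 6 (λ a c b u x y → (a :+ c :* b) :* u :+ (x :+ c :* y) := (a :* u :+ x) :+ c :* (b :* u :+ y)) refl

  Independent : ∀ {n} → (Fin n → V) → Set
  Independent u = ∀ a → comb a u ≡ 𝟎 → ∀ i → a i ≡ F.0#

  -- A relation with nonzero first coefficient could be solved for v. The extended family w enters
  -- through its values, because functions given by cases on the index are compared only pointwise.
  extend-independent : ∀ {n} v (u : Fin n → V) → Independent u → (∀ a → comb a u ≢ v) →
                       ∀ w → w zero ≡ v → (∀ i → w (suc i) ≡ u i) → Independent w
  extend-independent {n} v u independent outside w refl tail a eq = by-cases (a zero F.≟ F.0#)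
    where
    comb-tail : ∀ {k} (b : Fin k → F.Carrier) {x y : Fin k → V} → x ≗ y → comb b x ≡ comb b y
    comb-tail {zero}  b eq = refl
    comb-tail {suc k} b eq = cong₂ (λ s t → ι (b zero) ⊙ s ⊕ t) (eq zero) (comb-tail (b ∘ suc) (eq ∘ suc))

    combination : ι (a zero) ⊙ v ⊕ comb (a ∘ suc) u ≡ 𝟎
    combination = trans (cong (_ ⊕_) (comb-tail (a ∘ suc) (sym ∘ tail))) eq

    ⊕-identityˡ : ∀ x → 𝟎 ⊕ x ≡ x
    ⊕-identityˡ (x₀ , x₁ , x₂) = triple (+-identityˡ x₀) (+-identityˡ x₁) (+-identityˡ x₂)

    by-cases : Dec (a zero ≡ F.0#) → ∀ i → a i ≡ F.0#
    by-cases (yes a₀≡0) zero    = a₀≡0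
    by-cases (yes a₀≡0) (suc i) = independent (a ∘ suc)
      (trans (sym (⊕-identityˡ _)) (trans (cong (_⊕ comb (a ∘ suc) u)
        (sym (trans (cong (λ c → ι c ⊙ v) a₀≡0) (trans (cong (_⊙ v) ι-0) (0⊙ v))))) combination)) i
    -- The summand 0 brings the coefficients of the solved relation into the shape of `comb-affine`,
    -- with the zero combination as first part.
    by-cases (no a₀≢0) i = ⊥-elim (outside (λ j → F.0# F.+ c F.* a (suc j))
      (trans (comb-affine c (λ _ → F.0#) (a ∘ suc) u)
        (trans (cong (_⊕ ι c ⊙ comb (a ∘ suc) u) (comb-zero u))
          (triple (solved (at₀ combination)) (solved (at₁ combination))
                  (solved (at₂ combination))))))
      where
      c : F.Carrier
      c = F.- (a zero FT.⁻¹)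

      comb-zero : ∀ {k} (u : Fin k → V) → comb (λ _ → F.0#) u ≡ 𝟎
      comb-zero {zero}  u = refl
      comb-zero {suc k} u = trans (cong₂ _⊕_ (trans (cong (_⊙ u zero) ι-0) (0⊙ _)) (comb-zero (u ∘ suc))) (⊕-identityʳ 𝟎)

      ι[a⁻¹]ιa≡1 : ι (a zero FT.⁻¹) * ι (a zero) ≡ 1#
      ι[a⁻¹]ιa≡1 = trans (*-comm _ _) (trans (sym (ι-* _ _)) (trans (cong ι (FT.*-inverseʳ a₀≢0)) ι-1))

      solved : ∀ {x y} → ι (a zero) * x + y ≡ 0# → 0# + ι c * y ≡ x
      solved {x} {y} ax+y≡0 = begin
        0# + ι c * y
          ≡⟨ cong (λ s → 0# + s * y) (ι-neg _) ⟩
        0# + (- i₀) * y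
          ≡⟨ solve 4 (λ i a x y → :0 :+ (:- i) :* y := (i :* a) :* x :- i :* (a :* x :+ y)) refl i₀ (ι (a zero)) x y ⟩
        (i₀ * ι (a zero)) * x - i₀ * (ι (a zero) * x + y)
          ≡⟨ cong₂ (λ s t → s * x - i₀ * t) ι[a⁻¹]ιa≡1 ax+y≡0 ⟩
        1# * x - i₀ * 0#
          ≡⟨ solve 2 (λ x i → :1 :* x :- i :* :0 := x) refl x i₀ ⟩
        x ∎
        where
        i₀ : Carrier
        i₀ = ι (a zero FT.⁻¹)

  -- The size enters as a lower bound, through c distinct points, which is the form in which
  -- independent vectors are drawn from P.
  record ScatteredSubspace (P : V → Set) (c : ℕ) : Set where
    field
      ⊕-closed         : ∀ {u v} → P u → P v → P (u ⊕ v)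
      ⊙-closed         : ∀ f {v} → P v → P (ι f ⊙ v)
      scattered        : ∀ {u v} l → P u → P v → v ≢ 𝟎 → u ≡ l ⊙ v → ∃[ f ] ι f ≡ l
      points           : Fin c → V
      points-injective : Injective _≡_ _≡_ points
      points-sound     : ∀ i → P (points i)

  module _ {P : V → Set} {c : ℕ} (U : ScatteredSubspace P c) where
    open ScatteredSubspace U

    -- k vectors span at most q^k elements, fewer than c, so one of the points lies outside their
    -- span.
    independent-family : ∀ k → q ℕ.^ k ℕ.≤ c → ∃[ u ] (∀ i → P (u i)) × Independent {k} u
    independent-family zero    _       = (λ ()) , (λ ()) , λ _ _ ()
    independent-family (suc k) q^1+k≤c = extend (independent-family k (ℕ.<⇒≤ q^k<c))
      where
      q^k<c : q ℕ.^ k ℕ.< c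
      q^k<c = ℕ.<-≤-trans (ℕ.^-monoʳ-< q 1<q (ℕ.n<1+n k)) q^1+k≤c

      extend : ∃[ u ] (∀ i → P (u i)) × Independent {k} u → ∃[ u ] (∀ i → P (u i)) × Independent {suc k} u
      extend (u , u∈P , independent) =
        w , (λ { zero → points-sound j ; (suc i) → u∈P i }) ,
        extend-independent (points j) u independent outside w refl (λ _ → refl)
        where
        escaped : ∃[ j ] ∀ i → comb (coefficients k i) u ≢ points j
        escaped = Finite.escape V-finite points points-injective (λ i → comb (coefficients k i) u) q^k<c

        j : Fin c
        j = proj₁ escaped

        w : Fin (suc k) → V
        w zero    = points j
        w (suc i) = u i

        outside : ∀ a → comb a u ≢ points j
        outside a eq with i , same ← coefficients-surjective a =
          proj₂ escaped i (trans (comb-cong same u) eq)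

    comb-closed : ∀ {n} (a : Fin (suc n) → F.Carrier) u → (∀ i → P (u i)) → P (comb a u)
    comb-closed {zero}  a u u∈P = subst P (sym (⊕-identityʳ _)) (⊙-closed (a zero) (u∈P zero))
    comb-closed {suc n} a u u∈P = ⊕-closed (⊙-closed (a zero) (u∈P zero)) (comb-closed (a ∘ suc) (u ∘ suc) (u∈P ∘ suc))

  -- cutting: the F-span of u meets every line of the projective plane over K
  -- in points spanning that line.
  record CuttingFamily (n : ℕ) : Set where
    field
      u           : Fin n → V
      independent : Independent u
      cutting     : ∀ {x y} → x ≢ 𝟎 → (∀ a → x ∙ comb a u ≡ 0# → y ∙ comb a u ≡ 0#) → ∃[ c ] y ≡ c ⊙ x

    -- A form that vanishes on all of U is by `cutting` a multiple of two different unit vectors,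
    -- hence zero.
    spanning : ∀ {y} → (∀ a → y ∙ comb a u ≡ 0#) → y ≡ 𝟎
    spanning {y} y⊥ = from-lines (cutting {e₀} (λ eq → 0≢1 (sym (at₀ eq))) (λ a _ → y⊥ a))
                                 (cutting {e₁} (λ eq → 0≢1 (sym (at₁ eq))) (λ a _ → y⊥ a))
      where
      e₀ e₁ : V
      e₀ = 1# , 0# , 0#
      e₁ = 0# , 1# , 0#

      from-lines : (∃[ c ] y ≡ c ⊙ e₀) → (∃[ c ] y ≡ c ⊙ e₁) → y ≡ 𝟎
      from-lines (c , y≡ce₀) (d , y≡de₁) = triple (trans (at₀ y≡de₁) (zeroʳ d))
        (trans (at₁ y≡ce₀) (zeroʳ c)) (trans (at₂ y≡ce₀) (zeroʳ c))

  module _ {P : V → Set} {c : ℕ} (U : ScatteredSubspace P c) {n : ℕ}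
           (size-K×F<q^n : size ℕ.* q ℕ.< q ℕ.^ n) (u : Fin n → V) (comb∈P : ∀ a → P (comb a u))
           (independent : Independent u) where
    open ScatteredSubspace U

    private
      size-K<q^n : size ℕ.< q ℕ.^ n
      size-K<q^n = ℕ.≤-<-trans (ℕ.m≤m*n size q {{ℕ.>-nonZero (ℕ.<-trans ℕ.z<s 1<q)}}) size-K×F<q^n

      -- Pigeonhole into K gives a nonzero a with some coordinate aᵢ ≠ 0; pigeonhole into K × F,
      -- which also records the i-th coordinate, gives a nonzero b with bᵢ = 0. The second one needs
      -- q^(m+1) < q^n, whence n = m + 2.
      kernel-pair : ∀ x → ∃[ a ] ∃[ b ] (∃[ i ] a i ≢ F.0# × b i ≡ F.0#) × (∃[ j ] b j ≢ F.0#) ×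
                    x ∙ comb a u ≡ 0# × x ∙ comb b u ≡ 0#
      kernel-pair x with collapse finite size-K<q^n (λ a → lin a (λ i → x ∙ u i))
      ... | a₁ , a₂ , (i , a₁≢a₂) , a-eq
        with collapse (↔-trans (finite ×-↔ F.finite) (↔-sym Fin.*↔×)) size-K×F<q^n (λ b → lin b (λ i → x ∙ u i) , b i)
      ... | b₁ , b₂ , (j , b₁≢b₂) , b-eq =
        (λ t → a₁ t F.- a₂ t) , (λ t → b₁ t F.- b₂ t) ,
        (i , a₁≢a₂ ∘ FT.x-y≡0⇒x≡y , FT.x≡y⇒x-y≡0 (cong proj₂ b-eq)) ,
        (j , b₁≢b₂ ∘ FT.x-y≡0⇒x≡y) ,
        in-kernel a₁ a₂ a-eq , in-kernel b₁ b₂ (cong proj₁ b-eq)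
        where
        in-kernel : ∀ a b → lin a (λ i → x ∙ u i) ≡ lin b (λ i → x ∙ u i) → x ∙ comb (λ t → a t F.- b t) u ≡ 0#
        in-kernel a b eq = trans (∙-comb x _ u) (trans (lin-difference a b _) (x≡y⇒x-y≡0 eq))

      -- Scatteredness turns a proportionality over K into one over F, and the i-th coefficients
      -- exclude that.
      not-proportional : ∀ a b → (∃[ i ] a i ≢ F.0# × b i ≡ F.0#) → (∃[ j ] b j ≢ F.0#) →
                         cross (comb a u) (comb b u) ≢ 𝟎
      not-proportional a b (i , aᵢ≢0 , bᵢ≡0) (j , bⱼ≢0) eq =
        dependent (cross≡𝟎⇒proportional (comb a u) (comb b u) ub≢𝟎 eq)
        where
        ub≢𝟎 : comb b u ≢ 𝟎
        ub≢𝟎 ub≡𝟎 = bⱼ≢0 (independent b ub≡𝟎 j)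

        cancel : ∀ c x → c * x + (- c) * x ≡ 0#
        cancel = solve 2 (λ c x → c :* x :+ (:- c) :* x := :0) refl

        cancel-⊙ : ∀ c v → c ⊙ v ⊕ (- c) ⊙ v ≡ 𝟎
        cancel-⊙ c (v₀ , v₁ , v₂) = triple (cancel c v₀) (cancel c v₁) (cancel c v₂)

        relation : ∀ f → comb a u ≡ ι f ⊙ comb b u → comb (λ t → a t F.+ (F.- f) F.* b t) u ≡ 𝟎
        relation f eq′ = begin
          comb (λ t → a t F.+ (F.- f) F.* b t) u   ≡⟨ comb-affine (F.- f) a b u ⟩
          comb a u ⊕ ι (F.- f) ⊙ comb b u          ≡⟨ cong₂ (λ s t → s ⊕ t ⊙ comb b u) eq′ (ι-neg f) ⟩
          ι f ⊙ comb b u ⊕ (- ι f) ⊙ comb b u      ≡⟨ cancel-⊙ (ι f) (comb b u) ⟩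
          𝟎                                        ∎

        contradiction : ∀ f → comb a u ≡ ι f ⊙ comb b u → ⊥
        contradiction f eq′ = aᵢ≢0 (begin
          a i                          ≡⟨ F.solve 2 (λ a c → a F.:= a F.:+ c F.:* F.:0) refl (a i) (F.- f) ⟩
          a i F.+ (F.- f) F.* F.0#     ≡⟨ cong (λ t → a i F.+ (F.- f) F.* t) bᵢ≡0 ⟨
          a i F.+ (F.- f) F.* b i      ≡⟨ independent _ (relation f eq′) i ⟩
          F.0#                         ∎)

        dependent : (∃[ l ] comb a u ≡ l ⊙ comb b u) → ⊥
        dependent (l , eq′) with scattered l (comb∈P a) (comb∈P b) ub≢𝟎 eq′
        ... | f , ιf≡l = contradiction f (trans eq′ (cong (_⊙ comb b u) (sym ιf≡l)))

    -- Two independent points of U on the plane of x determine this plane: x and y are both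
    -- multiples of their cross product.
    cutting : ∀ {x y} → x ≢ 𝟎 → (∀ a → x ∙ comb a u ≡ 0# → y ∙ comb a u ≡ 0#) → ∃[ c ] y ≡ c ⊙ x
    cutting {x} {y} x≢𝟎 x⊥⇒y⊥ = from-pair (kernel-pair x)
      where
      quotient : ∀ p → (∃[ β ] x ≡ β ⊙ p) → (∃[ β ] y ≡ β ⊙ p) → ∃[ c ] y ≡ c ⊙ x
      quotient p (β , x≡βp) (β′ , y≡β′p) = β′ * β ⁻¹ , (begin
        y                          ≡⟨ y≡β′p ⟩
        β′ ⊙ p                     ≡⟨ cong (_⊙ p) (*-identityʳ β′) ⟨
        (β′ * 1#) ⊙ p              ≡⟨ cong (λ t → (β′ * t) ⊙ p) (trans (*-comm _ β) (*-inverseʳ β≢0)) ⟨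
        (β′ * (β ⁻¹ * β)) ⊙ p      ≡⟨ cong (_⊙ p) (*-assoc β′ (β ⁻¹) β) ⟨
        (β′ * β ⁻¹ * β) ⊙ p        ≡⟨ ⊙-assoc _ β p ⟨
        (β′ * β ⁻¹) ⊙ (β ⊙ p)      ≡⟨ cong ((β′ * β ⁻¹) ⊙_) x≡βp ⟨
        (β′ * β ⁻¹) ⊙ x            ∎)
        where
        β≢0 : β ≢ 0#
        β≢0 eq = x≢𝟎 (trans x≡βp (trans (cong (_⊙ p) eq) (0⊙ p)))

      from-pair : (∃[ a ] ∃[ b ] (∃[ i ] a i ≢ F.0# × b i ≡ F.0#) × (∃[ j ] b j ≢ F.0#) ×
                  x ∙ comb a u ≡ 0# × x ∙ comb b u ≡ 0#) → ∃[ c ] y ≡ c ⊙ x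
      from-pair (a , b , witness-a , witness-b , xa , xb) = quotient (cross (comb a u) (comb b u))
        (orthogonal⇒proportional {x} {comb a u} {comb b u} p≢𝟎 xa xb)
        (orthogonal⇒proportional {y} {comb a u} {comb b u} p≢𝟎 (x⊥⇒y⊥ a xa) (x⊥⇒y⊥ b xb))
        where
        p≢𝟎 : cross (comb a u) (comb b u) ≢ 𝟎
        p≢𝟎 = not-proportional a b witness-a witness-b

  cuttingFamily : ∀ {P c} → ScatteredSubspace P c → q ℕ.^ (2 ℕ.+ m) ℕ.≤ c → CuttingFamily (2 ℕ.+ m)
  cuttingFamily {P} {c} U q^2+m≤c = from-family (independent-family U (2 ℕ.+ m) q^2+m≤c)
    where
    size-K×F : size ℕ.* q ℕ.< q ℕ.^ (2 ℕ.+ m)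
    size-K×F = subst (ℕ._< q ℕ.^ (2 ℕ.+ m)) (trans (ℕ.*-comm q (q ℕ.^ m)) (cong (ℕ._* q) (sym size-K)))
      (ℕ.^-monoʳ-< q 1<q (ℕ.n<1+n (suc m)))

    from-family : ∃[ u ] (∀ i → P (u i)) × Independent {2 ℕ.+ m} u → CuttingFamily (2 ℕ.+ m)
    from-family (u , u∈P , independent) = record
      { u = u ; independent = independent
      ; cutting = cutting U size-K×F u (λ a → comb-closed U a u u∈P) independent }

-- Scattered subspaces for even m

module QuadraticSubfield (s : ℕ) (X : Extension (s ℕ.+ s)) where
  open Extension X
  open FiniteField K
  open FieldTheory K
  open Frobenius X
  open ≡-Reasoning

  bar : Carrier → Carrier
  bar = φ s

  bar-involutive : ∀ x → bar (bar x) ≡ x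
  bar-involutive x = trans (φ-compose s s x) (φ-period x)

  non-fixed : 0 ℕ.< s → ∃[ ω ] ¬ Fixed s ω
  non-fixed 0<s with distinct-powers 1<q^s q^s<size (Inverse.from finite) from-injective
    where
    1<q : 1 ℕ.< q
    1<q = FieldTheory.1<size F

    1<q^s : 1 ℕ.< q ℕ.^ s
    1<q^s = ℕ.^-monoʳ-< q 1<q 0<s

    q^s<size : q ℕ.^ s ℕ.< size
    q^s<size = subst (q ℕ.^ s ℕ.<_) (sym size-K) (ℕ.^-monoʳ-< q 1<q (ℕ.m<m+n s 0<s))
  ... | i , ω^q^s≢ω = Inverse.from finite i , λ fixed → ω^q^s≢ω (trans fixed (sym (*-identityʳ _)))

  module Coordinates (ω : Carrier) (ω-moves : ¬ Fixed s ω) where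
    δ : Carrier
    δ = ω - bar ω

    δ≢0 : δ ≢ 0#
    δ≢0 eq = ω-moves (sym (x-y≡0⇒x≡y eq))

    ω≢0 : ω ≢ 0#
    ω≢0 refl = ω-moves (φ-0 s)

    -- δ and z are both negated by bar.
    quotient-fixed : ∀ {y z} → δ * y ≡ z → bar z ≡ - z → Fixed s y
    quotient-fixed {y} {z} δy≡z bar-z = *-cancelˡ δ≢0 (begin
      δ * bar y           ≡⟨ solve 2 (λ d y → d :* y := :- ((:- d) :* y)) refl δ (bar y) ⟩
      - ((- δ) * bar y)   ≡⟨ cong (λ t → - (t * bar y)) bar-δ ⟨
      - (bar δ * bar y)   ≡⟨ cong -_ (φ-* s δ y) ⟨
      - bar (δ * y)       ≡⟨ cong (λ t → - bar t) δy≡z ⟩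
      - bar z             ≡⟨ cong -_ bar-z ⟩
      - (- z)             ≡⟨ solve 1 (λ z → :- (:- z) := z) refl z ⟩
      z                   ≡⟨ δy≡z ⟨
      δ * y               ∎)
      where
      bar-δ : bar δ ≡ - δ
      bar-δ = trans (φ-sub s ω (bar ω)) (trans (cong (λ t → bar ω - t) (bar-involutive ω))
        (solve 2 (λ a b → b :- a := :- (a :- b)) refl ω (bar ω)))

    -- Together with `real` this is Cramer's rule for x = r + ω i and its conjugate equation, where
    -- r and i lie in L; the determinant is δ up to sign.
    imaginary : Carrier → Carrier
    imaginary x = δ ⁻¹ * (x - bar x)

    δ-imaginary : ∀ x → δ * imaginary x ≡ x - bar x
    δ-imaginary x = *-⁻¹-cancel _ δ≢0

    imaginary-fixed : ∀ x → Fixed s (imaginary x)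
    imaginary-fixed x = quotient-fixed (δ-imaginary x) (begin
      bar (x - bar x)      ≡⟨ φ-sub s x (bar x) ⟩
      bar x - bar (bar x)  ≡⟨ cong (λ t → bar x - t) (bar-involutive x) ⟩
      bar x - x            ≡⟨ solve 2 (λ x y → y :- x := :- (x :- y)) refl x (bar x) ⟩
      - (x - bar x)        ∎)

    imaginary≡0⇒fixed : ∀ {x} → imaginary x ≡ 0# → Fixed s x
    imaginary≡0⇒fixed {x} eq = sym (x-y≡0⇒x≡y (trans (sym (δ-imaginary x)) (trans (cong (δ *_) eq) (zeroʳ δ))))

    real : Carrier → Carrier
    real x = δ ⁻¹ * (ω * bar x - bar ω * x)

    δ-real : ∀ x → δ * real x ≡ ω * bar x - bar ω * x
    δ-real x = *-⁻¹-cancel _ δ≢0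

    real-fixed : ∀ x → Fixed s (real x)
    real-fixed x = quotient-fixed (δ-real x) (begin
      bar (ω * bar x - bar ω * x)                      ≡⟨ φ-sub s _ _ ⟩
      bar (ω * bar x) - bar (bar ω * x)                ≡⟨ cong₂ _-_ (φ-* s ω (bar x)) (φ-* s (bar ω) x) ⟩
      bar ω * bar (bar x) - bar (bar ω) * bar x        ≡⟨ cong₂ (λ a b → bar ω * a - b * bar x) (bar-involutive x) (bar-involutive ω) ⟩
      bar ω * x - ω * bar x                            ≡⟨ solve 4 (λ w v x y → v :* x :- w :* y := :- (w :* y :- v :* x)) refl ω (bar ω) x (bar x) ⟩
      - (ω * bar x - bar ω * x)                        ∎)

    decompose : ∀ x → x ≡ real x + ω * imaginary x
    decompose x = *-cancelˡ δ≢0 (begin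
      δ * x                                              ≡⟨ solve 4 (λ w v x y → (w :- v) :* x := (w :* y :- v :* x) :+ w :* (x :- y)) refl ω (bar ω) x (bar x) ⟩
      (ω * bar x - bar ω * x) + ω * (x - bar x)          ≡⟨ cong₂ (λ a b → a + ω * b) (δ-real x) (δ-imaginary x) ⟨
      δ * real x + ω * (δ * imaginary x)                 ≡⟨ solve 4 (λ d r w i → d :* r :+ w :* (d :* i) := d :* (r :+ w :* i)) refl δ (real x) ω (imaginary x) ⟩
      δ * (real x + ω * imaginary x)                     ∎)

    fixedElements : Enumeration (Fixed s)
    fixedElements = enumerate finite (λ x → bar x ≟ x)

    -- An element is determined by its real and imaginary parts, so q^(2s) is at most the square of
    -- the number of fixed elements.
    many-fixed : q ℕ.^ s ℕ.≤ Enumeration.count fixedElements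
    many-fixed = square-root (pair-bound finite fixedElements real-fixed imaginary-fixed coordinates-injective)
      where
      coordinates-injective : ∀ {x y} → real x ≡ real y → imaginary x ≡ imaginary y → x ≡ y
      coordinates-injective {x} {y} real-eq imaginary-eq = begin
        x                          ≡⟨ decompose x ⟩
        real x + ω * imaginary x   ≡⟨ cong₂ (λ a b → a + ω * b) real-eq imaginary-eq ⟩
        real y + ω * imaginary y   ≡⟨ decompose y ⟨
        y                          ∎

      square-root : ∀ {c} → size ℕ.≤ c ℕ.* c → q ℕ.^ s ℕ.≤ c
      square-root {c} size≤c² = ℕ.≮⇒≥ λ c<q^s → ℕ.<⇒≱ (ℕ.*-mono-< c<q^s c<q^s)
        (subst (ℕ._≤ c ℕ.* c) (trans size-K (ℕ.^-distribˡ-+-* q s s)) size≤c²)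

    -- The hypotheses are one coordinate of the equation f x + ω x = l (f y + ω y) and its
    -- conjugate. Solving them expresses x and X through Y and y by the matrix over L of
    -- multiplication by l in the basis 1, ω.
    module Relations {x X y Y l} (eq : X + ω * x ≡ l * (Y + ω * y))
                                 (bar-eq : X + bar ω * x ≡ bar l * (Y + bar ω * y)) where

      -- Subtracting the two equations eliminates X and leaves δ x.
      x-relation : x ≡ imaginary l * Y + imaginary (l * ω) * y
      x-relation = *-cancelˡ δ≢0 (begin
        δ * x                                       ≡⟨ solve 4 (λ w v X x → (w :- v) :* x := (X :+ w :* x) :- (X :+ v :* x)) refl ω (bar ω) X x ⟩
        (X + ω * x) - (X + bar ω * x)               ≡⟨ cong₂ _-_ eq bar-eq ⟩
        l * (Y + ω * y) - bar l * (Y + bar ω * y)   ≡⟨ solve 6 (λ l k w v Y y → l :* (Y :+ w :* y) :- k :* (Y :+ v :* y) := (l :- k) :* Y :+ (l :* w :- k :* v) :* y) refl l (bar l) ω (bar ω) Y y ⟩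
        (l - bar l) * Y + (l * ω - bar l * bar ω) * y ≡⟨ cong₂ (λ a b → a * Y + b * y) (sym (δ-imaginary l)) (trans (cong (λ t → l * ω - t) (sym (φ-* s l ω))) (sym (δ-imaginary (l * ω)))) ⟩
        δ * imaginary l * Y + δ * imaginary (l * ω) * y ≡⟨ solve 5 (λ d i Y j y → d :* i :* Y :+ d :* j :* y := d :* (i :* Y :+ j :* y)) refl δ _ Y _ y ⟩
        δ * (imaginary l * Y + imaginary (l * ω) * y) ∎)

      X-relation : X ≡ real l * Y + (- (ω * bar ω) * imaginary l) * y
      X-relation = *-cancelˡ δ≢0 (begin
        δ * X                                       ≡⟨ solve 4 (λ w v X x → (w :- v) :* X := w :* (X :+ v :* x) :- v :* (X :+ w :* x)) refl ω (bar ω) X x ⟩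
        ω * (X + bar ω * x) - bar ω * (X + ω * x)   ≡⟨ cong₂ (λ a b → ω * a - bar ω * b) bar-eq eq ⟩
        ω * (bar l * (Y + bar ω * y)) - bar ω * (l * (Y + ω * y))
          ≡⟨ solve 6 (λ l k w v Y y → w :* (k :* (Y :+ v :* y)) :- v :* (l :* (Y :+ w :* y)) := (w :* k :- v :* l) :* Y :+ (:- (w :* v) :* (l :- k)) :* y) refl l (bar l) ω (bar ω) Y y ⟩
        (ω * bar l - bar ω * l) * Y + (- (ω * bar ω) * (l - bar l)) * y
          ≡⟨ cong₂ (λ a b → a * Y + (- (ω * bar ω) * b) * y) (sym (δ-real l)) (sym (δ-imaginary l)) ⟩
        δ * real l * Y + (- (ω * bar ω) * (δ * imaginary l)) * y
          ≡⟨ solve 6 (λ d r Y b i y → d :* r :* Y :+ (b :* (d :* i)) :* y := d :* (r :* Y :+ (b :* i) :* y)) refl δ (real l) Y (- (ω * bar ω)) (imaginary l) y ⟩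
        δ * (real l * Y + (- (ω * bar ω) * imaginary l) * y) ∎)

      module _ (l-fixed : Fixed s l) where
        private
          real≡l : real l ≡ l
          real≡l = *-cancelˡ δ≢0 (trans (δ-real l) (trans (cong (λ t → ω * t - bar ω * l) l-fixed)
            (solve 3 (λ w v l → w :* l :- v :* l := (w :- v) :* l) refl ω (bar ω) l)))

          imaginary≡0 : imaginary l ≡ 0#
          imaginary≡0 = trans (cong (λ t → δ ⁻¹ * (l - t)) l-fixed)
            (solve 2 (λ d l → d :* (l :- l) := :0) refl (δ ⁻¹) l)

          imaginary-lω≡l : imaginary (l * ω) ≡ l
          imaginary-lω≡l = *-cancelˡ δ≢0 (begin
            δ * imaginary (l * ω)     ≡⟨ δ-imaginary (l * ω) ⟩
            l * ω - bar (l * ω)       ≡⟨ cong (λ t → l * ω - t) (φ-* s l ω) ⟩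
            l * ω - bar l * bar ω     ≡⟨ cong (λ t → l * ω - t * bar ω) l-fixed ⟩
            l * ω - l * bar ω         ≡⟨ solve 3 (λ l w v → l :* w :- l :* v := (w :- v) :* l) refl l ω (bar ω) ⟩
            δ * l                     ∎)

        fixed-x : x ≡ l * y
        fixed-x = trans x-relation (trans (cong₂ (λ a b → a * Y + b * y) imaginary≡0 imaginary-lω≡l)
          (solve 3 (λ Y l y → :0 :* Y :+ l :* y := l :* y) refl Y l y))

        fixed-X : X ≡ l * Y
        fixed-X = trans X-relation (trans (cong₂ (λ a b → a * Y + (- (ω * bar ω) * b) * y) real≡l imaginary≡0)
          (solve 4 (λ Y l b y → l :* Y :+ (b :* :0) :* y := l :* Y) refl Y l (- (ω * bar ω)) y))

-- The subspace { f y + ω y : y = bar y } for a semilinear map f: an equation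
-- (f x + ω x) = l (f y + ω y) with l outside the subfield L fixed by bar makes
-- the span of y and f y over L invariant under f.
module SemilinearGraph (s : ℕ) (X : Extension (s ℕ.+ s)) (ω : FiniteField.Carrier (Extension.K X)) where
  open Extension X
  open FiniteField K
  open FieldTheory K
  open Frobenius X
  open QuadraticSubfield s X
  open Space K
  open CrossProduct K
  open Scattered F→K (s ℕ.+ s) size-K using (ScatteredSubspace)
  open Embedding F→K
  open ≡-Reasoning

  -- The fixed vectors of `bar-V` are the L-form M. It stays abstract because two forms occur:
  -- coordinatewise conjugation when 6 divides m, and a Frobenius power of the cubic extension
  -- otherwise. The twist r of f is 1 in the first case and 3 in the second.
  module Graph
    (ω-moves : ¬ Fixed s ω)
    (bar-V : V → V)
    (bar-V-⊕ : ∀ x y → bar-V (x ⊕ y) ≡ bar-V x ⊕ bar-V y)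
    (bar-V-⊙ : ∀ c x → bar-V (c ⊙ x) ≡ bar c ⊙ bar-V x)
    (r : ℕ)
    (f : V → V)
    (f-⊕ : ∀ x y → f (x ⊕ y) ≡ f x ⊕ f y)
    (f-⊙ : ∀ c x → f (c ⊙ x) ≡ φ r c ⊙ f x)
    (f-bar : ∀ {x} → bar-V x ≡ x → bar-V (f x) ≡ f x)
    (f-nonzero : ∀ {x} → x ≢ 𝟎 → f x ≢ 𝟎)
    (fixed-s-r : ∀ {l} → Fixed s l → Fixed r l → Fixed 1 l)
    (no-invariant-plane : ∀ {y} → bar-V y ≡ y → y ≢ 𝟎 → ∀ {C D} → Fixed s C → Fixed s D → D ≢ 0# →
                          f (f y) ≢ D ⊙ y ⊕ C ⊙ f y)
    where

    open Coordinates ω ω-moves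

    P : V → Set
    P v = ∃[ y ] bar-V y ≡ y × v ≡ f y ⊕ ω ⊙ y

    private
      f-𝟎 : f 𝟎 ≡ 𝟎
      f-𝟎 = begin
        f 𝟎               ≡⟨ cong f (0⊙ 𝟎) ⟨
        f (0# ⊙ 𝟎)        ≡⟨ f-⊙ 0# 𝟎 ⟩
        φ r 0# ⊙ f 𝟎      ≡⟨ cong (_⊙ f 𝟎) (φ-0 r) ⟩
        0# ⊙ f 𝟎          ≡⟨ 0⊙ (f 𝟎) ⟩
        𝟎                 ∎

      fixed-F : ∀ j g → Fixed j (ι g)
      fixed-F j g = subst (λ k → Fixed k (ι g)) (ℕ.*-identityʳ j) (fixed-multiple j (ι-fixed g))

      conjugate-equation : ∀ {x y l} → bar-V x ≡ x → bar-V y ≡ y → f x ⊕ ω ⊙ x ≡ l ⊙ (f y ⊕ ω ⊙ y) →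
                           f x ⊕ bar ω ⊙ x ≡ bar l ⊙ (f y ⊕ bar ω ⊙ y)
      conjugate-equation {x} {y} {l} fx fy eq = begin
        f x ⊕ bar ω ⊙ x                    ≡⟨ conjugate-point fx ⟨
        bar-V (f x ⊕ ω ⊙ x)                ≡⟨ cong bar-V eq ⟩
        bar-V (l ⊙ (f y ⊕ ω ⊙ y))          ≡⟨ bar-V-⊙ l _ ⟩
        bar l ⊙ bar-V (f y ⊕ ω ⊙ y)        ≡⟨ cong (bar l ⊙_) (conjugate-point fy) ⟩
        bar l ⊙ (f y ⊕ bar ω ⊙ y)          ∎
        where
        conjugate-point : ∀ {x} → bar-V x ≡ x → bar-V (f x ⊕ ω ⊙ x) ≡ f x ⊕ bar ω ⊙ x
        conjugate-point {x} fx = trans (bar-V-⊕ (f x) (ω ⊙ x))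
          (cong₂ _⊕_ (f-bar fx) (trans (bar-V-⊙ ω x) (cong (bar ω ⊙_) fx)))

      module Equation {x y l} (fx : bar-V x ≡ x) (fy : bar-V y ≡ y) (y≢𝟎 : y ≢ 𝟎)
                      (eq : f x ⊕ ω ⊙ x ≡ l ⊙ (f y ⊕ ω ⊙ y)) where
        bar-eq : f x ⊕ bar ω ⊙ x ≡ bar l ⊙ (f y ⊕ bar ω ⊙ y)
        bar-eq = conjugate-equation fx fy eq

        module R₀ = Relations {l = l} (at₀ eq) (at₀ bar-eq)
        module R₁ = Relations {l = l} (at₁ eq) (at₁ bar-eq)
        module R₂ = Relations {l = l} (at₂ eq) (at₂ bar-eq)

        v u u′ B : Carrier
        v  = imaginary l
        u  = real l
        u′ = imaginary (l * ω)
        B  = - (ω * bar ω)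

        -- For l in L the relations give x = l y and f x = l (f y), while semilinearity gives f x =
        -- (φ r l) (f y); as f y ≠ 0, l is fixed by `φ r` too.
        l-fixed⇒F : Fixed s l → Fixed 1 l
        l-fixed⇒F l-fixed = fixed-s-r l-fixed (x-y≡0⇒x≡y scalar≡0)
          where
          fx≡φl⊙fy : f x ≡ φ r l ⊙ f y
          fx≡φl⊙fy = trans (cong f (triple (R₀.fixed-x l-fixed) (R₁.fixed-x l-fixed) (R₂.fixed-x l-fixed))) (f-⊙ l y)

          fx≡l⊙fy : f x ≡ l ⊙ f y
          fx≡l⊙fy = triple (R₀.fixed-X l-fixed) (R₁.fixed-X l-fixed) (R₂.fixed-X l-fixed)

          difference : (φ r l - l) ⊙ f y ≡ 𝟎
          difference = triple (sub (at₀ both)) (sub (at₁ both)) (sub (at₂ both))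
            where
            both : φ r l ⊙ f y ≡ l ⊙ f y
            both = trans (sym fx≡φl⊙fy) fx≡l⊙fy

            sub : ∀ {a b c} → a * c ≡ b * c → (a - b) * c ≡ 0#
            sub {a} {b} {c} e = trans (solve 3 (λ a b c → (a :- b) :* c := a :* c :- b :* c) refl a b c) (x≡y⇒x-y≡0 e)

          scalar≡0 : φ r l - l ≡ 0#
          scalar≡0 with (φ r l - l) ≟ 0#
          ... | yes eq₀ = eq₀
          ... | no  neq = ⊥-elim (f-nonzero y≢𝟎 (⊙-cancel neq difference))

        -- Applying f to x = v (f y) + u′ y and comparing with f x = u (f y) + B v y gives an
        -- equation that, for v ≠ 0, can be solved for f (f y).
        v≡0 : v ≡ 0#
        v≡0 with v ≟ 0#
        ... | yes eq₀ = eq₀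
        ... | no  v≢0 = ⊥-elim (no-invariant-plane fy y≢𝟎 {C} {D} C-fixed D-fixed D≢0 ffy)
          where
          w C D : Carrier
          w = φ r v ⁻¹
          C = w * (u - φ r u′)
          D = w * (B * v)

          φv≢0 : φ r v ≢ 0#
          φv≢0 = φ-nonzero r v≢0

          w-fixed : Fixed s w
          w-fixed = fixed-⁻¹ {s} (fixed-φ {s} r (imaginary-fixed l))

          B-fixed : Fixed s B
          B-fixed = fixed-neg {s} (trans (φ-* s ω (bar ω)) (trans (cong (bar ω *_) (bar-involutive ω)) (*-comm (bar ω) ω)))

          C-fixed : Fixed s C
          C-fixed = fixed-* {s} w-fixed (fixed-+ {s} (real-fixed l) (fixed-neg {s} (fixed-φ {s} r (imaginary-fixed (l * ω)))))

          D-fixed : Fixed s D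
          D-fixed = fixed-* {s} w-fixed (fixed-* {s} B-fixed (imaginary-fixed l))

          D≢0 : D ≢ 0#
          D≢0 = *-nonzero (⁻¹-nonzero φv≢0) (*-nonzero B≢0 v≢0)
            where
            B≢0 : B ≢ 0#
            B≢0 eq₀ = *-nonzero ω≢0 (φ-nonzero s ω≢0) (trans (solve 1 (λ b → b := :- (:- b)) refl (ω * bar ω))
              (trans (cong -_ eq₀) (solve 0 (:- :0 := :0) refl)))

          x≡ : x ≡ v ⊙ f y ⊕ u′ ⊙ y
          x≡ = triple R₀.x-relation R₁.x-relation R₂.x-relation

          fx≡ : f x ≡ φ r v ⊙ f (f y) ⊕ φ r u′ ⊙ f y
          fx≡ = trans (cong f x≡) (trans (f-⊕ _ _) (cong₂ _⊕_ (f-⊙ v (f y)) (f-⊙ u′ y)))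

          both : φ r v ⊙ f (f y) ⊕ φ r u′ ⊙ f y ≡ u ⊙ f y ⊕ (B * v) ⊙ y
          both = trans (sym fx≡) (triple R₀.X-relation R₁.X-relation R₂.X-relation)

          component : ∀ {Z Y y} → φ r v * Z + φ r u′ * Y ≡ u * Y + (B * v) * y → Z ≡ D * y + C * Y
          component {Z} {Y} {y} e = *-cancelˡ φv≢0 (begin
            φ r v * Z                                     ≡⟨ solve 4 (λ a Z b Y → a :* Z := (a :* Z :+ b :* Y) :- b :* Y) refl (φ r v) Z (φ r u′) Y ⟩
            (φ r v * Z + φ r u′ * Y) - φ r u′ * Y         ≡⟨ cong (_- φ r u′ * Y) e ⟩
            (u * Y + (B * v) * y) - φ r u′ * Y            ≡⟨ solve 5 (λ u Y b y a → (u :* Y :+ b :* y) :- a :* Y := :1 :* (b :* y :+ (u :- a) :* Y)) refl u Y (B * v) y (φ r u′) ⟩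
            1# * ((B * v) * y + (u - φ r u′) * Y)         ≡⟨ cong (_* ((B * v) * y + (u - φ r u′) * Y)) (*-inverseʳ φv≢0) ⟨
            φ r v * w * ((B * v) * y + (u - φ r u′) * Y)  ≡⟨ solve 6 (λ a w b y c Y → a :* w :* (b :* y :+ c :* Y) := a :* (w :* b :* y :+ w :* c :* Y)) refl (φ r v) w (B * v) y (u - φ r u′) Y ⟩
            φ r v * (D * y + C * Y)                       ∎)

          ffy : f (f y) ≡ D ⊙ y ⊕ C ⊙ f y
          ffy = triple (component (at₀ both)) (component (at₁ both)) (component (at₂ both))

        l∈F : ∃[ g ] ι g ≡ l
        l∈F = fixed⇒ι (l-fixed⇒F (imaginary≡0⇒fixed v≡0))

    graph : ∀ {c} (M : Fin c → V) → Injective _≡_ _≡_ M → (∀ i → bar-V (M i) ≡ M i) → ScatteredSubspace P c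
    graph M M-injective M-fixed = record
      { ⊕-closed         = λ { {u} {v} (x , fx , u≡) (y , fy , v≡) → x ⊕ y ,
                             trans (bar-V-⊕ x y) (cong₂ _⊕_ fx fy) ,
                             trans (cong₂ _⊕_ u≡ v≡) (trans (interchange (f x) x (f y) y) (cong (_⊕ ω ⊙ (x ⊕ y)) (sym (f-⊕ x y)))) }
      ; ⊙-closed         = λ { g {v} (y , fy , v≡) → ι g ⊙ y ,
                             trans (bar-V-⊙ (ι g) y) (cong₂ _⊙_ (fixed-F s g) fy) ,
                             trans (cong (ι g ⊙_) v≡) (trans (scale-graph (ι g) (f y) y)
                               (cong (_⊕ ω ⊙ (ι g ⊙ y)) (sym (trans (f-⊙ (ι g) y) (cong (_⊙ f y) (fixed-F r g)))))) }
      ; scattered        = λ { l (x , fx , refl) (y , fy , refl) v≢𝟎 eq →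
                             Equation.l∈F fx fy (λ { refl → v≢𝟎 (trans (cong (_⊕ ω ⊙ 𝟎) f-𝟎) zero-graph) }) eq }
      ; points           = λ i → f (M i) ⊕ ω ⊙ M i
      ; points-injective = λ {i} {j} eq → M-injective (graph-injective (M-fixed i) (M-fixed j) eq)
      ; points-sound     = λ i → M i , M-fixed i , refl
      }
      where
      interchange : ∀ a x b y → (a ⊕ ω ⊙ x) ⊕ (b ⊕ ω ⊙ y) ≡ (a ⊕ b) ⊕ ω ⊙ (x ⊕ y)
      interchange (a₀ , a₁ , a₂) (x₀ , x₁ , x₂) (b₀ , b₁ , b₂) (y₀ , y₁ , y₂) =
        triple (step a₀ x₀ b₀ y₀) (step a₁ x₁ b₁ y₁) (step a₂ x₂ b₂ y₂)
        where
        step : ∀ a x b y → (a + ω * x) + (b + ω * y) ≡ (a + b) + ω * (x + y)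
        step = solve 5 (λ w a x b y → (a :+ w :* x) :+ (b :+ w :* y) := (a :+ b) :+ w :* (x :+ y)) refl ω

      scale-graph : ∀ c a x → c ⊙ (a ⊕ ω ⊙ x) ≡ c ⊙ a ⊕ ω ⊙ (c ⊙ x)
      scale-graph c (a₀ , a₁ , a₂) (x₀ , x₁ , x₂) = triple (step a₀ x₀) (step a₁ x₁) (step a₂ x₂)
        where
        step : ∀ a x → c * (a + ω * x) ≡ c * a + ω * (c * x)
        step = solve 4 (λ c w a x → c :* (a :+ w :* x) := c :* a :+ w :* (c :* x)) refl c ω

      zero-graph : 𝟎 ⊕ ω ⊙ 𝟎 ≡ 𝟎
      zero-graph = triple step step step
        where
        step : 0# + ω * 0# ≡ 0#
        step = solve 1 (λ w → :0 :+ w :* :0 := :0) refl ω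

      1⊙ : ∀ v → 1# ⊙ v ≡ v
      1⊙ (v₀ , v₁ , v₂) = triple (*-identityˡ v₀) (*-identityˡ v₁) (*-identityˡ v₂)

      -- The relations with l = 1, which lies in L, yield x = 1 · y.
      graph-injective : ∀ {x y} → bar-V x ≡ x → bar-V y ≡ y → f x ⊕ ω ⊙ x ≡ f y ⊕ ω ⊙ y → x ≡ y
      graph-injective {x} {y} fx fy eq = trans (triple
        (Relations.fixed-x {l = 1#} (at₀ eq₁) (at₀ bar-eq) (φ-1 s))
        (Relations.fixed-x {l = 1#} (at₁ eq₁) (at₁ bar-eq) (φ-1 s))
        (Relations.fixed-x {l = 1#} (at₂ eq₁) (at₂ bar-eq) (φ-1 s))) (1⊙ y)
        where
        eq₁ : f x ⊕ ω ⊙ x ≡ 1# ⊙ (f y ⊕ ω ⊙ y)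
        eq₁ = trans eq (sym (1⊙ _))

        bar-eq : f x ⊕ bar ω ⊙ x ≡ bar 1# ⊙ (f y ⊕ bar ω ⊙ y)
        bar-eq = conjugate-equation fx fy eq₁

-- Norms to the field of order q³

geometric : ℕ → ℕ → ℕ
geometric Q zero    = 0
geometric Q (suc n) = 1 ℕ.+ Q ℕ.* geometric Q n

-- The identity (Q - 1) g = Q^n - 1, rearranged to avoid subtraction.
geometric-sum : ∀ Q n → Q ℕ.* geometric Q n ℕ.+ 1 ≡ geometric Q n ℕ.+ Q ℕ.^ n
geometric-sum Q zero    = cong (ℕ._+ 1) (ℕ.*-zeroʳ Q)
geometric-sum Q (suc n) = begin
  Q ℕ.* (1 ℕ.+ Q ℕ.* g) ℕ.+ 1      ≡⟨ cong (λ k → Q ℕ.* k ℕ.+ 1) (trans (ℕ.+-comm 1 _) (geometric-sum Q n)) ⟩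
  Q ℕ.* (g ℕ.+ Q ℕ.^ n) ℕ.+ 1      ≡⟨ ℕ.+-comm _ 1 ⟩
  1 ℕ.+ Q ℕ.* (g ℕ.+ Q ℕ.^ n)      ≡⟨ cong (1 ℕ.+_) (ℕ.*-distribˡ-+ Q g _) ⟩
  1 ℕ.+ (Q ℕ.* g ℕ.+ Q ℕ.* Q ℕ.^ n) ≡⟨ ℕ.+-assoc 1 (Q ℕ.* g) _ ⟨
  1 ℕ.+ Q ℕ.* g ℕ.+ Q ℕ.* Q ℕ.^ n  ∎
  where
  open ≡-Reasoning
  g = geometric Q n

geometric-positive : ∀ Q n → 0 ℕ.< n → 0 ℕ.< geometric Q n
geometric-positive Q (suc n) _ = ℕ.z<s

module _ {q : ℕ} (1<q : 1 ℕ.< q) where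
  open ℕ.≤-Reasoning
  private
    instance
      q≢0 : ℕ.NonZero q
      q≢0 = ℕ.>-nonZero (ℕ.<-trans ℕ.z<s 1<q)

    1+q≤q³ : suc q ℕ.≤ q ℕ.^ 3
    1+q≤q³ = begin
      suc q             ≤⟨ ℕ.+-monoˡ-≤ q (ℕ.<⇒≤ 1<q) ⟩
      q ℕ.+ q           ≡⟨ cong (q ℕ.+_) (ℕ.+-identityʳ q) ⟨
      2 ℕ.* q           ≡⟨ ℕ.*-comm 2 q ⟩
      q ℕ.* 2           ≤⟨ ℕ.*-monoʳ-≤ q 1<q ⟩
      q ℕ.* q           ≤⟨ ℕ.*-monoʳ-≤ q (ℕ.m≤m*n q (q ℕ.^ 1) {{ℕ.m^n≢0 q 1}}) ⟩
      q ℕ.* (q ℕ.* q ℕ.^ 1) ∎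

  -- (q + 1) g ≤ q³ g = g + q^(3n) - 1 for the geometric sum g. A field of order q^(3n) thus has
  -- more elements than x^(qg) = x^g has roots.
  q*geometric<power : ∀ n → q ℕ.* geometric (q ℕ.^ 3) n ℕ.< q ℕ.^ (3 ℕ.* n)
  q*geometric<power n = subst (q ℕ.* g ℕ.<_) (ℕ.^-*-assoc q 3 n) (ℕ.+-cancelˡ-≤ g _ _ (begin
    g ℕ.+ suc (q ℕ.* g)        ≡⟨ ℕ.+-suc g _ ⟩
    suc (suc q ℕ.* g)          ≤⟨ ℕ.s≤s (ℕ.*-monoˡ-≤ g 1+q≤q³) ⟩
    suc (q ℕ.^ 3 ℕ.* g)        ≡⟨ ℕ.+-comm 1 _ ⟩
    q ℕ.^ 3 ℕ.* g ℕ.+ 1        ≡⟨ geometric-sum (q ℕ.^ 3) n ⟩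
    g ℕ.+ (q ℕ.^ 3) ℕ.^ n      ∎))
    where g = geometric (q ℕ.^ 3) n

  geometric<q*geometric : ∀ n → 0 ℕ.< n → geometric (q ℕ.^ 3) n ℕ.< q ℕ.* geometric (q ℕ.^ 3) n
  geometric<q*geometric n 0<n = subst (g ℕ.<_) (ℕ.*-comm g q) (ℕ.m<m*n g q {{ℕ.>-nonZero (geometric-positive _ n 0<n)}} 1<q)
    where g = geometric (q ℕ.^ 3) n

Prime-to-3 : ℕ → Set
Prime-to-3 s = (∃[ c ] s ≡ 1 ℕ.+ c ℕ.* 3) ⊎ (∃[ c ] s ≡ 2 ℕ.+ c ℕ.* 3)

prime-to-3-positive : ∀ {s} → Prime-to-3 s → 0 ℕ.< s
prime-to-3-positive (inj₁ (_ , refl)) = ℕ.z<s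
prime-to-3-positive (inj₂ (_ , refl)) = ℕ.z<s

prime-to-3-double : ∀ {s} → Prime-to-3 s → Prime-to-3 (s ℕ.+ s)
prime-to-3-double (inj₁ (c , refl)) = inj₂ (c ℕ.+ c , (begin
  1 ℕ.+ c ℕ.* 3 ℕ.+ (1 ℕ.+ c ℕ.* 3)    ≡⟨ cong suc (ℕ.+-suc (c ℕ.* 3) (c ℕ.* 3)) ⟩
  2 ℕ.+ (c ℕ.* 3 ℕ.+ c ℕ.* 3)          ≡⟨ cong (2 ℕ.+_) (ℕ.*-distribʳ-+ 3 c c) ⟨
  2 ℕ.+ (c ℕ.+ c) ℕ.* 3                ∎))
  where open ≡-Reasoning
prime-to-3-double (inj₂ (c , refl)) = inj₁ (1 ℕ.+ (c ℕ.+ c) , (begin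
  2 ℕ.+ c ℕ.* 3 ℕ.+ (2 ℕ.+ c ℕ.* 3)    ≡⟨ cong (2 ℕ.+_) (trans (ℕ.+-suc (c ℕ.* 3) _) (cong suc (ℕ.+-suc (c ℕ.* 3) (c ℕ.* 3)))) ⟩
  4 ℕ.+ (c ℕ.* 3 ℕ.+ c ℕ.* 3)          ≡⟨ cong (4 ℕ.+_) (ℕ.*-distribʳ-+ 3 c c) ⟨
  4 ℕ.+ (c ℕ.+ c) ℕ.* 3                ∎))
  where open ≡-Reasoning

module Norm {m : ℕ} (X : Extension m) where
  open Extension X
  open FiniteField K
  open FieldTheory K
  open Frobenius X
  open ≡-Reasoning

  1<q : 1 ℕ.< q
  1<q = FieldTheory.1<size F

  -- The field E meets the fixed field of `φ s` in F: division of s by 3 leaves remainder 1, or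
  -- remainder 2 and then 3 - 2 = 1.
  fixed-prime-to-3 : ∀ {s x} → Prime-to-3 s → Fixed 3 x → Fixed s x → Fixed 1 x
  fixed-prime-to-3 (inj₁ (c , refl)) f3 fs = fixed-remainder 1 c f3 fs
  fixed-prime-to-3 (inj₂ (c , refl)) f3 fs = fixed-2-3⇒1 f3 (fixed-remainder 2 c f3 fs)

  -- The norm from the field fixed by φ 3s to the field fixed by φ 3.
  norm : ℕ → Carrier → Carrier
  norm s x = x ^ geometric (q ℕ.^ 3) s

  norm-suc : ∀ s x → norm (suc s) x ≡ x * φ 3 (norm s x)
  norm-suc s x = cong (x *_) (trans (cong (x ^_) (ℕ.*-comm (q ℕ.^ 3) (geometric (q ℕ.^ 3) s)))
    (sym (^-assocʳ x (geometric (q ℕ.^ 3) s) (q ℕ.^ 3))))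

  norm-* : ∀ s x y → norm s (x * y) ≡ norm s x * norm s y
  norm-* s x y = ^-distrib-* x y (geometric (q ℕ.^ 3) s)

  -- Multiplication by x completes the exponent Q g to 1 + Q g = g + Q^s, and x^(Q^s) is x again.
  norm-φ : ∀ s {x} → x ≢ 0# → Fixed (3 ℕ.* s) x → norm s (φ 3 x) ≡ norm s x
  norm-φ s {x} x≢0 fx = *-cancelˡ x≢0 (begin
    x * (x ^ Q) ^ g           ≡⟨ cong (x *_) (^-assocʳ x Q g) ⟩
    x ^ suc (Q ℕ.* g)         ≡⟨ cong (x ^_) (trans (ℕ.+-comm 1 (Q ℕ.* g)) (geometric-sum Q s)) ⟩
    x ^ (g ℕ.+ Q ℕ.^ s)       ≡⟨ ^-homo-* x g (Q ℕ.^ s) ⟩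
    x ^ g * x ^ (Q ℕ.^ s)     ≡⟨ cong (λ k → x ^ g * x ^ k) (ℕ.^-*-assoc q 3 s) ⟩
    x ^ g * φ (3 ℕ.* s) x     ≡⟨ cong (x ^ g *_) fx ⟩
    x ^ g * x                 ≡⟨ *-comm _ x ⟩
    x * norm s x              ∎)
    where
    Q = q ℕ.^ 3
    g = geometric Q s

  norm-fixed : ∀ s {x} → x ≢ 0# → Fixed (3 ℕ.* s) x → Fixed 3 (norm s x)
  norm-fixed s {x} x≢0 fx = trans (φ-^ 3 x (geometric (q ℕ.^ 3) s)) (norm-φ s x≢0 fx)

  -- A norm in F means x^(qg) = x^g, an equation with at most qg roots.
  norm-not-in-F : ∀ s → 0 ℕ.< s → ∀ {c} (el : Fin c → Carrier) → Injective _≡_ _≡_ el →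
                  q ℕ.^ (3 ℕ.* s) ℕ.≤ c → ∃[ i ] ¬ Fixed 1 (norm s (el i))
  norm-not-in-F s 0<s el injective q^3s≤c = from-powers
    (distinct-powers (geometric<q*geometric 1<q s 0<s) (ℕ.<-≤-trans (q*geometric<power 1<q s) q^3s≤c) el injective)
    where
    g : ℕ
    g = geometric (q ℕ.^ 3) s

    from-powers : ∃[ i ] el i ^ (q ℕ.* g) ≢ el i ^ g → ∃[ i ] ¬ Fixed 1 (norm s (el i))
    from-powers (i , neq) = i , λ fixed → neq (begin
      el i ^ (q ℕ.* g)              ≡⟨ cong (el i ^_) (trans (ℕ.*-comm q g) (cong (g ℕ.*_) (sym (ℕ.*-identityʳ q)))) ⟩
      el i ^ (g ℕ.* (q ℕ.^ 1))      ≡⟨ ^-assocʳ (el i) g (q ℕ.^ 1) ⟨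
      φ 1 (norm s (el i))           ≡⟨ fixed ⟩
      el i ^ g                      ∎)

  norm-nonzero-argument : ∀ s → 0 ℕ.< s → ∀ {x} → ¬ Fixed 1 (norm s x) → x ≢ 0#
  norm-nonzero-argument s 0<s not-fixed refl = not-fixed
    (subst (Fixed 1) (sym (0^ (geometric (q ℕ.^ 3) s) (geometric-positive _ s 0<s))) (φ-0 1))

  -- ν, φ s ν and φ 2s ν would be three roots of the same quadratic.
  no-quadratic : ∀ {s ν β γ} → Prime-to-3 s → Fixed 3 ν → ¬ Fixed 1 ν → Fixed s β → Fixed s γ →
                 ν * ν ≢ β * ν + γ
  no-quadratic {s} {ν} {β} {γ} 3∤s ν∈E ν∉F fβ fγ quadratic = ν≢ν″ (begin
    ν                ≡⟨ solve 2 (λ a b → a := (a :+ b) :- b) refl ν ν′ ⟩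
    (ν + ν′) - ν′    ≡⟨ cong (_- ν′) (trans (vieta ν≢ν′ quadratic quadratic′) (sym (vieta ν′≢ν″ quadratic′ quadratic″))) ⟩
    (ν′ + ν″) - ν′   ≡⟨ solve 2 (λ a b → (a :+ b) :- a := b) refl ν′ ν″ ⟩
    ν″               ∎)
    where
    ν′ ν″ : Carrier
    ν′ = φ s ν
    ν″ = φ s ν′

    ν≢ν′ : ν ≢ ν′
    ν≢ν′ eq = ν∉F (fixed-prime-to-3 3∤s ν∈E (sym eq))

    ν′≢ν″ : ν′ ≢ ν″
    ν′≢ν″ eq = ν≢ν′ (φ-injective s eq)

    ν≢ν″ : ν ≢ ν″
    ν≢ν″ eq = ν∉F (fixed-prime-to-3 (prime-to-3-double 3∤s) ν∈E (trans (sym (φ-compose s s ν)) (sym eq)))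

    conjugate-quadratic : ∀ {x} → x * x ≡ β * x + γ → φ s x * φ s x ≡ β * φ s x + γ
    conjugate-quadratic {x} eq = begin
      φ s x * φ s x            ≡⟨ φ-* s x x ⟨
      φ s (x * x)              ≡⟨ cong (φ s) eq ⟩
      φ s (β * x + γ)          ≡⟨ φ-+ s _ γ ⟩
      φ s (β * x) + φ s γ      ≡⟨ cong₂ _+_ (trans (φ-* s β x) (cong (_* φ s x) fβ)) fγ ⟩
      β * φ s x + γ            ∎

    quadratic′ : ν′ * ν′ ≡ β * ν′ + γ
    quadratic′ = conjugate-quadratic quadratic

    quadratic″ : ν″ * ν″ ≡ β * ν″ + γ
    quadratic″ = conjugate-quadratic quadratic′

    vieta : ∀ {x y} → x ≢ y → x * x ≡ β * x + γ → y * y ≡ β * y + γ → x + y ≡ β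
    vieta {x} {y} x≢y ex ey = x-y≡0⇒x≡y (nonzero-*-≡0 (λ eq → x≢y (x-y≡0⇒x≡y eq)) (begin
      (x - y) * (x + y - β)                        ≡⟨ solve 3 (λ x y b → (x :- y) :* (x :+ y :- b) := (x :* x :- y :* y) :- b :* (x :- y)) refl x y β ⟩
      (x * x - y * y) - β * (x - y)                ≡⟨ cong₂ (λ a b → (a - b) - β * (x - y)) ex ey ⟩
      ((β * x + γ) - (β * y + γ)) - β * (x - y)    ≡⟨ solve 4 (λ x y b c → ((b :* x :+ c) :- (b :* y :+ c)) :- b :* (x :- y) := :0) refl x y β γ ⟩
      0#                                           ∎))

  -- With w = a (φ 3 y) / y the hypothesis reads w (φ 3 w) = d + c w.  Then
  -- every partial norm of w lies in L + L w, where L is the field fixed by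
  -- φ s; so does ν = norm w, and w is an affine function of ν over L.
  no-invariant-plane : ∀ {s a y c d} → Prime-to-3 s → Fixed (3 ℕ.* s) a → a ≢ 0# → ¬ Fixed 1 (norm s a) →
                       Fixed (3 ℕ.* s) y → y ≢ 0# → Fixed s c → Fixed s d →
                       a * φ 3 (a * φ 3 y) ≢ d * y + c * (a * φ 3 y)
  no-invariant-plane {s} {a} {y} {c} {d} 3∤s fa a≢0 ν∉F fy y≢0 fc fd plane = by-cases (affine s)
    where
    w : Carrier
    w = y ⁻¹ * (a * φ 3 y)

    yw : y * w ≡ a * φ 3 y
    yw = *-⁻¹-cancel _ y≢0

    w-equation : w * φ 3 w ≡ d + c * w
    w-equation = *-cancelˡ y≢0 (begin
      y * (w * φ 3 w)                  ≡⟨ *-assoc y w _ ⟨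
      y * w * φ 3 w                    ≡⟨ cong (_* φ 3 w) yw ⟩
      a * φ 3 y * φ 3 w                ≡⟨ *-assoc a _ _ ⟩
      a * (φ 3 y * φ 3 w)              ≡⟨ cong (a *_) (φ-* 3 y w) ⟨
      a * φ 3 (y * w)                  ≡⟨ cong (λ t → a * φ 3 t) yw ⟩
      a * φ 3 (a * φ 3 y)              ≡⟨ plane ⟩
      d * y + c * (a * φ 3 y)          ≡⟨ cong (λ t → d * y + c * t) yw ⟨
      d * y + c * (y * w)              ≡⟨ solve 4 (λ y w c d → d :* y :+ c :* (y :* w) := y :* (d :+ c :* w)) refl y w c d ⟩
      y * (d + c * w)                  ∎)

    affine : ∀ j → ∃[ A ] ∃[ B ] Fixed s A × Fixed s B × norm j w ≡ A + B * w
    affine zero    = 1# , 0# , φ-1 s , φ-0 s , solve 1 (λ w → :1 := :1 :+ :0 :* w) refl w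
    affine (suc j) with affine j
    ... | A , B , fA , fB , eq = φ 3 B * d , φ 3 A + φ 3 B * c ,
      fixed-* {s} (fixed-φ {s} 3 fB) fd , fixed-+ {s} (fixed-φ {s} 3 fA) (fixed-* {s} (fixed-φ {s} 3 fB) fc) , (begin
        norm (suc j) w                        ≡⟨ norm-suc j w ⟩
        w * φ 3 (norm j w)                    ≡⟨ cong (λ t → w * φ 3 t) eq ⟩
        w * φ 3 (A + B * w)                   ≡⟨ cong (w *_) (trans (φ-+ 3 A _) (cong (φ 3 A +_) (φ-* 3 B w))) ⟩
        w * (φ 3 A + φ 3 B * φ 3 w)           ≡⟨ solve 4 (λ w A B w′ → w :* (A :+ B :* w′) := A :* w :+ B :* (w :* w′)) refl w (φ 3 A) (φ 3 B) (φ 3 w) ⟩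
        φ 3 A * w + φ 3 B * (w * φ 3 w)       ≡⟨ cong (λ t → φ 3 A * w + φ 3 B * t) w-equation ⟩
        φ 3 A * w + φ 3 B * (d + c * w)       ≡⟨ solve 5 (λ w A B c d → A :* w :+ B :* (d :+ c :* w) := B :* d :+ (A :+ B :* c) :* w) refl w (φ 3 A) (φ 3 B) c d ⟩
        φ 3 B * d + (φ 3 A + φ 3 B * c) * w   ∎)

    ν : Carrier
    ν = norm s a

    ν∈E : Fixed 3 ν
    ν∈E = norm-fixed s a≢0 fa

    norm-w : norm s w ≡ ν
    norm-w = *-cancelˡ (^-nonzero (geometric (q ℕ.^ 3) s) y≢0) (begin
      norm s y * norm s w           ≡⟨ norm-* s y w ⟨
      norm s (y * w)                ≡⟨ cong (norm s) yw ⟩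
      norm s (a * φ 3 y)            ≡⟨ norm-* s a (φ 3 y) ⟩
      norm s a * norm s (φ 3 y)     ≡⟨ cong (norm s a *_) (norm-φ s y≢0 fy) ⟩
      norm s a * norm s y           ≡⟨ *-comm _ _ ⟩
      norm s y * ν                  ∎)

    by-cases : (∃[ A ] ∃[ B ] Fixed s A × Fixed s B × norm s w ≡ A + B * w) → ⊥
    by-cases (A , B , fA , fB , eq) = split (B ≟ 0#)
      where
      ν≡ : ν ≡ A + B * w
      ν≡ = trans (sym norm-w) eq

      Bw : B * w ≡ ν - A
      Bw = trans (solve 3 (λ A B w → B :* w := (A :+ B :* w) :- A) refl A B w) (cong (_- A) (sym ν≡))

      φBw : φ 3 B * φ 3 w ≡ ν - φ 3 A
      φBw = trans (sym (φ-* 3 B w)) (trans (cong (φ 3) Bw) (trans (φ-sub 3 ν A) (cong (_- φ 3 A) ν∈E)))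

      -- These come from (ν - A)(ν - φ 3 A) = B (φ 3 B) w (φ 3 w), in which `w-equation` replaces w
      -- (φ 3 w) by d + c w, and then B w is replaced by ν - A.
      β γ : Carrier
      β = A + φ 3 A + φ 3 B * c
      γ = B * φ 3 B * d - φ 3 B * c * A - A * φ 3 A

      fφA : Fixed s (φ 3 A)
      fφA = fixed-φ {s} 3 fA

      fφBc : Fixed s (φ 3 B * c)
      fφBc = fixed-* {s} (fixed-φ {s} 3 fB) fc

      rest : Carrier
      rest = (A + φ 3 A) * ν - A * φ 3 A

      quadratic : ν * ν ≡ β * ν + γ
      quadratic = begin
        ν * ν
          ≡⟨ solve 3 (λ n A A′ → n :* n := (n :- A) :* (n :- A′) :+ ((A :+ A′) :* n :- A :* A′)) refl ν A (φ 3 A) ⟩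
        (ν - A) * (ν - φ 3 A) + rest
          ≡⟨ cong (_+ rest) (cong₂ _*_ Bw φBw) ⟨
        B * w * (φ 3 B * φ 3 w) + rest
          ≡⟨ cong (_+ rest) (solve 4 (λ B w B′ w′ → B :* w :* (B′ :* w′) := B :* B′ :* (w :* w′)) refl B w (φ 3 B) (φ 3 w)) ⟩
        B * φ 3 B * (w * φ 3 w) + rest
          ≡⟨ cong (λ t → B * φ 3 B * t + rest) w-equation ⟩
        B * φ 3 B * (d + c * w) + rest
          ≡⟨ cong (_+ rest) (solve 5 (λ B w B′ c d → B :* B′ :* (d :+ c :* w) := B :* B′ :* d :+ B′ :* c :* (B :* w)) refl B w (φ 3 B) c d) ⟩
        (B * φ 3 B * d + φ 3 B * c * (B * w)) + rest
          ≡⟨ cong (λ t → (B * φ 3 B * d + φ 3 B * c * t) + rest) Bw ⟩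
        (B * φ 3 B * d + φ 3 B * c * (ν - A)) + rest
          ≡⟨ solve 5 (λ n A A′ b k → (b :+ k :* (n :- A)) :+ ((A :+ A′) :* n :- A :* A′) :=
               (A :+ A′ :+ k) :* n :+ (b :- k :* A :- A :* A′)) refl ν A (φ 3 A) (B * φ 3 B * d) (φ 3 B * c) ⟩
        β * ν + γ ∎

      split : Dec (B ≡ 0#) → ⊥
      split (yes refl) = ν∉F (fixed-prime-to-3 3∤s ν∈E
        (subst (Fixed s) (trans (solve 2 (λ A w → A := A :+ :0 :* w) refl A w) (sym ν≡)) fA))
      split (no  B≢0)  = no-quadratic {s} 3∤s ν∈E ν∉F
        (fixed-+ {s} (fixed-+ {s} fA fφA) fφBc)
        (fixed-+ {s} (fixed-+ {s} (fixed-* {s} (fixed-* {s} fB (fixed-φ {s} 3 fB)) fd) (fixed-neg {s} (fixed-* {s} fφBc fA)))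
          (fixed-neg {s} (fixed-* {s} fA fφA))) quadratic

-- m = 2s with s prime to 3

module EvenPrimeTo3 (s : ℕ) (X : Extension (s ℕ.+ s)) (2≤s : 2 ℕ.≤ s) (3∤s : Prime-to-3 s) where
  open Extension X
  open FiniteField K using (Carrier; size)
  open Space K
  open CrossProduct K using (0⊙)
  open CubicExtension K using (N; κ; κ-scale)
  private
    module N = FiniteField N
    module NT = FieldTheory N
    module κ = Embedding κ
  open Scattered F→K (s ℕ.+ s) size-K using (q; 1<q; CuttingFamily; cuttingFamily; ScatteredSubspace)
  module φK = Frobenius X
  open ≡-Reasoning

  private
    0<s : 0 ℕ.< s
    0<s = ℕ.<-trans ℕ.z<s 2≤s

    t : ℕ
    t = 3 ℕ.* s

    X-N : Extension (t ℕ.+ t)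
    X-N = cubicExtension (ℕ.*-distribˡ-+ 3 s s) X

    module QK = QuadraticSubfield s X
    module QN = QuadraticSubfield t X-N
    module NN = Norm X-N
    open Frobenius X-N hiding (q)

    φ-κ : ∀ j x → φ j (κ.ι x) ≡ κ.ι (φK.φ j x)
    φ-κ j x = sym (κ.ι-^ x (q ℕ.^ j))

    κ-fixed : ∀ {j x} → φK.Fixed j x → Fixed j (κ.ι x)
    κ-fixed {j} {x} fx = trans (φ-κ j x) (cong κ.ι fx)

    -- 3s and s agree modulo the degree 2s of K, so conjugation `φ t` of the cubic extension
    -- restricts to conjugation of K.
    φK-t : ∀ x → φK.φ t x ≡ φK.φ s x
    φK-t x = begin
      φK.φ (3 ℕ.* s) x              ≡⟨ cong (λ k → φK.φ (s ℕ.+ (s ℕ.+ k)) x) (ℕ.+-identityʳ s) ⟩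
      φK.φ (s ℕ.+ (s ℕ.+ s)) x      ≡⟨ φK.φ-compose s (s ℕ.+ s) x ⟨
      φK.φ s (φK.φ (s ℕ.+ s) x)     ≡⟨ cong (φK.φ s) (φK.φ-period x) ⟩
      φK.φ s x                      ∎

  module Construction (ω : Carrier) (ω-moves : ¬ φK.Fixed s ω) where
    private
      κω-moves : ¬ Fixed t (κ.ι ω)
      κω-moves fixed = ω-moves (trans (sym (φK-t ω)) (κ.ι-injective (trans (sym (φ-κ t ω)) fixed)))

      module CN = QN.Coordinates (κ.ι ω) κω-moves
      module M = Enumeration CN.fixedElements

    module Graphs (a : V) (a-fixed : Fixed t a) (a-norm : ¬ Fixed 1 (NN.norm s a)) where
      private
        a≢0 : a ≢ 𝟎
        a≢0 = NN.norm-nonzero-argument s 0<s a-norm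

        f : V → V
        f y = a N.* φ 3 y

        φ-⊙ : ∀ j c x → φ j (c ⊙ x) ≡ φK.φ j c ⊙ φ j x
        φ-⊙ j c x = begin
          φ j (c ⊙ x)                    ≡⟨ cong (φ j) (κ-scale c x) ⟨
          φ j (κ.ι c N.* x)              ≡⟨ φ-* j (κ.ι c) x ⟩
          φ j (κ.ι c) N.* φ j x          ≡⟨ cong (N._* φ j x) (φ-κ j c) ⟩
          κ.ι (φK.φ j c) N.* φ j x       ≡⟨ κ-scale (φK.φ j c) (φ j x) ⟩
          φK.φ j c ⊙ φ j x               ∎

        f-⊕ : ∀ x y → f (x ⊕ y) ≡ f x ⊕ f y
        f-⊕ x y = trans (cong (a N.*_) (φ-+ 3 x y)) (N.distribˡ a (φ 3 x) (φ 3 y))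

        ⊙-⊗ : ∀ c x → a N.* (c ⊙ x) ≡ c ⊙ (a N.* x)
        ⊙-⊗ c x = begin
          a N.* (c ⊙ x)             ≡⟨ cong (a N.*_) (κ-scale c x) ⟨
          a N.* (κ.ι c N.* x)       ≡⟨ N.*-assoc a (κ.ι c) x ⟨
          (a N.* κ.ι c) N.* x       ≡⟨ cong (N._* x) (N.*-comm a (κ.ι c)) ⟩
          (κ.ι c N.* a) N.* x       ≡⟨ N.*-assoc (κ.ι c) a x ⟩
          κ.ι c N.* (a N.* x)       ≡⟨ κ-scale c (a N.* x) ⟩
          c ⊙ (a N.* x)             ∎

        f-⊙ : ∀ c x → f (c ⊙ x) ≡ φK.φ 3 c ⊙ f x
        f-⊙ c x = trans (cong (a N.*_) (φ-⊙ 3 c x)) (⊙-⊗ (φK.φ 3 c) (φ 3 x))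

        f-fixed : ∀ {x} → Fixed t x → Fixed t (f x)
        f-fixed fx = fixed-* {t} a-fixed (fixed-φ {t} 3 fx)

        f-nonzero : ∀ {x} → x ≢ 𝟎 → f x ≢ 𝟎
        f-nonzero x≢0 = NT.*-nonzero a≢0 (φ-nonzero 3 x≢0)

        bar-⊙ : ∀ c x → φ t (c ⊙ x) ≡ φK.φ s c ⊙ φ t x
        bar-⊙ c x = trans (φ-⊙ t c x) (cong (_⊙ φ t x) (φK-t c))

        fixed-s-3 : ∀ {l} → φK.Fixed s l → φK.Fixed 3 l → φK.Fixed 1 l
        fixed-s-3 fs f3 = Norm.fixed-prime-to-3 X 3∤s f3 fs

        no-plane : ∀ {y} → Fixed t y → y ≢ 𝟎 → ∀ {c d} → φK.Fixed s c → φK.Fixed s d → d ≢ FiniteField.0# K →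
                   f (f y) ≢ d ⊙ y ⊕ c ⊙ f y
        no-plane {y} fy y≢0 {c} {d} fc fd _ eq = NN.no-invariant-plane 3∤s a-fixed a≢0 a-norm fy y≢0
          (κ-fixed {s} fc) (κ-fixed {s} fd) (trans eq (sym (cong₂ _⊕_ (κ-scale d y) (κ-scale c (f y)))))

      module G = SemilinearGraph.Graph s X ω ω-moves (φ t) (φ-+ t) bar-⊙ 3 f f-⊕ f-⊙
        (λ {x} → f-fixed {x}) (λ {x} → f-nonzero {x}) fixed-s-3 no-plane

      scatteredSubspace : ScatteredSubspace G.P M.count
      scatteredSubspace = G.graph M.element M.injective M.sound

    private
      -- The inequality 2 + 2s ≤ 3s, that is s ≥ 2, is where m ≥ 4 enters.
      enough : q ℕ.^ (2 ℕ.+ (s ℕ.+ s)) ℕ.≤ M.count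
      enough = ℕ.≤-trans (ℕ.^-monoʳ-≤ q {{ℕ.>-nonZero (ℕ.<-trans ℕ.z<s 1<q)}}
        (ℕ.+-mono-≤ 2≤s (ℕ.≤-reflexive (cong (s ℕ.+_) (sym (ℕ.+-identityʳ s)))))) CN.many-fixed

      from-norm : ∃[ i ] ¬ Fixed 1 (NN.norm s (M.element i)) → CuttingFamily (2 ℕ.+ (s ℕ.+ s))
      from-norm (i , a-norm) = cuttingFamily (Graphs.scatteredSubspace (M.element i) (M.sound i) a-norm) enough

    family : CuttingFamily (2 ℕ.+ (s ℕ.+ s))
    family = from-norm (NN.norm-not-in-F s 0<s M.element M.injective CN.many-fixed)

  cutting-family : CuttingFamily (2 ℕ.+ (s ℕ.+ s))
  cutting-family = from-ω (QK.non-fixed 0<s)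
    where
    from-ω : ∃[ ω ] ¬ φK.Fixed s ω → CuttingFamily (2 ℕ.+ (s ℕ.+ s))
    from-ω (ω , ω-moves) = Construction.family ω ω-moves

-- m = 2s with s divisible by 3

module EvenMultipleOf3 (j : ℕ) (0<j : 0 ℕ.< j) (X : Extension (3 ℕ.* j ℕ.+ 3 ℕ.* j)) where
  open Extension X
  open FiniteField K
  open FieldTheory K
  open Space K
  open CrossProduct K
  private
    s : ℕ
    s = 3 ℕ.* j
  open Frobenius X
  open QuadraticSubfield s X
  open Scattered F→K (s ℕ.+ s) size-K using (1<q; CuttingFamily; cuttingFamily; ScatteredSubspace)
  open ≡-Reasoning

  private
    0<s : 0 ℕ.< s
    0<s = ℕ.<-≤-trans 0<j (ℕ.m≤n*m j 3)

    -- The exponent 1 + q + q² of x (φ 1 x) (φ 1 (φ 1 x)), with q in the form `q ^ 1` that `φ 1`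
    -- produces.
    cubic-exponent : ℕ
    cubic-exponent = 1 ℕ.+ (q ℕ.^ 1 ℕ.+ q ℕ.^ 1 ℕ.* q ℕ.^ 1)

    -- (q - 1)(1 + q³ + ... + q^{s-3}), the index of the subgroup of values
    -- of x ↦ x^{1+q+q²} on the units of the field of order q^s.
    index : ℕ
    index = ℕ.pred q ℕ.* geometric (q ℕ.^ 3) j

    q-1>0 : 0 ℕ.< ℕ.pred q
    q-1>0 = ℕ.pred-mono-≤ 1<q

    0<index : 0 ℕ.< index
    0<index = ℕ.*-mono-≤ q-1>0 (geometric-positive (q ℕ.^ 3) j 0<j)

    -- Combines (1 + q + q²)(q - 1) = q³ - 1 with the geometric sum of the powers of q³ up to
    -- q^(3j).
    index-equation : cubic-exponent ℕ.* index ℕ.+ 1 ≡ q ℕ.^ s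
    index-equation = trans (ℕ.+-cancelˡ-≡ g _ _ (begin
      g ℕ.+ (cubic-exponent ℕ.* (r ℕ.* g) ℕ.+ 1)
        ≡⟨ +-*-Solver.solve 3 (λ n r g → g S.:+ (n S.:* (r S.:* g) S.:+ S.con 1) S.:= (n S.:* r S.:+ S.con 1) S.:* g S.:+ S.con 1) refl cubic-exponent r g ⟩
      (cubic-exponent ℕ.* r ℕ.+ 1) ℕ.* g ℕ.+ 1
        ≡⟨ cong (λ k → k ℕ.* g ℕ.+ 1) (cube 1+r≡q) ⟩
      q ℕ.^ 3 ℕ.* g ℕ.+ 1
        ≡⟨ geometric-sum (q ℕ.^ 3) j ⟩
      g ℕ.+ (q ℕ.^ 3) ℕ.^ j ∎)) (ℕ.^-*-assoc q 3 j)
      where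
      module S = +-*-Solver
      r = ℕ.pred q
      g = geometric (q ℕ.^ 3) j

      1+r≡q : suc r ≡ q
      1+r≡q = ℕ.suc-pred q {{ℕ.>-nonZero (ℕ.<-trans ℕ.z<s 1<q)}}

      cube : ∀ {n} → suc r ≡ n → (1 ℕ.+ (n ℕ.^ 1 ℕ.+ n ℕ.^ 1 ℕ.* n ℕ.^ 1)) ℕ.* r ℕ.+ 1 ≡ n ℕ.^ 3
      cube refl = S.solve 1 (λ r → let n = S.con 1 S.:+ r; n¹ = n S.:* S.con 1 in
        (S.con 1 S.:+ (n¹ S.:+ n¹ S.:* n¹)) S.:* r S.:+ S.con 1 S.:= n S.:* (n S.:* n¹)) refl r

    index<q^s : suc index ℕ.< q ℕ.^ s
    index<q^s = subst (suc index ℕ.<_) (trans (ℕ.+-comm 1 (cubic-exponent ℕ.* index)) index-equation)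
      (ℕ.s<s (subst (index ℕ.<_) (ℕ.*-comm index cubic-exponent)
        (ℕ.m<m*n index cubic-exponent {{ℕ.>-nonZero 0<index}}
          (ℕ.s<s (ℕ.<-≤-trans (ℕ.m^n>0 q {{ℕ.>-nonZero (ℕ.<-trans ℕ.z<s 1<q)}} 1) (ℕ.m≤m+n _ _))))))

  module Construction (ω : Carrier) (ω-moves : ¬ Fixed s ω) where
    open Coordinates ω ω-moves using (fixedElements; many-fixed)
    private
      module L = Enumeration fixedElements

    -- The single inequation `α-power` excludes both α = 0 and α^index = 1, and it has the shape
    -- that `distinct-powers` supplies.
    module Graphs (α : Carrier) (α-fixed : Fixed s α) (α-power : α ^ suc index ≢ α ^ 1) where
      private
        -- For nonzero x in L and α = x^(1+q+q²), the power α^index is x^(q^s - 1) = 1.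
        not-cubic-norm : ∀ {x} → Fixed s x → x * (φ 1 x * φ 1 (φ 1 x)) ≢ α
        not-cubic-norm {x} fx eq = α-power (cong (α *_) (by-cases (x ≟ 0#)))
          where
          α≡ : α ≡ x ^ cubic-exponent
          α≡ = begin
            α                                      ≡⟨ eq ⟨
            x * (φ 1 x * φ 1 (φ 1 x))              ≡⟨ cong (λ y → x * (φ 1 x * y)) (^-assocʳ x (q ℕ.^ 1) (q ℕ.^ 1)) ⟩
            x * (φ 1 x * x ^ (q ℕ.^ 1 ℕ.* q ℕ.^ 1)) ≡⟨ cong (x *_) (^-homo-* x (q ℕ.^ 1) _) ⟨
            x ^ cubic-exponent                     ∎

          by-cases : Dec (x ≡ 0#) → α ^ index ≡ α ^ 0
          by-cases (yes refl) = ⊥-elim (α-power (begin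
            α * α ^ index          ≡⟨ cong (_* α ^ index) α≡0 ⟩
            0# * α ^ index         ≡⟨ zeroˡ _ ⟩
            0#                     ≡⟨ zeroˡ 1# ⟨
            0# * 1#                ≡⟨ cong (_* 1#) α≡0 ⟨
            α * 1#                 ∎))
            where
            α≡0 : α ≡ 0#
            α≡0 = trans (sym eq) (zeroˡ _)
          by-cases (no x≢0) = *-cancelˡ x≢0 (begin
            x * α ^ index                          ≡⟨ cong (λ y → x * y ^ index) α≡ ⟩
            x * (x ^ cubic-exponent) ^ index       ≡⟨ cong (x *_) (^-assocʳ x cubic-exponent index) ⟩
            x ^ suc (cubic-exponent ℕ.* index)     ≡⟨ cong (x ^_) (trans (ℕ.+-comm 1 (cubic-exponent ℕ.* index)) index-equation) ⟩
            φ s x                                  ≡⟨ fx ⟩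
            x                                      ≡⟨ *-identityʳ x ⟨
            x * 1#                                 ∎)

        α≢0 : α ≢ 0#
        α≢0 refl = α-power (trans (zeroˡ _) (sym (zeroˡ 1#)))

        φ-quotient : ∀ {a b c d} → b ≢ 0# → d ≢ 0# → φ 1 a * d ≡ c * φ 1 b → φ 1 (a * b ⁻¹) ≡ c * d ⁻¹
        φ-quotient {a} {b} {c} {d} b≢0 d≢0 eq = *-cancelˡ (*-nonzero (φ-nonzero 1 b≢0) d≢0) (begin
          φ 1 b * d * φ 1 (a * b ⁻¹)         ≡⟨ solve 3 (λ x d y → x :* d :* y := x :* y :* d) refl (φ 1 b) d _ ⟩
          φ 1 b * φ 1 (a * b ⁻¹) * d         ≡⟨ cong (_* d) (sym (φ-* 1 b _)) ⟩
          φ 1 (b * (a * b ⁻¹)) * d           ≡⟨ cong (λ x → φ 1 x * d) (trans (cong (b *_) (*-comm a _)) (*-⁻¹-cancel a b≢0)) ⟩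
          φ 1 a * d                          ≡⟨ eq ⟩
          c * φ 1 b                          ≡⟨ solve 2 (λ c x → c :* x := x :* :1 :* c) refl c (φ 1 b) ⟩
          φ 1 b * 1# * c                     ≡⟨ cong (λ x → φ 1 b * x * c) (sym (*-inverseʳ d≢0)) ⟩
          φ 1 b * (d * d ⁻¹) * c             ≡⟨ solve 4 (λ x d i c → x :* (d :* i) :* c := x :* d :* (c :* i)) refl (φ 1 b) d (d ⁻¹) c ⟩
          φ 1 b * d * (c * d ⁻¹)             ∎)

        cancel₃ : ∀ {x y z} → x ≢ 0# → y ≢ 0# → z ≢ 0# → ∀ a → (x * x ⁻¹) * (y * y ⁻¹) * (z * z ⁻¹) * a ≡ a
        cancel₃ x≢0 y≢0 z≢0 a = trans (cong (_* a) (cong₂ _*_ (cong₂ _*_ (*-inverseʳ x≢0) (*-inverseʳ y≢0)) (*-inverseʳ z≢0)))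
          (solve 1 (λ a → :1 :* :1 :* :1 :* a := a) refl a)

        -- x = z₁ / z₀ would have x (φ x) (φ² x) = α.
        no-cycle : ∀ {z₀ z₁ z₂ c} → Fixed s z₀ → Fixed s z₁ → z₀ ≢ 0# → z₁ ≢ 0# → z₂ ≢ 0# →
                   φ 1 z₂ ≡ c * z₀ → α * φ 1 z₀ ≡ c * z₁ → α * φ 1 z₁ ≡ c * z₂ → ⊥
        no-cycle {z₀} {z₁} {z₂} {c} f₀ f₁ z₀≢0 z₁≢0 z₂≢0 e₂ e₀ e₁ =
          not-cubic-norm (fixed-* {s} f₁ (fixed-⁻¹ {s} f₀)) (begin
            x * (φ 1 x * φ 1 (φ 1 x))      ≡⟨ cong (λ y → x * (y * φ 1 y)) φx ⟩
            x * (z₂ * z₁ ⁻¹ * φ 1 (z₂ * z₁ ⁻¹)) ≡⟨ cong (λ y → x * (z₂ * z₁ ⁻¹ * y)) φφx ⟩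
            x * (z₂ * z₁ ⁻¹ * (α * z₀ * z₂ ⁻¹)) ≡⟨ solve 7 (λ x y z i j k a → y :* i :* (z :* j :* (a :* x :* k)) := (x :* i) :* (y :* j) :* (z :* k) :* a) refl z₀ z₁ z₂ (z₀ ⁻¹) (z₁ ⁻¹) (z₂ ⁻¹) α ⟩
            (z₀ * z₀ ⁻¹) * (z₁ * z₁ ⁻¹) * (z₂ * z₂ ⁻¹) * α ≡⟨ cancel₃ z₀≢0 z₁≢0 z₂≢0 α ⟩
            α                              ∎)
          where
          x : Carrier
          x = z₁ * z₀ ⁻¹

          φx : φ 1 x ≡ z₂ * z₁ ⁻¹
          φx = φ-quotient z₀≢0 z₁≢0 (*-cancelˡ α≢0 (begin
            α * (φ 1 z₁ * z₁)      ≡⟨ *-assoc α _ z₁ ⟨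
            α * φ 1 z₁ * z₁        ≡⟨ cong (_* z₁) e₁ ⟩
            c * z₂ * z₁            ≡⟨ solve 3 (λ c x y → c :* x :* y := x :* (c :* y)) refl c z₂ z₁ ⟩
            z₂ * (c * z₁)          ≡⟨ cong (z₂ *_) e₀ ⟨
            z₂ * (α * φ 1 z₀)      ≡⟨ solve 3 (λ a x y → x :* (a :* y) := a :* (x :* y)) refl α z₂ (φ 1 z₀) ⟩
            α * (z₂ * φ 1 z₀)      ∎))

          φφx : φ 1 (z₂ * z₁ ⁻¹) ≡ α * z₀ * z₂ ⁻¹
          φφx = φ-quotient z₁≢0 z₂≢0 (begin
            φ 1 z₂ * z₂            ≡⟨ cong (_* z₂) e₂ ⟩
            c * z₀ * z₂            ≡⟨ solve 3 (λ c x y → c :* x :* y := x :* (c :* y)) refl c z₀ z₂ ⟩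
            z₀ * (c * z₂)          ≡⟨ cong (z₀ *_) e₁ ⟨
            z₀ * (α * φ 1 z₁)      ≡⟨ solve 3 (λ a x y → x :* (a :* y) := a :* x :* y) refl α z₀ (φ 1 z₁) ⟩
            α * z₀ * φ 1 z₁        ∎)

        -- x = y₀ / y₁ would have x (φ x) (φ² x) = α.
        no-eigenvector : ∀ {y₀ y₁ y₂ c} → Fixed s y₀ → Fixed s y₁ → y₀ ≢ 0# → y₁ ≢ 0# → y₂ ≢ 0# →
                         α * φ 1 y₂ ≡ c * y₀ → φ 1 y₀ ≡ c * y₁ → φ 1 y₁ ≡ c * y₂ → ⊥
        no-eigenvector {y₀} {y₁} {y₂} {c} f₀ f₁ y₀≢0 y₁≢0 y₂≢0 e₂ e₀ e₁ =
          not-cubic-norm (fixed-* {s} f₀ (fixed-⁻¹ {s} f₁)) (begin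
            x * (φ 1 x * φ 1 (φ 1 x))      ≡⟨ cong (λ y → x * (y * φ 1 y)) φx ⟩
            x * (y₁ * y₂ ⁻¹ * φ 1 (y₁ * y₂ ⁻¹)) ≡⟨ cong (λ y → x * (y₁ * y₂ ⁻¹ * y)) φφx ⟩
            x * (y₁ * y₂ ⁻¹ * (α * y₂ * y₀ ⁻¹)) ≡⟨ solve 7 (λ x y z i j k a → x :* j :* (y :* k :* (a :* z :* i)) := (x :* i) :* (y :* j) :* (z :* k) :* a) refl y₀ y₁ y₂ (y₀ ⁻¹) (y₁ ⁻¹) (y₂ ⁻¹) α ⟩
            (y₀ * y₀ ⁻¹) * (y₁ * y₁ ⁻¹) * (y₂ * y₂ ⁻¹) * α ≡⟨ cancel₃ y₀≢0 y₁≢0 y₂≢0 α ⟩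
            α                              ∎)
          where
          x : Carrier
          x = y₀ * y₁ ⁻¹

          φx : φ 1 x ≡ y₁ * y₂ ⁻¹
          φx = φ-quotient y₁≢0 y₂≢0 (begin
            φ 1 y₀ * y₂      ≡⟨ cong (_* y₂) e₀ ⟩
            c * y₁ * y₂      ≡⟨ solve 3 (λ c x y → c :* x :* y := x :* (c :* y)) refl c y₁ y₂ ⟩
            y₁ * (c * y₂)    ≡⟨ cong (y₁ *_) e₁ ⟨
            y₁ * φ 1 y₁      ∎)

          φφx : φ 1 (y₁ * y₂ ⁻¹) ≡ α * y₂ * y₀ ⁻¹
          φφx = φ-quotient y₂≢0 y₀≢0 (begin
            φ 1 y₁ * y₀            ≡⟨ cong (_* y₀) e₁ ⟩
            c * y₂ * y₀            ≡⟨ solve 3 (λ c x y → c :* x :* y := x :* (c :* y)) refl c y₂ y₀ ⟩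
            y₂ * (c * y₀)          ≡⟨ cong (y₂ *_) e₂ ⟨
            y₂ * (α * φ 1 y₂)      ≡⟨ solve 3 (λ a x y → x :* (a :* y) := a :* x :* y) refl α y₂ (φ 1 y₂) ⟩
            α * y₂ * φ 1 y₂        ∎)

        f : V → V
        f (y₀ , y₁ , y₂) = α * φ 1 y₂ , φ 1 y₀ , φ 1 y₁

        bar-V : V → V
        bar-V (y₀ , y₁ , y₂) = bar y₀ , bar y₁ , bar y₂

        bar-⊕ : ∀ x y → bar-V (x ⊕ y) ≡ bar-V x ⊕ bar-V y
        bar-⊕ (x₀ , x₁ , x₂) (y₀ , y₁ , y₂) = triple (φ-+ s x₀ y₀) (φ-+ s x₁ y₁) (φ-+ s x₂ y₂)

        bar-⊙ : ∀ c x → bar-V (c ⊙ x) ≡ bar c ⊙ bar-V x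
        bar-⊙ c (x₀ , x₁ , x₂) = triple (φ-* s c x₀) (φ-* s c x₁) (φ-* s c x₂)

        f-⊕ : ∀ x y → f (x ⊕ y) ≡ f x ⊕ f y
        f-⊕ (x₀ , x₁ , x₂) (y₀ , y₁ , y₂) =
          triple (trans (cong (α *_) (φ-+ 1 x₂ y₂)) (distribˡ α _ _)) (φ-+ 1 x₀ y₀) (φ-+ 1 x₁ y₁)

        f-⊙ : ∀ c x → f (c ⊙ x) ≡ φ 1 c ⊙ f x
        f-⊙ c (x₀ , x₁ , x₂) = triple
          (trans (cong (α *_) (φ-* 1 c x₂)) (solve 3 (λ a c x → a :* (c :* x) := c :* (a :* x)) refl α (φ 1 c) (φ 1 x₂)))
          (φ-* 1 c x₀) (φ-* 1 c x₁)

        f-fixed : ∀ {x} → bar-V x ≡ x → bar-V (f x) ≡ f x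
        f-fixed eq = triple
          (fixed-* {s} α-fixed (fixed-φ {s} 1 (at₂ eq)))
          (fixed-φ {s} 1 (at₀ eq)) (fixed-φ {s} 1 (at₁ eq))

        φ≡0⇒≡0 : ∀ {x} → φ 1 x ≡ 0# → x ≡ 0#
        φ≡0⇒≡0 eq = φ-injective 1 (trans eq (sym (φ-0 1)))

        f-nonzero : ∀ {x} → x ≢ 𝟎 → f x ≢ 𝟎
        f-nonzero x≢𝟎 eq = x≢𝟎 (triple (φ≡0⇒≡0 (at₁ eq)) (φ≡0⇒≡0 (at₂ eq))
          (φ≡0⇒≡0 (nonzero-*-≡0 α≢0 (at₀ eq))))

        -- A zero coordinate propagates around the cycle and would annihilate the whole vector.
        all-nonzero : ∀ {z₀ z₁ z₂} → (z₀ , z₁ , z₂) ≢ 𝟎 → (z₀ ≡ 0# → z₁ ≡ 0#) → (z₁ ≡ 0# → z₂ ≡ 0#) → (z₂ ≡ 0# → z₀ ≡ 0#) →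
                      z₀ ≢ 0# × z₁ ≢ 0# × z₂ ≢ 0#
        all-nonzero z≢𝟎 0⇒1 1⇒2 2⇒0 = from₀ , (λ e → from₀ (2⇒0 (1⇒2 e))) , (λ e → from₀ (2⇒0 e))
          where
          from₀ : _ ≢ 0#
          from₀ e = z≢𝟎 (triple e (0⇒1 e) (1⇒2 (0⇒1 e)))

        propagate : ∀ {a b c z w} → c ≢ 0# → a * φ 1 z ≡ c * w → b ≡ a → z ≡ 0# → w ≡ 0#
        propagate {a} c≢0 eq refl refl = nonzero-*-≡0 c≢0 (trans (sym eq) (trans (cong (a *_) (φ-0 1)) (zeroʳ a)))

        -- If y and f y are proportional, y is an eigenvector of f. Otherwise their cross product,
        -- the normal of the invariant plane, is an eigenvector of the cofactor map. Both lead to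
        -- some x in L with x^(1+q+q²) = α.
        no-plane : ∀ {y} → bar-V y ≡ y → y ≢ 𝟎 → ∀ {c d} → Fixed s c → Fixed s d → d ≢ 0# →
                   f (f y) ≢ d ⊙ y ⊕ c ⊙ f y
        no-plane {y@(y₀ , y₁ , y₂)} fy y≢𝟎 {c} {d} _ _ d≢0 eq = by-cases (z₀ ≟ 0#) (z₁ ≟ 0#) (z₂ ≟ 0#)
          where
          z₀ z₁ z₂ : Carrier
          z₀ = proj₁ (cross (f y) y)
          z₁ = proj₁ (proj₂ (cross (f y) y))
          z₂ = proj₂ (proj₂ (cross (f y) y))

          f₀ : Fixed s y₀
          f₀ = at₀ fy
          f₁ : Fixed s y₁
          f₁ = at₁ fy
          f₂ : Fixed s y₂
          f₂ = at₂ fy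

          fixed-minor : ∀ {a b c d} → Fixed s a → Fixed s b → Fixed s c → Fixed s d → Fixed s (a * b - c * d)
          fixed-minor fa fb fc fd = fixed-+ {s} (fixed-* {s} fa fb) (fixed-neg {s} (fixed-* {s} fc fd))

          g₀ : Fixed s (α * φ 1 y₂)
          g₀ = fixed-* {s} α-fixed (fixed-φ {s} 1 f₂)
          g₁ : Fixed s (φ 1 y₀)
          g₁ = fixed-φ {s} 1 f₀
          g₂ : Fixed s (φ 1 y₁)
          g₂ = fixed-φ {s} 1 f₁

          φ-minor : ∀ a b c d → φ 1 (a * b - c * d) ≡ φ 1 a * φ 1 b - φ 1 c * φ 1 d
          φ-minor a b c d = trans (φ-sub 1 _ _) (cong₂ _-_ (φ-* 1 a b) (φ-* 1 c d))

          -d≢0 : - d ≢ 0#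
          -d≢0 e₀ = d≢0 (trans (solve 1 (λ d → d := :- (:- d)) refl d) (trans (cong -_ e₀) (solve 0 (:- :0 := :0) refl)))

          e₀ : α * φ 1 (φ 1 y₁) ≡ d * y₀ + c * (α * φ 1 y₂)
          e₀ = at₀ eq
          e₁ : φ 1 (α * φ 1 y₂) ≡ d * y₁ + c * φ 1 y₀
          e₁ = at₁ eq
          e₂ : φ 1 (φ 1 y₀) ≡ d * y₂ + c * φ 1 y₁
          e₂ = at₂ eq

          -- The cofactor matrix of f maps y × f y to f y × f (f y), which is
          -- proportional to f y × y.
          cycle₂ : φ 1 z₂ ≡ (- d) * z₀
          cycle₂ = begin
            φ 1 (α * φ 1 y₂ * y₁ - φ 1 y₀ * y₀)
              ≡⟨ φ-minor _ _ _ _ ⟩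
            φ 1 (α * φ 1 y₂) * φ 1 y₁ - φ 1 (φ 1 y₀) * φ 1 y₀
              ≡⟨ cong₂ (λ a b → a * φ 1 y₁ - b * φ 1 y₀) e₁ e₂ ⟩
            (d * y₁ + c * φ 1 y₀) * φ 1 y₁ - (d * y₂ + c * φ 1 y₁) * φ 1 y₀
              ≡⟨ solve 6 (λ d c y₁ y₂ a b → (d :* y₁ :+ c :* a) :* b :- (d :* y₂ :+ c :* b) :* a := :- d :* (a :* y₂ :- b :* y₁)) refl d c y₁ y₂ (φ 1 y₀) (φ 1 y₁) ⟩
            (- d) * z₀ ∎

          cycle₀ : α * φ 1 z₀ ≡ (- d) * z₁
          cycle₀ = begin
            α * φ 1 (φ 1 y₀ * y₂ - φ 1 y₁ * y₁)
              ≡⟨ cong (α *_) (φ-minor _ _ _ _) ⟩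
            α * (φ 1 (φ 1 y₀) * φ 1 y₂ - φ 1 (φ 1 y₁) * φ 1 y₁)
              ≡⟨ solve 5 (λ a x y z w → a :* (x :* y :- z :* w) := x :* (a :* y) :- (a :* z) :* w) refl α _ _ _ _ ⟩
            φ 1 (φ 1 y₀) * (α * φ 1 y₂) - (α * φ 1 (φ 1 y₁)) * φ 1 y₁
              ≡⟨ cong₂ (λ a b → a * (α * φ 1 y₂) - b * φ 1 y₁) e₂ e₀ ⟩
            (d * y₂ + c * φ 1 y₁) * (α * φ 1 y₂) - (d * y₀ + c * (α * φ 1 y₂)) * φ 1 y₁
              ≡⟨ solve 6 (λ d c y₂ y₀ a b → (d :* y₂ :+ c :* b) :* a :- (d :* y₀ :+ c :* a) :* b := :- d :* (b :* y₀ :- a :* y₂)) refl d c y₂ y₀ (α * φ 1 y₂) (φ 1 y₁) ⟩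
            (- d) * z₁ ∎

          cycle₁ : α * φ 1 z₁ ≡ (- d) * z₂
          cycle₁ = begin
            α * φ 1 (φ 1 y₁ * y₀ - α * φ 1 y₂ * y₂)
              ≡⟨ cong (α *_) (φ-minor _ _ _ _) ⟩
            α * (φ 1 (φ 1 y₁) * φ 1 y₀ - φ 1 (α * φ 1 y₂) * φ 1 y₂)
              ≡⟨ solve 5 (λ a x y z w → a :* (x :* y :- z :* w) := (a :* x) :* y :- z :* (a :* w)) refl α _ _ _ _ ⟩
            (α * φ 1 (φ 1 y₁)) * φ 1 y₀ - φ 1 (α * φ 1 y₂) * (α * φ 1 y₂)
              ≡⟨ cong₂ (λ a b → a * φ 1 y₀ - b * (α * φ 1 y₂)) e₀ e₁ ⟩
            (d * y₀ + c * (α * φ 1 y₂)) * φ 1 y₀ - (d * y₁ + c * φ 1 y₀) * (α * φ 1 y₂)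
              ≡⟨ solve 6 (λ d c y₀ y₁ a b → (d :* y₀ :+ c :* a) :* b :- (d :* y₁ :+ c :* b) :* a := :- d :* (a :* y₁ :- b :* y₀)) refl d c y₀ y₁ (α * φ 1 y₂) (φ 1 y₀) ⟩
            (- d) * z₂ ∎

          independent : cross (f y) y ≢ 𝟎 → ⊥
          independent z≢𝟎 = contradict (all-nonzero z≢𝟎 (propagate -d≢0 cycle₀ refl) (propagate -d≢0 cycle₁ refl)
              (propagate -d≢0 (trans (*-identityˡ _) cycle₂) refl))
            where
            contradict : z₀ ≢ 0# × z₁ ≢ 0# × z₂ ≢ 0# → ⊥
            contradict (z₀≢0 , z₁≢0 , z₂≢0) = no-cycle (fixed-minor g₁ f₂ g₂ f₁) (fixed-minor g₂ f₀ g₀ f₂) z₀≢0 z₁≢0 z₂≢0 cycle₂ cycle₀ cycle₁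

          proportional : ∃[ k ] f y ≡ k ⊙ y → ⊥
          proportional (k , fy≡ky) = contradict (all-nonzero y≢𝟎
              (propagate k≢0 (trans (*-identityˡ _) k₁) refl) (propagate k≢0 (trans (*-identityˡ _) k₂) refl) (propagate k≢0 k₀ refl))
            where
            k₀ : α * φ 1 y₂ ≡ k * y₀
            k₀ = at₀ fy≡ky
            k₁ : φ 1 y₀ ≡ k * y₁
            k₁ = at₁ fy≡ky
            k₂ : φ 1 y₁ ≡ k * y₂
            k₂ = at₂ fy≡ky

            k≢0 : k ≢ 0#
            k≢0 e = f-nonzero y≢𝟎 (trans fy≡ky (trans (cong (_⊙ y) e) (0⊙ y)))

            contradict : y₀ ≢ 0# × y₁ ≢ 0# × y₂ ≢ 0# → ⊥
            contradict (y₀≢0 , y₁≢0 , y₂≢0) = no-eigenvector f₀ f₁ y₀≢0 y₁≢0 y₂≢0 k₀ k₁ k₂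

          by-cases : Dec (z₀ ≡ 0#) → Dec (z₁ ≡ 0#) → Dec (z₂ ≡ 0#) → ⊥
          by-cases (yes z₀≡0) (yes z₁≡0) (yes z₂≡0) =
            proportional (cross≡𝟎⇒proportional (f y) y y≢𝟎 (triple z₀≡0 z₁≡0 z₂≡0))
          by-cases (no z₀≢0) _ _ = independent (λ e → z₀≢0 (at₀ e))
          by-cases _ (no z₁≢0) _ = independent (λ e → z₁≢0 (at₁ e))
          by-cases _ _ (no z₂≢0) = independent (λ e → z₂≢0 (at₂ e))

      module G = SemilinearGraph.Graph s X ω ω-moves bar-V bar-⊕ bar-⊙ 1 f f-⊕ f-⊙
        (λ {x} → f-fixed {x}) (λ {x} → f-nonzero {x}) (λ _ f1 → f1) no-plane

      point : Fin (L.count ℕ.* (L.count ℕ.* L.count)) → V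
      point i = L.element a , L.element b , L.element c
        where
        a = proj₁ (Fin.remQuot (L.count ℕ.* L.count) i)
        b = proj₁ (Fin.remQuot {L.count} L.count (proj₂ (Fin.remQuot {L.count} (L.count ℕ.* L.count) i)))
        c = proj₂ (Fin.remQuot {L.count} L.count (proj₂ (Fin.remQuot {L.count} (L.count ℕ.* L.count) i)))

      point-injective : Injective _≡_ _≡_ point
      point-injective {i} {k} eq = remQuot-injective {L.count} {L.count ℕ.* L.count} (L.injective (at₀ eq))
        (remQuot-injective {L.count} {L.count} (L.injective (at₁ eq)) (L.injective (at₂ eq)))
        where
        remQuot-injective : ∀ {m n} {i k : Fin (m ℕ.* n)} → proj₁ (Fin.remQuot {m} n i) ≡ proj₁ (Fin.remQuot {m} n k) →
                            proj₂ (Fin.remQuot {m} n i) ≡ proj₂ (Fin.remQuot {m} n k) → i ≡ k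
        remQuot-injective {m} {n} {i} {k} e₁ e₂ = trans (sym (Fin.combine-remQuot {m} n i))
          (trans (cong₂ Fin.combine e₁ e₂) (Fin.combine-remQuot {m} n k))

      point-fixed : ∀ i → bar-V (point i) ≡ point i
      point-fixed i = triple (L.sound _) (L.sound _) (L.sound _)

      scatteredSubspace : ScatteredSubspace G.P (L.count ℕ.* (L.count ℕ.* L.count))
      scatteredSubspace = G.graph point point-injective point-fixed

    private
      enough : q ℕ.^ (2 ℕ.+ (s ℕ.+ s)) ℕ.≤ L.count ℕ.* (L.count ℕ.* L.count)
      enough = ℕ.≤-trans (ℕ.^-monoʳ-≤ q {{ℕ.>-nonZero (ℕ.<-trans ℕ.z<s 1<q)}} (ℕ.+-monoˡ-≤ (s ℕ.+ s) 2≤s))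
        (subst (ℕ._≤ L.count ℕ.* (L.count ℕ.* L.count))
          (sym (trans (ℕ.^-distribˡ-+-* q s (s ℕ.+ s)) (cong (q ℕ.^ s ℕ.*_) (ℕ.^-distribˡ-+-* q s s))))
          (ℕ.*-mono-≤ many-fixed (ℕ.*-mono-≤ many-fixed many-fixed)))
        where
        2≤s : 2 ℕ.≤ s
        2≤s = ℕ.≤-trans (ℕ.n≤1+n 2) (ℕ.*-monoʳ-≤ 3 0<j)

      from-power : ∃[ i ] L.element i ^ suc index ≢ L.element i ^ 1 → CuttingFamily (2 ℕ.+ (s ℕ.+ s))
      from-power (i , α-power) = cuttingFamily (Graphs.scatteredSubspace (L.element i) (L.sound i) α-power) enough

    family : CuttingFamily (2 ℕ.+ (s ℕ.+ s))
    family = from-power (distinct-powers (ℕ.s<s 0<index) (ℕ.<-≤-trans index<q^s many-fixed) L.element L.injective)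

  cutting-family : CuttingFamily (2 ℕ.+ (s ℕ.+ s))
  cutting-family = from-ω (non-fixed 0<s)
    where
    from-ω : ∃[ ω ] ¬ Fixed s ω → CuttingFamily (2 ℕ.+ (s ℕ.+ s))
    from-ω (ω , ω-moves) = Construction.family ω ω-moves

-- Scattered subspaces for m ≡ 1 (mod 3)

-- Subspaces over the field E fixed by φ 3, built one dimension at a time, in
-- which the ratios of vectors that are fixed by φ m lie in F.
module Greedy {m : ℕ} (3∤m : Prime-to-3 m) (X : Extension (3 ℕ.* m)) (θ : FiniteField.Carrier (Extension.K X))
              (θ∈E : Frobenius.Fixed X 3 θ) (θ∉F : ¬ Frobenius.Fixed X 1 θ) where
  open Extension X
  open FiniteField K
  open FieldTheory K
  open Frobenius X
  open Norm X
  open Embedding F→K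
  open Scattered F→K (3 ℕ.* m) size-K using (collapse)
  open ≡-Reasoning
  private
    module F = FiniteField F
    module FT = FieldTheory F

    fixed-sub : ∀ {j x y} → Fixed j x → Fixed j y → Fixed j (x - y)
    fixed-sub {j} fx fy = fixed-+ {j} fx (fixed-neg {j} fy)

    F⊂fixed : ∀ {j x} → Fixed 1 x → Fixed j x
    F⊂fixed {j} {x} fx = subst (λ k → Fixed k x) (ℕ.*-identityʳ j) (fixed-multiple j fx)

    eliminate : ∀ {a x b} → a ≢ 0# → a * x + b ≡ 0# → x ≡ a ⁻¹ * (- b)
    eliminate {a} {x} {b} a≢0 eq = *-cancelˡ a≢0 (trans (solve 2 (λ y b → y := (y :+ b) :+ (:- b)) refl (a * x) b)
      (trans (cong (_+ (- b)) eq) (trans (+-identityˡ _) (sym (*-⁻¹-cancel (- b) a≢0)))))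

    affine-root : ∀ {j a x b} → a ≢ 0# → Fixed j a → Fixed j b → a * x + b ≡ 0# → Fixed j x
    affine-root {j} a≢0 fa fb eq = subst (Fixed j) (sym (eliminate a≢0 eq))
      (fixed-* {j} (fixed-⁻¹ {j} fa) (fixed-neg {j} fb))

    E-elements : Enumeration (Fixed 3)
    E-elements = enumerate finite (λ x → φ 3 x ≟ x)

    K-elements : Enumeration (Fixed m)
    K-elements = enumerate finite (λ x → φ m x ≟ x)

    fixed-count≤ : ∀ j → 0 ℕ.< j → (L : Enumeration (Fixed j)) → Enumeration.count L ℕ.≤ q ℕ.^ j
    fixed-count≤ j 0<j L = power-bound (ℕ.^-monoʳ-< q 1<q 0<j) element injective
      (λ i → trans (sound i) (sym (*-identityʳ _)))
      where open Enumeration L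

    0<m : 0 ℕ.< m
    0<m = prime-to-3-positive 3∤m

  Q k : ℕ
  Q = Enumeration.count E-elements
  k = Enumeration.count K-elements

  private
    module E = Enumeration E-elements
    module L = Enumeration K-elements

    -- θ has degree 3 over F: `no-quadratic` with s = 1 excludes degree 2, and θ ∉ F excludes degree
    -- 1.
    quadratic-vanishes : ∀ {a b c} → Fixed 1 a → Fixed 1 b → Fixed 1 c → c * (θ * θ) + (b * θ + a) ≡ 0# →
                         a ≡ 0# × b ≡ 0# × c ≡ 0#
    quadratic-vanishes {a} {b} {c} fa fb fc eq = a≡0 , b≡0 , c≡0
      where
      c≡0 : c ≡ 0#
      c≡0 with c ≟ 0#
      ... | yes c≡0 = c≡0
      ... | no  c≢0 = ⊥-elim (no-quadratic {1} {θ} {c ⁻¹ * (- b)} {c ⁻¹ * (- a)} (inj₁ (0 , refl)) θ∈E θ∉F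
        (fixed-* {1} (fixed-⁻¹ {1} fc) (fixed-neg {1} fb)) (fixed-* {1} (fixed-⁻¹ {1} fc) (fixed-neg {1} fa))
        (trans (eliminate c≢0 eq) (solve 4 (λ i a b t → i :* (:- (b :* t :+ a)) := i :* (:- b) :* t :+ i :* (:- a)) refl (c ⁻¹) a b θ)))

      linear : b * θ + a ≡ 0#
      linear = trans (solve 2 (λ t r → r := :0 :* t :+ r) refl (θ * θ) (b * θ + a))
        (trans (cong (λ x → x * (θ * θ) + (b * θ + a)) (sym c≡0)) eq)

      b≡0 : b ≡ 0#
      b≡0 with b ≟ 0#
      ... | yes b≡0 = b≡0
      ... | no  b≢0 = ⊥-elim (θ∉F (affine-root {1} b≢0 fb fa linear))

      a≡0 : a ≡ 0#
      a≡0 = trans (solve 2 (λ t a → a := :0 :* t :+ a) refl θ a) (trans (cong (λ x → x * θ + a) (sym b≡0)) linear)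

  Q≤q³ : Q ℕ.≤ q ℕ.^ 3
  Q≤q³ = fixed-count≤ 3 ℕ.z<s E-elements

  k≤q^m : k ℕ.≤ q ℕ.^ m
  k≤q^m = fixed-count≤ m 0<m K-elements

  -- The combinations of 1, θ, θ² over F are pairwise distinct elements of E.
  q³≤Q : q ℕ.^ 3 ℕ.≤ Q
  q³≤Q = Fin.injective⇒≤ {f = λ i → E.index (value i) (value∈E i)} λ {i} {j} eq →
    trans (sym (Fin.funToFin-finToFin {3} {q} i))
      (trans (funToFin-cong (λ t → F.from-injective (ι-injective (same i j (value-injective i j eq) t))))
        (Fin.funToFin-finToFin {3} {q} j))
    where
    coefficient : Fin (q ℕ.^ 3) → Fin 3 → Carrier
    coefficient i t = ι (Inverse.from F.finite (Fin.finToFun i t))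

    ⟨0⟩ ⟨1⟩ ⟨2⟩ : Fin 3
    ⟨0⟩ = zero
    ⟨1⟩ = suc zero
    ⟨2⟩ = suc (suc zero)

    value : Fin (q ℕ.^ 3) → Carrier
    value i = coefficient i ⟨2⟩ * (θ * θ) + (coefficient i ⟨1⟩ * θ + coefficient i ⟨0⟩)

    fixed-coefficient : ∀ j i t → Fixed j (coefficient i t)
    fixed-coefficient j i t = F⊂fixed {j} (ι-fixed _)

    value∈E : ∀ i → Fixed 3 (value i)
    value∈E i = fixed-+ {3} (fixed-* {3} (fixed-coefficient 3 i ⟨2⟩) (fixed-* {3} θ∈E θ∈E))
      (fixed-+ {3} (fixed-* {3} (fixed-coefficient 3 i ⟨1⟩) θ∈E) (fixed-coefficient 3 i ⟨0⟩))

    value-injective : ∀ i j → E.index (value i) (value∈E i) ≡ E.index (value j) (value∈E j) → value i ≡ value j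
    value-injective i j eq = trans (sym (E.complete (value i) (value∈E i)))
      (trans (cong E.element eq) (E.complete (value j) (value∈E j)))

    difference : ∀ i j t → Carrier
    difference i j t = coefficient i t - coefficient j t

    fixed-difference : ∀ i j t → Fixed 1 (difference i j t)
    fixed-difference i j t = fixed-sub {1} (fixed-coefficient 1 i t) (fixed-coefficient 1 j t)

    vanishing : ∀ i j → value i ≡ value j →
                difference i j ⟨0⟩ ≡ 0# × difference i j ⟨1⟩ ≡ 0# × difference i j ⟨2⟩ ≡ 0#
    vanishing i j eq = quadratic-vanishes (fixed-difference i j ⟨0⟩) (fixed-difference i j ⟨1⟩) (fixed-difference i j ⟨2⟩)
      (trans (solve 7 (λ t a b c a′ b′ c′ → (c :- c′) :* (t :* t) :+ ((b :- b′) :* t :+ (a :- a′)) :=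
        (c :* (t :* t) :+ (b :* t :+ a)) :- (c′ :* (t :* t) :+ (b′ :* t :+ a′))) refl θ
        (coefficient i ⟨0⟩) (coefficient i ⟨1⟩) (coefficient i ⟨2⟩) (coefficient j ⟨0⟩) (coefficient j ⟨1⟩) (coefficient j ⟨2⟩))
        (x≡y⇒x-y≡0 eq))

    same : ∀ i j → value i ≡ value j → ∀ t → coefficient i t ≡ coefficient j t
    same i j eq zero             = x-y≡0⇒x≡y (proj₁ (vanishing i j eq))
    same i j eq (suc zero)       = x-y≡0⇒x≡y (proj₁ (proj₂ (vanishing i j eq)))
    same i j eq (suc (suc zero)) = x-y≡0⇒x≡y (proj₂ (proj₂ (vanishing i j eq)))

  Q≡q³ : Q ≡ q ℕ.^ 3
  Q≡q³ = ℕ.≤-antisym Q≤q³ q³≤Q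

  -- U is the image of an injective list, so n is its exact size: the count of bad vectors bounds it
  -- from above, the final choice of independent vectors from below.
  record ESubspace (n : ℕ) : Set where
    field
      point     : Fin n → Carrier
      injective : Injective _≡_ _≡_ point

    U : Carrier → Set
    U x = ∃[ i ] point i ≡ x

    field
      0∈U       : U 0#
      +-closed  : ∀ {x y} → U x → U y → U (x + y)
      *-closed  : ∀ {b x} → Fixed 3 b → U x → U (b * x)
      scattered : ∀ {l x y} → Fixed m l → U x → U y → y ≢ 0# → x ≡ l * y → Fixed 1 l

    sub-closed : ∀ {x y} → U x → U y → U (x - y)
    sub-closed {x} {y} Ux Uy = +-closed Ux (subst U (solve 1 (λ y → (:- :1) :* y := :- y) refl y)
      (*-closed {b = - 1#} (fixed-neg {3} (φ-1 3)) Uy))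

  -- 1, θ, ρ and ρθ are linearly dependent over F since E has only q³ elements.
  fractional-linear : ∀ {ρ} → Fixed 3 ρ → ¬ Fixed 1 ρ →
                      ∃[ a ] ∃[ b ] ∃[ c ] ∃[ d ] Fixed 1 a × Fixed 1 b × Fixed 1 c × Fixed 1 d ×
                      c * ρ + a ≢ 0# × c * ρ * θ + d * ρ + a * θ + b ≡ 0#
  fractional-linear {ρ} ρ∈E ρ∉F = from-collision (collapse {n = 4} (↔-refl {A = Fin Q})
      (subst (ℕ._< q ℕ.^ 4) (sym Q≡q³) (ℕ.^-monoʳ-< q 1<q (ℕ.n<1+n 3)))
      (λ a → E.index (value a) (value∈E a)))
    where
    value : (Fin 4 → F.Carrier) → Carrier
    value a = ι (a (suc (suc zero))) * ρ * θ + ι (a (suc (suc (suc zero)))) * ρ + ι (a zero) * θ + ι (a (suc zero))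

    fixed-ι : ∀ j f → Fixed j (ι f)
    fixed-ι j f = F⊂fixed {j} (ι-fixed f)

    value∈E : ∀ a → Fixed 3 (value a)
    value∈E a = fixed-+ {3} (fixed-+ {3} (fixed-+ {3} (fixed-* {3} (fixed-* {3} (fixed-ι 3 _) ρ∈E) θ∈E) (fixed-* {3} (fixed-ι 3 _) ρ∈E))
      (fixed-* {3} (fixed-ι 3 _) θ∈E)) (fixed-ι 3 _)

    from-collision : ∃[ x ] ∃[ y ] (∃[ i ] x i ≢ y i) × E.index (value x) (value∈E x) ≡ E.index (value y) (value∈E y) →
                     ∃[ a ] ∃[ b ] ∃[ c ] ∃[ d ] Fixed 1 a × Fixed 1 b × Fixed 1 c × Fixed 1 d ×
                     c * ρ + a ≢ 0# × c * ρ * θ + d * ρ + a * θ + b ≡ 0#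
    from-collision (x , y , (i , xᵢ≢yᵢ) , eq) = D zero , D (suc zero) , D (suc (suc zero)) , D (suc (suc (suc zero))) ,
      D∈F _ , D∈F _ , D∈F _ , D∈F _ , cρ+a≢0 , relation
      where
      D : Fin 4 → Carrier
      D t = ι (x t) - ι (y t)

      D∈F : ∀ t → Fixed 1 (D t)
      D∈F t = fixed-sub {1} (ι-fixed (x t)) (ι-fixed (y t))

      value-eq : value x ≡ value y
      value-eq = trans (sym (E.complete (value x) (value∈E x))) (trans (cong E.element eq) (E.complete (value y) (value∈E y)))

      relation : D (suc (suc zero)) * ρ * θ + D (suc (suc (suc zero))) * ρ + D zero * θ + D (suc zero) ≡ 0#
      relation = trans (solve 10 (λ r t a b c d a′ b′ c′ d′ →
          (c :- c′) :* r :* t :+ (d :- d′) :* r :+ (a :- a′) :* t :+ (b :- b′) :=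
          (c :* r :* t :+ d :* r :+ a :* t :+ b) :- (c′ :* r :* t :+ d′ :* r :+ a′ :* t :+ b′)) refl ρ θ
          (ι (x zero)) (ι (x (suc zero))) (ι (x (suc (suc zero)))) (ι (x (suc (suc (suc zero)))))
          (ι (y zero)) (ι (y (suc zero))) (ι (y (suc (suc zero)))) (ι (y (suc (suc (suc zero))))))
        (x≡y⇒x-y≡0 value-eq)

      -- Otherwise the relation leaves d ρ + b = 0 as well, and ρ ∉ F makes all four coefficients
      -- vanish.
      cρ+a≢0 : D (suc (suc zero)) * ρ + D zero ≢ 0#
      cρ+a≢0 cρ+a≡0 = xᵢ≢yᵢ (ι-injective (x-y≡0⇒x≡y (all-zero i)))
        where
        coefficients-vanish : ∀ {c a} → Fixed 1 c → Fixed 1 a → c * ρ + a ≡ 0# → c ≡ 0# × a ≡ 0#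
        coefficients-vanish {c} {a} fc fa eq with c ≟ 0#
        ... | no  c≢0 = ⊥-elim (ρ∉F (affine-root {1} c≢0 fc fa eq))
        ... | yes refl = refl , trans (solve 2 (λ r a → a := :0 :* r :+ a) refl ρ a) eq

        ca≡0 : D (suc (suc zero)) ≡ 0# × D zero ≡ 0#
        ca≡0 = coefficients-vanish (D∈F _) (D∈F _) cρ+a≡0

        db≡0 : D (suc (suc (suc zero))) ≡ 0# × D (suc zero) ≡ 0#
        db≡0 = coefficients-vanish (D∈F _) (D∈F _) (trans
          (solve 6 (λ a b c d r t → d :* r :+ b := (c :* r :* t :+ d :* r :+ a :* t :+ b) :- (c :* r :+ a) :* t) refl
            (D zero) (D (suc zero)) (D (suc (suc zero))) (D (suc (suc (suc zero)))) ρ θ)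
          (trans (cong₂ (λ x y → x - y * θ) relation cρ+a≡0) (solve 1 (λ t → :0 :- :0 :* t := :0) refl θ)))

        all-zero : ∀ i → D i ≡ 0#
        all-zero zero                   = proj₂ ca≡0
        all-zero (suc zero)             = proj₂ db≡0
        all-zero (suc (suc zero))       = proj₁ ca≡0
        all-zero (suc (suc (suc zero))) = proj₁ db≡0

  -- For vectors b v + u and b′ v + u′, `avoids₁` treats the ratios b / b′ in F and the case b′ = 0,
  -- while `avoids₂` treats the ratios outside F.
  module Step {n : ℕ} (S : ESubspace n) (v : Carrier)
              (avoids₁ : ∀ {l x y} → Fixed m l → ESubspace.U S x → ESubspace.U S y → v ≢ l * x - y)
              (avoids₂ : ∀ {l x y} → Fixed m l → ESubspace.U S x → ESubspace.U S y → v ≢ (l - θ) ⁻¹ * x - y) where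
    open ESubspace S

    private
      v∉U : ¬ U v
      v∉U Uv = avoids₁ (φ-1 m) Uv 0∈U (solve 1 (λ v → v := :1 :* v :- :0) refl v)

      multiple∉U : ∀ {b} → Fixed 3 b → b ≢ 0# → ¬ U (b * v)
      multiple∉U {b} fb b≢0 Ubv = v∉U (subst U
        (trans (solve 3 (λ i b v → i :* (b :* v) := b :* (i :* v)) refl (b ⁻¹) b v) (*-⁻¹-cancel v b≢0))
        (*-closed (fixed-⁻¹ {3} fb) Ubv))

      point′ : Fin (Q ℕ.* n) → Carrier
      point′ i = E.element (proj₁ (Fin.remQuot {Q} n i)) * v + point (proj₂ (Fin.remQuot {Q} n i))

      U′ : Carrier → Set
      U′ x = ∃[ b ] ∃[ u ] Fixed 3 b × U u × x ≡ b * v + u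

      to-U′ : ∀ {x} → (∃[ i ] point′ i ≡ x) → U′ x
      to-U′ (i , eq) = _ , _ , E.sound (proj₁ (Fin.remQuot {Q} n i)) , (proj₂ (Fin.remQuot {Q} n i) , refl) , sym eq

      from-U′ : ∀ {x} → U′ x → ∃[ i ] point′ i ≡ x
      from-U′ (b , u , fb , (j , eq) , x≡) = Fin.combine (E.index b fb) j ,
        trans (cong (λ (s , t) → E.element s * v + point t) (Fin.remQuot-combine (E.index b fb) j))
          (trans (cong₂ (λ s t → s * v + t) (E.complete b fb) eq) (sym x≡))

      point′-injective : Injective _≡_ _≡_ point′
      point′-injective {i} {j} eq = trans (sym (Fin.combine-remQuot {Q} n i))
        (trans (cong₂ Fin.combine (E.injective b≡b′) (injective u≡u′)) (Fin.combine-remQuot {Q} n j))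
        where
        b b′ u u′ : Carrier
        b  = E.element (proj₁ (Fin.remQuot {Q} n i))
        b′ = E.element (proj₁ (Fin.remQuot {Q} n j))
        u  = point (proj₂ (Fin.remQuot {Q} n i))
        u′ = point (proj₂ (Fin.remQuot {Q} n j))

        difference : (b - b′) * v ≡ u′ - u
        difference = trans (solve 5 (λ b b′ v u u′ → (b :- b′) :* v := ((b :* v :+ u) :- (b′ :* v :+ u′)) :+ (u′ :- u)) refl b b′ v u u′)
          (trans (cong (_+ (u′ - u)) (x≡y⇒x-y≡0 eq)) (+-identityˡ _))

        b≡b′ : b ≡ b′
        b≡b′ with (b - b′) ≟ 0#
        ... | yes eq₀ = x-y≡0⇒x≡y eq₀
        ... | no  neq = ⊥-elim (multiple∉U (fixed-sub {3} (E.sound _) (E.sound _)) neq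
          (subst U (sym difference) (sub-closed (_ , refl) (_ , refl))))

        u≡u′ : u ≡ u′
        u≡u′ = sym (x-y≡0⇒x≡y (trans (sym difference) (trans (cong (_* v) (x≡y⇒x-y≡0 b≡b′)) (zeroˡ v))))

      module Ratio {l b u b′ u′} (l∈K : Fixed m l) (b∈E : Fixed 3 b) (Uu : U u) (b′∈E : Fixed 3 b′) (Uu′ : U u′)
                   (eq : b * v + u ≡ l * (b′ * v + u′)) where

        old : b ≡ 0# → b′ ≡ 0# → b′ * v + u′ ≢ 0# → Fixed 1 l
        old refl refl neq = scattered l∈K Uu Uu′ (λ e → neq (trans (simplify u′) e))
          (trans (sym (simplify u)) (trans eq (cong (l *_) (simplify u′))))
          where
          simplify : ∀ w → 0# * v + w ≡ w
          simplify = solve 2 (λ v w → :0 :* v :+ w := w) refl v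

        only-b′-zero : b ≢ 0# → b′ ≡ 0# → ⊥
        only-b′-zero b≢0 refl = avoids₁ {l} l∈K (*-closed (fixed-⁻¹ {3} b∈E) Uu′) (*-closed (fixed-⁻¹ {3} b∈E) Uu)
          (*-cancelˡ b≢0 (begin
            b * v                                    ≡⟨ solve 3 (λ b v u → b :* v := (b :* v :+ u) :- u) refl b v u ⟩
            (b * v + u) - u                          ≡⟨ cong (_- u) eq ⟩
            l * (0# * v + u′) - u                    ≡⟨ solve 4 (λ l v u′ u → l :* (:0 :* v :+ u′) :- u := :1 :* (l :* u′ :- u)) refl l v u′ u ⟩
            1# * (l * u′ - u)                        ≡⟨ cong (_* (l * u′ - u)) (*-inverseʳ b≢0) ⟨
            b * b ⁻¹ * (l * u′ - u)                  ≡⟨ solve 5 (λ b i l u′ u → b :* i :* (l :* u′ :- u) := b :* (l :* (i :* u′) :- i :* u)) refl b (b ⁻¹) l u′ u ⟩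
            b * (l * (b ⁻¹ * u′) - b ⁻¹ * u)         ∎))

        module _ (b′≢0 : b′ ≢ 0#) where
          -- Division by b′ turns the equation into ρ v + w = l (v + w′), that is (ρ - l)(v + w′) =
          -- x with x in U.
          ρ w w′ x : Carrier
          ρ  = b′ ⁻¹ * b
          w  = b′ ⁻¹ * u
          w′ = b′ ⁻¹ * u′
          x  = ρ * w′ - w

          ρ∈E : Fixed 3 ρ
          ρ∈E = fixed-* {3} (fixed-⁻¹ {3} b′∈E) b∈E

          Uw : U w
          Uw = *-closed (fixed-⁻¹ {3} b′∈E) Uu
          Uw′ : U w′
          Uw′ = *-closed (fixed-⁻¹ {3} b′∈E) Uu′
          Ux : U x
          Ux = sub-closed (*-closed ρ∈E Uw′) Uw

          difference : (ρ - l) * (v + w′) ≡ x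
          difference = begin
            (ρ - l) * (v + w′)
              ≡⟨ solve 5 (λ r l v w w′ → (r :- l) :* (v :+ w′) := ((r :* v :+ w) :- l :* (:1 :* v :+ w′)) :+ (r :* w′ :- w)) refl ρ l v w w′ ⟩
            ((ρ * v + w) - l * (1# * v + w′)) + x
              ≡⟨ cong (λ t → ((ρ * v + w) - l * (t * v + w′)) + x) (*-inverseʳ b′≢0) ⟨
            ((ρ * v + w) - l * (b′ * b′ ⁻¹ * v + w′)) + x
              ≡⟨ solve 8 (λ i b v u l b′ u′ x → ((i :* b :* v :+ i :* u) :- l :* (b′ :* i :* v :+ i :* u′)) :+ x :=
                   i :* ((b :* v :+ u) :- l :* (b′ :* v :+ u′)) :+ x) refl (b′ ⁻¹) b v u l b′ u′ x ⟩
            b′ ⁻¹ * ((b * v + u) - l * (b′ * v + u′)) + x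
              ≡⟨ cong (λ t → b′ ⁻¹ * t + x) (x≡y⇒x-y≡0 eq) ⟩
            b′ ⁻¹ * 0# + x
              ≡⟨ solve 2 (λ i x → i :* :0 :+ x := x) refl (b′ ⁻¹) x ⟩
            x ∎

          -- Here ρ - l lies in K. Unless it is zero, v is the bad vector x / (ρ - l) - w′.
          ρ-in-F : Fixed 1 ρ → Fixed 1 l
          ρ-in-F ρ∈F with (ρ - l) ≟ 0#
          ... | yes eq₀ = subst (Fixed 1) (x-y≡0⇒x≡y eq₀) ρ∈F
          ... | no  neq = ⊥-elim (avoids₁ (fixed-⁻¹ {m} (fixed-sub {m} (F⊂fixed {m} ρ∈F) l∈K)) Ux Uw′ (*-cancelˡ neq (begin
            (ρ - l) * v                              ≡⟨ solve 3 (λ d v w → d :* v := d :* (v :+ w) :- d :* w) refl (ρ - l) v w′ ⟩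
            (ρ - l) * (v + w′) - (ρ - l) * w′        ≡⟨ cong (_- (ρ - l) * w′) difference ⟩
            x - (ρ - l) * w′                         ≡⟨ cong (_- (ρ - l) * w′) (*-⁻¹-cancel x neq) ⟨
            (ρ - l) * ((ρ - l) ⁻¹ * x) - (ρ - l) * w′ ≡⟨ solve 3 (λ d y w → d :* y :- d :* w := d :* (y :- w)) refl (ρ - l) _ w′ ⟩
            (ρ - l) * ((ρ - l) ⁻¹ * x - w′)          ∎)))

          -- With μ = -(b₀ + d l) / (c l + a) the relation between ρ and θ gives
          -- (μ - θ)(c l + a) = (ρ - l)(c θ + d).
          ρ-not-in-F : ¬ Fixed 1 ρ → Fixed 1 l
          ρ-not-in-F ρ∉F = from-relation (fractional-linear ρ∈E ρ∉F)
            where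
            from-relation : ∃[ a ] ∃[ b ] ∃[ c ] ∃[ d ] Fixed 1 a × Fixed 1 b × Fixed 1 c × Fixed 1 d ×
                            c * ρ + a ≢ 0# × c * ρ * θ + d * ρ + a * θ + b ≡ 0# → Fixed 1 l
            from-relation (a , b₀ , c , d , a∈F , b₀∈F , c∈F , d∈F , g≢0 , relation) = by-cases (h ≟ 0#)
              where
              g h μ x₁ x₂ : Carrier
              g  = c * ρ + a
              h  = c * l + a
              μ  = h ⁻¹ * (- (b₀ + d * l))
              x₁ = g ⁻¹ * ((c * θ + d) * x)
              x₂ = w′ - g ⁻¹ * (c * x)

              g⁻¹∈E : Fixed 3 (g ⁻¹)
              g⁻¹∈E = fixed-⁻¹ {3} (fixed-+ {3} (fixed-* {3} (F⊂fixed {3} c∈F) ρ∈E) (F⊂fixed {3} a∈F))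

              μ∈K : Fixed m μ
              μ∈K = fixed-* {m} (fixed-⁻¹ {m} (fixed-+ {m} (fixed-* {m} (F⊂fixed {m} c∈F) l∈K) (F⊂fixed {m} a∈F)))
                (fixed-neg {m} (fixed-+ {m} (F⊂fixed {m} b₀∈F) (fixed-* {m} (F⊂fixed {m} d∈F) l∈K)))

              Ux₁ : U x₁
              Ux₁ = *-closed g⁻¹∈E (*-closed (fixed-+ {3} (fixed-* {3} (F⊂fixed {3} c∈F) θ∈E) (F⊂fixed {3} d∈F)) Ux)

              Ux₂ : U x₂
              Ux₂ = sub-closed Uw′ (*-closed g⁻¹∈E (*-closed (F⊂fixed {3} c∈F) Ux))

              μ-θ≢0 : μ - θ ≢ 0#
              μ-θ≢0 eq₀ = θ∉F (fixed-prime-to-3 3∤m θ∈E (subst (Fixed m) (x-y≡0⇒x≡y eq₀) μ∈K))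

              [μ-θ]h : h ≢ 0# → (μ - θ) * h ≡ (ρ - l) * (c * θ + d)
              [μ-θ]h h≢0 = begin
                (μ - θ) * h
                  ≡⟨ solve 3 (λ i t h → (i :- t) :* h := h :* i :- t :* h) refl μ θ h ⟩
                h * μ - θ * h
                  ≡⟨ cong (_- θ * h) (*-⁻¹-cancel _ h≢0) ⟩
                (- (b₀ + d * l)) - θ * h
                  ≡⟨ solve 7 (λ a b c d r l t → (:- (b :+ d :* l)) :- t :* (c :* l :+ a) :=
                       (r :- l) :* (c :* t :+ d) :- (c :* r :* t :+ d :* r :+ a :* t :+ b)) refl a b₀ c d ρ l θ ⟩
                (ρ - l) * (c * θ + d) - (c * ρ * θ + d * ρ + a * θ + b₀)
                  ≡⟨ cong (λ t → (ρ - l) * (c * θ + d) - t) relation ⟩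
                (ρ - l) * (c * θ + d) - 0#
                  ≡⟨ solve 1 (λ y → y :- :0 := y) refl ((ρ - l) * (c * θ + d)) ⟩
                (ρ - l) * (c * θ + d) ∎

              -- Since g = c (ρ - l) + h, it follows that g (v + w′) = c x + (c θ + d) x / (μ - θ).
              -- The coefficients g, c and c θ + d lie in E, which keeps x₁ and x₂ in U.
              v≡ : h ≢ 0# → v ≡ (μ - θ) ⁻¹ * x₁ - x₂
              v≡ h≢0 = *-cancelˡ (*-nonzero g≢0 μ-θ≢0) (begin
                g * (μ - θ) * v
                  ≡⟨ solve 7 (λ c r a l n v w → (c :* r :+ a) :* n :* v :=
                       n :* (c :* ((r :- l) :* (v :+ w))) :+ n :* (c :* l :+ a) :* (v :+ w) :- (c :* r :+ a) :* n :* w)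
                       refl c ρ a l (μ - θ) v w′ ⟩
                (μ - θ) * (c * ((ρ - l) * (v + w′))) + (μ - θ) * h * (v + w′) - g * (μ - θ) * w′
                  ≡⟨ cong₂ (λ s t → (μ - θ) * (c * s) + t * (v + w′) - g * (μ - θ) * w′) difference ([μ-θ]h h≢0) ⟩
                (μ - θ) * (c * x) + (ρ - l) * (c * θ + d) * (v + w′) - g * (μ - θ) * w′
                  ≡⟨ solve 6 (λ y r k v w gn → y :+ r :* k :* (v :+ w) :- gn :* w := y :+ k :* (r :* (v :+ w)) :- gn :* w)
                       refl ((μ - θ) * (c * x)) (ρ - l) (c * θ + d) v w′ (g * (μ - θ)) ⟩
                (μ - θ) * (c * x) + (c * θ + d) * ((ρ - l) * (v + w′)) - g * (μ - θ) * w′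
                  ≡⟨ cong (λ s → (μ - θ) * (c * x) + (c * θ + d) * s - g * (μ - θ) * w′) difference ⟩
                (μ - θ) * (c * x) + (c * θ + d) * x - g * (μ - θ) * w′
                  ≡⟨ solve 5 (λ n cx kx gn w → n :* cx :+ kx :- gn :* w := (:1 :* :1) :* kx :+ :1 :* (n :* cx) :- gn :* w)
                       refl (μ - θ) (c * x) ((c * θ + d) * x) (g * (μ - θ)) w′ ⟩
                (1# * 1#) * ((c * θ + d) * x) + 1# * ((μ - θ) * (c * x)) - g * (μ - θ) * w′
                  ≡⟨ cong₂ (λ s t → (s * t) * ((c * θ + d) * x) + s * ((μ - θ) * (c * x)) - g * (μ - θ) * w′) (*-inverseʳ g≢0) (*-inverseʳ μ-θ≢0) ⟨
                (g * g ⁻¹ * ((μ - θ) * (μ - θ) ⁻¹)) * ((c * θ + d) * x) + g * g ⁻¹ * ((μ - θ) * (c * x)) - g * (μ - θ) * w′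
                  ≡⟨ solve 7 (λ g i n j kx cx w → (g :* i :* (n :* j)) :* kx :+ g :* i :* (n :* cx) :- g :* n :* w :=
                       g :* n :* (j :* (i :* kx) :- (w :- i :* cx))) refl g (g ⁻¹) (μ - θ) ((μ - θ) ⁻¹) ((c * θ + d) * x) (c * x) w′ ⟩
                g * (μ - θ) * ((μ - θ) ⁻¹ * x₁ - x₂) ∎)

              by-cases : Dec (h ≡ 0#) → Fixed 1 l
              by-cases (no  h≢0) = ⊥-elim (avoids₂ μ∈K Ux₁ Ux₂ (v≡ h≢0))
              -- At the pole h = c l + a = 0 the ratio l is -a / c and so lies in F.
              by-cases (yes h≡0) = affine-root {1} c≢0 c∈F a∈F h≡0
                where
                c≢0 : c ≢ 0#
                c≢0 c≡0 = g≢0 (trans (cong (λ t → t * ρ + a) c≡0) (trans (solve 3 (λ r l a → :0 :* r :+ a := :0 :* l :+ a) refl ρ l a)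
                  (trans (cong (λ t → t * l + a) (sym c≡0)) h≡0)))

          ratio : Fixed 1 l
          ratio with φ 1 ρ ≟ ρ
          ... | yes ρ∈F = ρ-in-F ρ∈F
          ... | no  ρ∉F = ρ-not-in-F ρ∉F

        l∈F : b′ * v + u′ ≢ 0# → Fixed 1 l
        l∈F neq = by-cases (b ≟ 0#) (b′ ≟ 0#)
          where
          by-cases : Dec (b ≡ 0#) → Dec (b′ ≡ 0#) → Fixed 1 l
          by-cases _         (no  b′≢0) = ratio b′≢0
          by-cases (yes b≡0) (yes b′≡0) = old b≡0 b′≡0 neq
          by-cases (no  b≢0) (yes b′≡0) = ⊥-elim (only-b′-zero b≢0 b′≡0)

    extended : ESubspace (Q ℕ.* n)
    extended = record
      { point     = point′
      ; injective = point′-injective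
      ; 0∈U       = from-U′ (0# , 0# , φ-0 3 , 0∈U , solve 1 (λ v → :0 := :0 :* v :+ :0) refl v)
      ; +-closed  = λ Ux Uy → from-U′ (add (to-U′ Ux) (to-U′ Uy))
      ; *-closed  = λ fb Ux → from-U′ (scale fb (to-U′ Ux))
      ; scattered = λ l∈K Ux Uy y≢0 eq → ratio-in-F l∈K (to-U′ Ux) (to-U′ Uy) y≢0 eq
      }
      where
      add : ∀ {x y} → U′ x → U′ y → U′ (x + y)
      add (b , u , fb , Uu , refl) (b′ , u′ , fb′ , Uu′ , refl) = b + b′ , u + u′ , fixed-+ {3} fb fb′ , +-closed Uu Uu′ ,
        solve 5 (λ b b′ v u u′ → (b :* v :+ u) :+ (b′ :* v :+ u′) := (b :+ b′) :* v :+ (u :+ u′)) refl b b′ v u u′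

      scale : ∀ {c x} → Fixed 3 c → U′ x → U′ (c * x)
      scale {c} fc (b , u , fb , Uu , refl) = c * b , c * u , fixed-* {3} fc fb , *-closed fc Uu ,
        solve 4 (λ c b v u → c :* (b :* v :+ u) := c :* b :* v :+ c :* u) refl c b v u

      ratio-in-F : ∀ {l x y} → Fixed m l → U′ x → U′ y → y ≢ 0# → x ≡ l * y → Fixed 1 l
      ratio-in-F l∈K (b , u , fb , Uu , refl) (b′ , u′ , fb′ , Uu′ , refl) y≢0 eq =
        Ratio.l∈F l∈K fb Uu fb′ Uu′ eq y≢0

  -- A bad vector is given by its kind, an element of K and two points of U, whence 2 k n² of them.
  extend : ∀ {n} → ESubspace n → 2 ℕ.* (k ℕ.* (n ℕ.* n)) ℕ.< size → ESubspace (Q ℕ.* n)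
  extend {n} S small = from-missed (missed (bad ∘ Inverse.from code) small)
    where
    open ESubspace S

    Parameters : Set
    Parameters = Fin 2 × (Fin k × (Fin n × Fin n))

    code : Parameters ↔ Fin (2 ℕ.* (k ℕ.* (n ℕ.* n)))
    code = ↔-trans (↔-refl ×-↔ ↔-trans (↔-refl ×-↔ ↔-sym Fin.*↔×) (↔-sym Fin.*↔×)) (↔-sym Fin.*↔×)

    bad : Parameters → Carrier
    bad (zero     , l , i , j) = L.element l * point i - point j
    bad (suc zero , l , i , j) = (L.element l - θ) ⁻¹ * point i - point j

    from-missed : (∃[ v ] ∀ i → bad (Inverse.from code i) ≢ v) → ESubspace (Q ℕ.* n)
    from-missed (v , avoids) = Step.extended S v
      (λ { {l} fl (i , refl) (j , refl) eq → avoids-parameter (zero , L.index l fl , i , j)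
           (trans (cong (λ t → t * point i - point j) (L.complete l fl)) (sym eq)) })
      (λ { {l} fl (i , refl) (j , refl) eq → avoids-parameter (suc zero , L.index l fl , i , j)
           (trans (cong (λ t → (t - θ) ⁻¹ * point i - point j) (L.complete l fl)) (sym eq)) })
      where
      avoids-parameter : ∀ x → bad x ≢ v
      avoids-parameter x eq = avoids (Inverse.to code x) (trans (cong bad (Inverse.strictlyInverseʳ code x)) eq)

  trivial : ESubspace 1
  trivial = record
    { point     = λ _ → 0#
    ; injective = λ { {zero} {zero} _ → refl }
    ; 0∈U       = zero , refl
    ; +-closed  = λ { (_ , refl) (_ , refl) → zero , sym (+-identityˡ 0#) }
    ; *-closed  = λ { {b} _ (_ , refl) → zero , sym (zeroʳ b) }
    ; scattered = λ { _ _ (_ , refl) y≢0 _ → ⊥-elim (y≢0 refl) }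
    }

  -- Against E-dimension j there are at most 2 q^(m+6j) ≤ q^(1+m+6j) bad vectors. The bound grows
  -- with j, so the hypothesis for the last step also serves all earlier ones.
  subspace : ∀ j → 1 ℕ.+ m ℕ.+ (3 ℕ.* j ℕ.+ 3 ℕ.* j) ℕ.< 3 ℕ.* m → ESubspace (Q ℕ.^ suc j)
  subspace j small = extend (previous j small) (ℕ.≤-<-trans (small-count j) (subst (q ℕ.^ (1 ℕ.+ m ℕ.+ (3 ℕ.* j ℕ.+ 3 ℕ.* j)) ℕ.<_) (sym size-K)
      (ℕ.^-monoʳ-< q 1<q small)))
    where
    previous : ∀ j → 1 ℕ.+ m ℕ.+ (3 ℕ.* j ℕ.+ 3 ℕ.* j) ℕ.< 3 ℕ.* m → ESubspace (Q ℕ.^ j)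
    previous zero    _     = trivial
    previous (suc j) small = subspace j (ℕ.≤-<-trans (ℕ.+-monoʳ-≤ (1 ℕ.+ m)
      (ℕ.+-mono-≤ (ℕ.*-monoʳ-≤ 3 (ℕ.n≤1+n j)) (ℕ.*-monoʳ-≤ 3 (ℕ.n≤1+n j)))) small)

    small-count : ∀ j → 2 ℕ.* (k ℕ.* (Q ℕ.^ j ℕ.* Q ℕ.^ j)) ℕ.≤ q ℕ.^ (1 ℕ.+ m ℕ.+ (3 ℕ.* j ℕ.+ 3 ℕ.* j))
    small-count j = subst (2 ℕ.* (k ℕ.* (Q ℕ.^ j ℕ.* Q ℕ.^ j)) ℕ.≤_) (sym (begin
        q ℕ.* q ℕ.^ (m ℕ.+ (3 ℕ.* j ℕ.+ 3 ℕ.* j))                   ≡⟨ cong (q ℕ.*_) (ℕ.^-distribˡ-+-* q m _) ⟩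
        q ℕ.* (q ℕ.^ m ℕ.* q ℕ.^ (3 ℕ.* j ℕ.+ 3 ℕ.* j))             ≡⟨ cong (λ t → q ℕ.* (q ℕ.^ m ℕ.* t)) (ℕ.^-distribˡ-+-* q (3 ℕ.* j) (3 ℕ.* j)) ⟩
        q ℕ.* (q ℕ.^ m ℕ.* (q ℕ.^ (3 ℕ.* j) ℕ.* q ℕ.^ (3 ℕ.* j)))   ≡⟨ cong (λ t → q ℕ.* (q ℕ.^ m ℕ.* (t ℕ.* t))) Q^j ⟨
        q ℕ.* (q ℕ.^ m ℕ.* (Q ℕ.^ j ℕ.* Q ℕ.^ j))                   ∎))
      (ℕ.*-mono-≤ 1<q (ℕ.*-monoˡ-≤ (Q ℕ.^ j ℕ.* Q ℕ.^ j) k≤q^m))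
      where
      Q^j : Q ℕ.^ j ≡ q ℕ.^ (3 ℕ.* j)
      Q^j = trans (cong (ℕ._^ j) Q≡q³) (ℕ.^-*-assoc q 3 j)

module OneModThree (c : ℕ) (X : Extension (1 ℕ.+ c ℕ.* 3)) where
  open Extension X
  open FiniteField K using (Carrier; size)
  open Space K
  open CubicExtension K using (N; κ; κ-scale)
  private
    module N = FiniteField N
    module κ = Embedding κ
    module ι = Embedding F→K

    m : ℕ
    m = 1 ℕ.+ c ℕ.* 3

    3∤m : Prime-to-3 m
    3∤m = inj₁ (c , refl)
  open Scattered F→K m size-K using (q; 1<q; CuttingFamily; cuttingFamily; ScatteredSubspace)
  open ≡-Reasoning

  private
    X-N : Extension (3 ℕ.* m)
    X-N = cubicExtension refl X

    open Frobenius X-N hiding (q)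
    module φK = Frobenius X
    module NN = Norm X-N

    κ-fixed : ∀ l → Fixed m (κ.ι l)
    κ-fixed l = trans (sym (κ.ι-^ l (q ℕ.^ m))) (cong κ.ι (φK.φ-period l))

    module Construction (θ : V) (θ∈E : Fixed 3 θ) (θ∉F : ¬ Fixed 1 θ) where
      open Greedy 3∤m X-N θ θ∈E θ∉F

      -- For m = 1 + 3c the left side is exactly 3m - 1.
      room : 1 ℕ.+ m ℕ.+ (3 ℕ.* c ℕ.+ 3 ℕ.* c) ℕ.< 3 ℕ.* m
      room = ℕ.≤-reflexive (S.solve 1 (λ c → let m = S.con 1 S.:+ c S.:* S.con 3; 3c = S.con 3 S.:* c in
        S.con 1 S.:+ (S.con 1 S.:+ m S.:+ (3c S.:+ 3c)) S.:= S.con 3 S.:* m) refl c)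
        where module S = +-*-Solver

      module U = ESubspace (subspace c room)

      scatteredSubspace : ScatteredSubspace U.U (Q ℕ.^ suc c)
      scatteredSubspace = record
        { ⊕-closed         = U.+-closed
        ; ⊙-closed         = λ f {v} Uv → subst U.U (κ-scale (ι.ι f) v) (U.*-closed (fixed-multiple {1} 3 (ι-fixed f)) Uv)
        ; scattered        = λ l Uu Uv v≢𝟎 eq → from-fixed l (U.scattered (κ-fixed l) Uu Uv v≢𝟎 (trans eq (sym (κ-scale l _))))
        ; points           = U.point
        ; points-injective = U.injective
        ; points-sound     = λ i → i , refl
        }
        where
        from-fixed : ∀ l → Fixed 1 (κ.ι l) → ∃[ f ] ι.ι f ≡ l
        from-fixed l fixed with fixed⇒ι fixed
        ... | f , eq = f , κ.ι-injective eq

      enough : q ℕ.^ (2 ℕ.+ m) ℕ.≤ Q ℕ.^ suc c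
      enough = ℕ.≤-reflexive (begin
        q ℕ.^ (3 ℕ.+ c ℕ.* 3)       ≡⟨ cong (λ k → q ℕ.^ k) (ℕ.*-comm (suc c) 3) ⟩
        q ℕ.^ (3 ℕ.* suc c)         ≡⟨ ℕ.^-*-assoc q 3 (suc c) ⟨
        (q ℕ.^ 3) ℕ.^ suc c         ≡⟨ cong (ℕ._^ suc c) Q≡q³ ⟨
        Q ℕ.^ suc c                 ∎)

      family : CuttingFamily (2 ℕ.+ m)
      family = cuttingFamily scatteredSubspace enough

  -- Taking θ to be a norm from the cubic extension puts it into E, and counting gives one that is
  -- not in F.
  cutting-family : CuttingFamily (2 ℕ.+ m)
  cutting-family = from-norm (NN.norm-not-in-F m ℕ.z<s (Inverse.from N.finite) N.from-injective (ℕ.≤-reflexive (sym (Extension.size-K X-N))))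
    where
    from-norm : ∃[ i ] ¬ Fixed 1 (NN.norm m (Inverse.from N.finite i)) → CuttingFamily (2 ℕ.+ m)
    from-norm (i , θ∉F) = Construction.family (NN.norm m x) (NN.norm-fixed m (NN.norm-nonzero-argument m ℕ.z<s θ∉F) (φ-period x)) θ∉F
      where
      x : V
      x = Inverse.from N.finite i

-- Choice of the construction by m modulo 6

cutting-family : ∀ {m} (X : Extension m) → m ℕ.% 6 ≢ 3 → m ℕ.% 6 ≢ 5 → 4 ℕ.≤ m →
                 Scattered.CuttingFamily (Extension.F→K X) m (Extension.size-K X) (2 ℕ.+ m)
cutting-family {m} X ≢3 ≢5 4≤m = by-remainder (m ℕ.% 6) (m%n<n m 6) refl
  where
  c : ℕ
  c = m ℕ./ 6

  Goal : Set
  Goal = Scattered.CuttingFamily (Extension.F→K X) m (Extension.size-K X) (2 ℕ.+ m)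

  transport : ∀ {n} → m ≡ n → ((X : Extension n) →
              Scattered.CuttingFamily (Extension.F→K X) n (Extension.size-K X) (2 ℕ.+ n)) → Goal
  transport refl family = family X

  m≡ : ∀ {r} → m ℕ.% 6 ≡ r → m ≡ r ℕ.+ c ℕ.* 6
  m≡ refl = m≡m%n+[m/n]*n m 6

  module S = +-*-Solver

  half≥2 : ∀ {s} → m ≡ s ℕ.+ s → 2 ℕ.≤ s
  half≥2 {zero}        refl = ⊥-elim (ℕ.<⇒≱ ℕ.z<s 4≤m)
  half≥2 {suc zero}    refl = ⊥-elim (ℕ.<⇒≱ (ℕ.s≤s (ℕ.s≤s (ℕ.s≤s ℕ.z≤n))) 4≤m)
  half≥2 {suc (suc s)} _    = ℕ.s≤s (ℕ.s≤s ℕ.z≤n)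

  c>0 : ∀ {n} → m ≡ n ℕ.* 6 → 0 ℕ.< n
  c>0 {zero}  refl = ⊥-elim (ℕ.<⇒≱ ℕ.z<s 4≤m)
  c>0 {suc n} _    = ℕ.z<s

  by-remainder : ∀ r → r ℕ.< 6 → m ℕ.% 6 ≡ r → Goal
  by-remainder 0 _ eq = transport
    (trans (m≡ eq) (S.solve 1 (λ c → c S.:* S.con 6 S.:= S.con 3 S.:* c S.:+ S.con 3 S.:* c) refl c))
    (EvenMultipleOf3.cutting-family c (c>0 (m≡ eq)))
  by-remainder 1 _ eq = transport
    (trans (m≡ eq) (S.solve 1 (λ c → S.con 1 S.:+ c S.:* S.con 6 S.:= S.con 1 S.:+ (S.con 2 S.:* c) S.:* S.con 3) refl c))
    (OneModThree.cutting-family (2 ℕ.* c))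
  by-remainder 2 _ eq = transport m≡s+s
    (λ X → EvenPrimeTo3.cutting-family (1 ℕ.+ c ℕ.* 3) X (half≥2 m≡s+s) (inj₁ (c , refl)))
    where
    m≡s+s : m ≡ (1 ℕ.+ c ℕ.* 3) ℕ.+ (1 ℕ.+ c ℕ.* 3)
    m≡s+s = trans (m≡ eq) (S.solve 1 (λ c → S.con 2 S.:+ c S.:* S.con 6 S.:= (S.con 1 S.:+ c S.:* S.con 3) S.:+ (S.con 1 S.:+ c S.:* S.con 3)) refl c)
  by-remainder 3 _ eq = ⊥-elim (≢3 eq)
  by-remainder 4 _ eq = transport m≡s+s
    (λ X → EvenPrimeTo3.cutting-family (2 ℕ.+ c ℕ.* 3) X (half≥2 m≡s+s) (inj₂ (c , refl)))
    where
    m≡s+s : m ≡ (2 ℕ.+ c ℕ.* 3) ℕ.+ (2 ℕ.+ c ℕ.* 3)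
    m≡s+s = trans (m≡ eq) (S.solve 1 (λ c → S.con 4 S.:+ c S.:* S.con 6 S.:= (S.con 2 S.:+ c S.:* S.con 3) S.:+ (S.con 2 S.:+ c S.:* S.con 3)) refl c)
  by-remainder 5 _ eq = ⊥-elim (≢5 eq)
  by-remainder (suc (suc (suc (suc (suc (suc _)))))) r<6 _ = ⊥-elim (ℕ.<⇒≱ r<6 (ℕ.s≤s (ℕ.s≤s (ℕ.s≤s (ℕ.s≤s (ℕ.s≤s (ℕ.s≤s ℕ.z≤n)))))))

-- Codes from scattered subspaces

module LinearSystems (K : FiniteField) where
  open FiniteField K
  open FieldTheory K
  open SemiringSum semiring using (sum; sum-cong-≗; ∑-distrib-+; ∑-comm; *-distribˡ-sum; sum-replicate-zero)
  open ≡-Reasoning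

  δ : ∀ {n} → Fin n → Fin n → Carrier
  δ zero    zero    = 1#
  δ zero    (suc j) = 0#
  δ (suc i) zero    = 0#
  δ (suc i) (suc j) = δ i j

  sum-δ : ∀ {n} (f : Fin n → Carrier) i → sum (λ j → f j * δ j i) ≡ f i
  sum-δ {suc n} f zero = begin
    f zero * 1# + sum (λ j → f (suc j) * 0#)   ≡⟨ cong₂ _+_ (*-identityʳ _) (trans (sum-cong-≗ {n} (λ j → zeroʳ (f (suc j)))) (sum-replicate-zero n)) ⟩
    f zero + 0#                                ≡⟨ +-identityʳ _ ⟩
    f zero                                     ∎
  sum-δ {suc n} f (suc i) = trans (cong₂ _+_ (zeroʳ (f zero)) (sum-δ (f ∘ suc) i)) (+-identityˡ _)

  ⟨_,_⟩ : ∀ {n} → (Fin n → Carrier) → (Fin n → Carrier) → Carrier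
  ⟨ x , y ⟩ = sum (λ t → x t * y t)

  ⟨,⟩-affine : ∀ {n} (x y z : Fin n → Carrier) c → ⟨ x , (λ t → y t + c * z t) ⟩ ≡ ⟨ x , y ⟩ + c * ⟨ x , z ⟩
  ⟨,⟩-affine x y z c = begin
    sum (λ t → x t * (y t + c * z t))                  ≡⟨ sum-cong-≗ (λ t → solve 4 (λ x y c z → x :* (y :+ c :* z) := x :* y :+ c :* (x :* z)) refl (x t) (y t) c (z t)) ⟩
    sum (λ t → x t * y t + c * (x t * z t))            ≡⟨ ∑-distrib-+ (λ t → x t * y t) (λ t → c * (x t * z t)) ⟩
    ⟨ x , y ⟩ + sum (λ t → c * (x t * z t))            ≡⟨ cong (⟨ x , y ⟩ +_) (*-distribˡ-sum c (λ t → x t * z t)) ⟨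
    ⟨ x , y ⟩ + c * ⟨ x , z ⟩                          ∎

  ⟨,⟩-sum : ∀ {n k} (x : Fin n → Carrier) (c : Fin k → Carrier) (z : Fin k → Fin n → Carrier) →
            ⟨ x , (λ t → sum (λ j → c j * z j t)) ⟩ ≡ sum (λ j → c j * ⟨ x , z j ⟩)
  ⟨,⟩-sum x c z = begin
    sum (λ t → x t * sum (λ j → c j * z j t))          ≡⟨ sum-cong-≗ (λ t → *-distribˡ-sum (x t) (λ j → c j * z j t)) ⟩
    sum (λ t → sum (λ j → x t * (c j * z j t)))        ≡⟨ ∑-comm (λ t j → x t * (c j * z j t)) ⟩
    sum (λ j → sum (λ t → x t * (c j * z j t)))        ≡⟨ sum-cong-≗ (λ j → sum-cong-≗ (λ t → solve 3 (λ x c z → x :* (c :* z) := c :* (x :* z)) refl (x t) (c j) (z j t))) ⟩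
    sum (λ j → sum (λ t → c j * (x t * z j t)))        ≡⟨ sum-cong-≗ (λ j → *-distribˡ-sum (c j) (λ t → x t * z j t)) ⟨
    sum (λ j → c j * ⟨ x , z j ⟩)                      ∎

  IndependentRows : ∀ {n k} → (Fin n → Fin k → Carrier) → Set
  IndependentRows {n} {k} r =
    ∀ (a : Fin n → Carrier) → (∀ (t : Fin k) → sum (λ i → a i * r i t) ≡ 0#) → ∀ i → a i ≡ 0#

  private
    δ-sym : ∀ {n} (i j : Fin n) → δ i j ≡ δ j i
    δ-sym zero    zero    = refl
    δ-sym zero    (suc j) = refl
    δ-sym (suc i) zero    = refl
    δ-sym (suc i) (suc j) = δ-sym i j

  -- One step of the construction of a dual basis: x₀ is the t-th unit vector
  -- made orthogonal to the rows r′.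
  module AddRow {n k} (r₀ : Fin k → Carrier) (r′ dual : Fin n → Fin k → Carrier)
                (dual-correct : ∀ i j → ⟨ r′ i , dual j ⟩ ≡ δ j i) where

    -- r₀ reduced modulo the rows r′ so that it pairs to 0 with every `dual j`; independence of the
    -- rows makes it nonzero.
    residual : Fin k → Carrier
    residual t = r₀ t + sum (λ j → - ⟨ r₀ , dual j ⟩ * r′ j t)

    module _ (t : Fin k) (ρ≢0 : residual t ≢ 0#) where
      ρ : Carrier
      ρ = residual t

      x₀ : Fin k → Carrier
      x₀ t′ = δ t t′ + (- 1#) * sum (λ j → r′ j t * dual j t′)

      ⟨,x₀⟩ : ∀ x → ⟨ x , x₀ ⟩ ≡ x t + (- 1#) * sum (λ j → r′ j t * ⟨ x , dual j ⟩)
      ⟨,x₀⟩ x = trans (⟨,⟩-affine x (δ t) (λ t′ → sum (λ j → r′ j t * dual j t′)) (- 1#))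
        (cong₂ (λ a b → a + (- 1#) * b) (trans (sum-cong-≗ (λ s → cong (x s *_) (δ-sym t s))) (sum-δ x t)) (⟨,⟩-sum x (λ j → r′ j t) dual))

      r′x₀≡0 : ∀ i → ⟨ r′ i , x₀ ⟩ ≡ 0#
      r′x₀≡0 i = begin
        ⟨ r′ i , x₀ ⟩                                                ≡⟨ ⟨,x₀⟩ (r′ i) ⟩
        r′ i t + (- 1#) * sum (λ j → r′ j t * ⟨ r′ i , dual j ⟩)     ≡⟨ cong (λ s → r′ i t + (- 1#) * s) (trans (sum-cong-≗ (λ j → cong (r′ j t *_) (dual-correct i j))) (sum-δ (λ j → r′ j t) i)) ⟩
        r′ i t + (- 1#) * r′ i t                                     ≡⟨ solve 1 (λ x → x :+ (:- :1) :* x := :0) refl (r′ i t) ⟩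
        0#                                                           ∎

      r₀x₀≡ρ : ⟨ r₀ , x₀ ⟩ ≡ ρ
      r₀x₀≡ρ = trans (⟨,x₀⟩ r₀) (cong (r₀ t +_) (trans (*-distribˡ-sum (- 1#) (λ j → r′ j t * ⟨ r₀ , dual j ⟩))
        (sum-cong-≗ (λ j → solve 2 (λ a b → (:- :1) :* (a :* b) := (:- b) :* a) refl (r′ j t) ⟨ r₀ , dual j ⟩))))

      module _ (y′ : Fin k → Carrier) (w₀ : Carrier) where
        c : Carrier
        c = ρ ⁻¹ * (w₀ - ⟨ r₀ , y′ ⟩)

        solution : Fin k → Carrier
        solution t′ = y′ t′ + c * x₀ t′

        new-row : ⟨ r₀ , solution ⟩ ≡ w₀
        new-row = begin
          ⟨ r₀ , solution ⟩                  ≡⟨ ⟨,⟩-affine r₀ y′ x₀ c ⟩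
          ⟨ r₀ , y′ ⟩ + c * ⟨ r₀ , x₀ ⟩      ≡⟨ cong (λ s → ⟨ r₀ , y′ ⟩ + s) (trans (*-comm c _) (trans (cong (_* c) r₀x₀≡ρ) (*-⁻¹-cancel _ ρ≢0))) ⟩
          ⟨ r₀ , y′ ⟩ + (w₀ - ⟨ r₀ , y′ ⟩)   ≡⟨ solve 2 (λ a b → a :+ (b :- a) := b) refl ⟨ r₀ , y′ ⟩ w₀ ⟩
          w₀                                 ∎

        old-row : ∀ i → ⟨ r′ i , solution ⟩ ≡ ⟨ r′ i , y′ ⟩
        old-row i = begin
          ⟨ r′ i , solution ⟩                ≡⟨ ⟨,⟩-affine (r′ i) y′ x₀ c ⟩
          ⟨ r′ i , y′ ⟩ + c * ⟨ r′ i , x₀ ⟩  ≡⟨ cong (λ b → ⟨ r′ i , y′ ⟩ + c * b) (r′x₀≡0 i) ⟩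
          ⟨ r′ i , y′ ⟩ + c * 0#             ≡⟨ solve 2 (λ a c → a :+ c :* :0 := a) refl ⟨ r′ i , y′ ⟩ c ⟩
          ⟨ r′ i , y′ ⟩                      ∎

  -- Induction on the rows: solutions for the unit vectors are a dual family of the tail rows, and a
  -- nonzero entry of the residual of the first row is the pivot for correcting a solution of the
  -- tail. This yields nondegeneracy, where independent rows must force the columns to span.
  independent⇒solvable : ∀ {n k} (r : Fin n → Fin k → Carrier) → IndependentRows r →
                         ∀ (w : Fin n → Carrier) → ∃[ y ] ∀ i → ⟨ r i , y ⟩ ≡ w i
  independent⇒solvable {zero}      r independent w = (λ _ → 0#) , λ ()
  independent⇒solvable {suc n} {k} r independent w =
    step (λ j → proj₁ (solve′ (δ j))) (λ i j → proj₂ (solve′ (δ j)) i) (solve′ (w ∘ suc))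
    where
    solve′ : ∀ (w : Fin n → Carrier) → ∃[ y ] ∀ i → ⟨ r (suc i) , y ⟩ ≡ w i
    solve′ = independent⇒solvable (r ∘ suc) λ a vanish i → independent (λ { zero → 0# ; (suc j) → a j })
      (λ t → trans (cong₂ _+_ (zeroˡ (r zero t)) (vanish t)) (+-identityˡ 0#)) (suc i)

    step : ∀ (dual : Fin n → Fin k → Carrier) → (∀ i j → ⟨ r (suc i) , dual j ⟩ ≡ δ j i) → (∃[ y ] ∀ i → ⟨ r (suc i) , y ⟩ ≡ w (suc i)) →
           ∃[ y ] ∀ i → ⟨ r i , y ⟩ ≡ w i
    step dual dual-correct (y′ , y′-correct) = from-pivot pivot
      where
      open AddRow (r zero) (r ∘ suc) dual dual-correct

      pivot : ∃[ t ] residual t ≢ 0#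
      pivot = Fin.¬∀⟶∃¬ k _ (λ t → residual t ≟ 0#) λ vanish →
        0≢1 (sym (independent (λ { zero → 1# ; (suc j) → - ⟨ r zero , dual j ⟩ })
          (λ t → trans (cong (_+ sum (λ j → - ⟨ r zero , dual j ⟩ * r (suc j) t)) (*-identityˡ (r zero t))) (vanish t)) zero))

      from-pivot : ∃[ t ] residual t ≢ 0# → ∃[ y ] ∀ i → ⟨ r i , y ⟩ ≡ w i
      from-pivot (t , ρ≢0) = solution t ρ≢0 y′ (w zero) , λ
        { zero    → new-row t ρ≢0 y′ (w zero)
        ; (suc i) → trans (old-row t ρ≢0 y′ (w zero) i) (y′-correct i) }

-- Transport to Fin n turns the equality of a finite field into _≡_.
module FromHeyting {c ℓ₁ ℓ₂ : Level} (H : HeytingField c ℓ₁ ℓ₂) {n : ℕ} (card : HasCardinality H n) where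
  private
    module H = HeytingField H
    module R = CommutativeRing (underlyingRing H)

  open Inverse card public using (to; from; to-cong) renaming (strictlyInverseˡ to to-from; strictlyInverseʳ to from-to)

  private
    Fin-rawRing : RawRing 0ℓ 0ℓ
    Fin-rawRing = record
      { Carrier = Fin n
      ; _≈_     = _≡_
      ; _+_     = λ x y → to (from x R.+ from y)
      ; _*_     = λ x y → to (from x R.* from y)
      ; -_      = λ x → to (R.- from x)
      ; 0#      = to R.0#
      ; 1#      = to R.1#
      }

  from-injective : ∀ {i j} → from i R.≈ from j → i ≡ j
  from-injective {i} {j} eq = trans (sym (to-from i)) (trans (to-cong eq) (to-from j))

  isRingMonomorphism : RingMorphisms.IsRingMonomorphism Fin-rawRing R.rawRing from
  isRingMonomorphism = record
    { isRingHomomorphism = record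
      { isSemiringHomomorphism = record
        { isNearSemiringHomomorphism = record
          { +-isMonoidHomomorphism = record
            { isMagmaHomomorphism = record
              { isRelHomomorphism = record { cong = λ { refl → R.refl } }
              ; homo              = λ _ _ → from-to _
              }
            ; ε-homo = from-to _
            }
          ; *-homo = λ _ _ → from-to _
          }
        ; 1#-homo = from-to _
        }
      ; -‿homo = λ _ → from-to _
      }
    ; injective = from-injective
    }

  private
    -- If 0 and 1 coincided, 0 - 0 would be invertible and 0 apart from itself.
    0≉1 : ¬ (R.0# R.≈ R.1#)
    0≉1 0≈1 = H.#-irrefl R.refl (H.invertible⇒# {R.0#} {R.0#} (R.0# , zero-unit , zero-unit))
      where
      all-zero : ∀ x → x R.≈ R.0#
      all-zero x = R.trans (R.sym (R.*-identityˡ x)) (R.trans (R.*-congʳ (R.sym 0≈1)) (R.zeroˡ x))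

      zero-unit : ∀ {x} → x R.≈ R.1#
      zero-unit {x} = R.trans (all-zero x) 0≈1

    -- A search of the finite carrier decides invertibility. An element without inverse is not apart
    -- from 0, and tightness makes it equal to 0.
    inverse : ∀ i → i ≢ to R.0# → ∃[ j ] to (from i R.* from j) ≡ to R.1#
    inverse i i≢0 with Fin.any? (λ j → to (from i R.* from j) Fin.≟ to R.1#)
    ... | yes found = found
    ... | no  none  = ⊥-elim (i≢0 (from-injective (R.trans (proj₁ (H.tight (from i) R.0#) apart-impossible) (R.sym (from-to R.0#)))))
      where
      apart-impossible : ¬ (from i H.# R.0#)
      apart-impossible apart with H.#⇒invertible apart
      ... | x , _ , eq = none (to x , to-cong (R.trans (R.*-cong minus-zero (from-to x)) eq))
        where
        minus-zero : from i R.≈ from i R.- R.0#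
        minus-zero = R.sym (R.trans (R.+-congˡ -0#≈0#) (R.+-identityʳ _))
          where open import Algebra.Properties.Ring R.ring using (-0#≈0#)

  field′ : FiniteField
  field′ = record
    { Carrier           = Fin n
    ; _+_               = RawRing._+_ Fin-rawRing
    ; _*_               = RawRing._*_ Fin-rawRing
    ; -_                = RawRing.-_ Fin-rawRing
    ; 0#                = to R.0#
    ; 1#                = to R.1#
    ; isCommutativeRing = RingMonomorphism.isCommutativeRing isRingMonomorphism R.isCommutativeRing
    ; 0≢1               = λ eq → 0≉1 (R.trans (R.sym (from-to _)) (R.trans (R.reflexive (cong from eq)) (from-to _)))
    ; inverse           = inverse
    ; size              = n
    ; finite            = ↔-refl
    }

linearCombination-at : ∀ {c ℓ} (R : RawRing c ℓ) n {k} (x : Fin k → RawRing.Carrier R) (b : Fin k → Fin n → RawRing.Carrier R) i →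
  LinearAlgebra.linearCombination R (coordinateSpace R n) x b i ≡
  RawMonoidDefinitions.sum (RawRing.+-rawMonoid R) (λ j → RawRing._*_ R (x j) (b j i))
linearCombination-at R n {zero}  x b i = refl
linearCombination-at R n {suc k} x b i = cong (RawRing._+_ R _) (linearCombination-at R n (x ∘ suc) (b ∘ suc) i)

vectorSum-at : ∀ {c ℓ} (R : RawRing c ℓ) n {k} (x : Fin k → Fin n → RawRing.Carrier R) i →
  RawMonoidDefinitions.sum (RawLeftModule.+ᴹ-rawMonoid (coordinateSpace R n)) x i ≡
  RawMonoidDefinitions.sum (RawRing.+-rawMonoid R) (λ j → x j i)
vectorSum-at R n {zero}  x i = refl
vectorSum-at R n {suc k} x i = cong (RawRing._+_ R _) (vectorSum-at R n (x ∘ suc) i)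

module Transfer {q m : ℕ} {c ℓ₁ ℓ₂ c′ ℓ₁′ ℓ₂′ : Level} (E : FiniteFieldExtension q m c ℓ₁ ℓ₂ c′ ℓ₁′ ℓ₂′) where
  open FiniteFieldExtension E
  module FF = FromHeyting F F-cardinality
  module KK = FromHeyting K K-cardinality
  module RF = CommutativeRing (underlyingRing F)
  module RK = CommutativeRing (underlyingRing K)
  module ιH = RingMorphisms.IsRingHomomorphism ι-isRingHomomorphism

  F→K : Embedding FF.field′ KK.field′
  F→K = record
    { ι   = λ x → KK.to (ι (FF.from x))
    ; ι-+ = λ x y → KK.to-cong (RK.trans (ιH.⟦⟧-cong (FF.from-to _)) (RK.trans (ιH.+-homo _ _)
              (RK.+-cong (RK.sym (KK.from-to _)) (RK.sym (KK.from-to _)))))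
    ; ι-* = λ x y → KK.to-cong (RK.trans (ιH.⟦⟧-cong (FF.from-to _)) (RK.trans (ιH.*-homo _ _)
              (RK.*-cong (RK.sym (KK.from-to _)) (RK.sym (KK.from-to _)))))
    ; ι-1 = KK.to-cong (RK.trans (ιH.⟦⟧-cong (FF.from-to _)) ιH.1#-homo)
    }

-- The code of a cutting family

module CodeFromFamily {q m : ℕ} {c ℓ₁ ℓ₂ c′ ℓ₁′ ℓ₂′ : Level} (E : FiniteFieldExtension q m c ℓ₁ ℓ₂ c′ ℓ₁′ ℓ₂′)
                      (Γ : FiniteFieldExtension.OrderedBasis E) (n : ℕ)
                      (cuttingFamily : Scattered.CuttingFamily (Transfer.F→K E) m refl n) where
  open FiniteFieldExtension E
  open OrderedBasis Γ
  open Transfer E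
  open RankSupport E Γ
  open Space KK.field′
  open CrossProduct KK.field′
  open Scattered F→K m refl using (lin; comb; ∙-comb; module CuttingFamily)
  open CuttingFamily cuttingFamily
  private
    module F′ = FiniteField FF.field′
    module K′ = FiniteField KK.field′
    module LF = LinearSystems FF.field′
    module ΣF = SemiringSum RF.semiring
    module ΣK = SemiringSum RK.semiring
    module ΣF′ = SemiringSum F′.semiring
    module SF = IntegerSolver (underlyingRing F)
    module SK = IntegerSolver (underlyingRing K)

    π : Fin 3 → V → K′.Carrier
    π zero             (x₀ , x₁ , x₂) = x₀
    π (suc zero)       (x₀ , x₁ , x₂) = x₁
    π (suc (suc zero)) (x₀ , x₁ , x₂) = x₂

    -- The generator matrix with the vectors u i as columns: the codeword of a has the entries a · u
    -- i.
    g : Fin 3 → Fin n → ∣K∣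
    g j i = KK.from (π j (u i))

    toV : (Fin 3 → ∣K∣) → V
    toV a = KK.to (a zero) , KK.to (a (suc zero)) , KK.to (a (suc (suc zero)))

    codeword : (Fin 3 → ∣K∣) → Fin n → ∣K∣
    codeword a = K^.linearCombination n a g

    codeword-∙ : ∀ a i → codeword a i RK.≈ KK.from (toV a ∙ u i)
    codeword-∙ a i = RK.sym (RK.trans (from-+ _ _) (RK.trans (RK.+-congʳ (from-+ _ _)) (RK.trans
      (RK.+-cong (RK.+-cong (term (a zero) _) (term (a (suc zero)) _)) (term (a (suc (suc zero))) _))
      (SK.solve 3 (λ x y z → (x SK.:+ y) SK.:+ z SK.:= x SK.:+ (y SK.:+ (z SK.:+ SK.:0))) RK.refl _ _ _))))
      where
      from-+ : ∀ x y → KK.from (x K′.+ y) RK.≈ KK.from x RK.+ KK.from y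
      from-+ x y = KK.from-to _

      term : ∀ b x → KK.from (KK.to b K′.* x) RK.≈ b RK.* KK.from x
      term b x = RK.trans (KK.from-to _) (RK.*-congʳ (KK.from-to b))

    from-0 : KK.from K′.0# RK.≈ RK.0#
    from-0 = KK.from-to _

    ≡0⇒from≈0 : ∀ {x} → x ≡ K′.0# → KK.from x RK.≈ RK.0#
    ≡0⇒from≈0 refl = from-0

    from≈0⇒≡0 : ∀ {x} → KK.from x RK.≈ RK.0# → x ≡ K′.0#
    from≈0⇒≡0 eq = KK.from-injective (RK.trans eq (RK.sym from-0))

    -- `pair a v` vanishes when a is an F-relation among the entries of v, which is to say when a is
    -- orthogonal to the rank support of v.
    pair : (Fin n → ∣F∣) → (Fin n → ∣K∣) → ∣K∣
    pair a v = ΣK.sum (λ i → ι (a i) RK.* v i)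

    from-lin : ∀ {k} (a : Fin k → F′.Carrier) h →
               KK.from (lin a h) RK.≈ ΣK.sum (λ i → ι (FF.from (a i)) RK.* KK.from (h i))
    from-lin {zero}  a h = from-0
    from-lin {suc k} a h = RK.trans (KK.from-to _)
      (RK.+-cong (RK.trans (KK.from-to _) (RK.*-congʳ (KK.from-to _))) (from-lin (a ∘ suc) (h ∘ suc)))

    pair-cong : ∀ a {v v′} → (∀ i → v i RK.≈ v′ i) → pair a v RK.≈ pair a v′
    pair-cong a eq = ΣK.sum-cong-≋ (λ i → RK.*-congˡ {ι (a i)} (eq i))

    pair-codeword : ∀ a x v → (∀ i → v i RK.≈ KK.from (x ∙ u i)) → pair (FF.from ∘ a) v RK.≈ KK.from (x ∙ comb a u)
    pair-codeword a x v eq = RK.trans (pair-cong (FF.from ∘ a) eq)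
      (RK.trans (RK.sym (from-lin a (λ i → x ∙ u i))) (RK.reflexive (cong KK.from (sym (∙-comb x a u)))))

    module _ (a : Fin n → ∣F∣) where
      column-sum : (Fin n → ∣K∣) → Fin m → ∣F∣
      column-sum v j = ΣF.sum (λ i → a i RF.* expand v i j)

      ι-sum : ∀ {k} (h : Fin k → ∣F∣) → ι (ΣF.sum h) RK.≈ ΣK.sum (ι ∘ h)
      ι-sum {zero}  h = ιH.0#-homo
      ι-sum {suc k} h = RK.trans (ιH.+-homo _ _) (RK.+-congˡ (ι-sum (h ∘ suc)))

      pair-columns : ∀ v → pair a v RK.≈ ΣK.sum (λ j → ι (column-sum v j) RK.* γ j)
      pair-columns v = begin
        ΣK.sum (λ i → ι (a i) RK.* v i)
          ≈⟨ ΣK.sum-cong-≋ (λ i → RK.*-congˡ {ι (a i)} (proj₂ (K/F.IsBasis.spans isBasis {v i} _))) ⟩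
        ΣK.sum (λ i → ι (a i) RK.* ΣK.sum (λ j → ι (e i j) RK.* γ j))
          ≈⟨ ΣK.sum-cong-≋ (λ i → ΣK.*-distribˡ-sum (ι (a i)) (λ j → ι (e i j) RK.* γ j)) ⟩
        ΣK.sum (λ i → ΣK.sum (λ j → ι (a i) RK.* (ι (e i j) RK.* γ j)))
          ≈⟨ ΣK.∑-comm (λ i j → ι (a i) RK.* (ι (e i j) RK.* γ j)) ⟩
        ΣK.sum (λ j → ΣK.sum (λ i → ι (a i) RK.* (ι (e i j) RK.* γ j)))
          ≈⟨ ΣK.sum-cong-≋ (λ j → ΣK.sum-cong-≋ (λ i → absorb i j)) ⟩
        ΣK.sum (λ j → ΣK.sum (λ i → ι (a i RF.* e i j) RK.* γ j))
          ≈⟨ ΣK.sum-cong-≋ (λ j → ΣK.*-distribʳ-sum (γ j) (λ i → ι (a i RF.* e i j))) ⟨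
        ΣK.sum (λ j → ΣK.sum (λ i → ι (a i RF.* e i j)) RK.* γ j)
          ≈⟨ ΣK.sum-cong-≋ (λ j → RK.*-congʳ {γ j} (ι-sum (λ i → a i RF.* e i j))) ⟨
        ΣK.sum (λ j → ι (column-sum v j) RK.* γ j) ∎
        where
        open import Relation.Binary.Reasoning.Setoid RK.setoid
        e : Fin n → Fin m → ∣F∣
        e = expand v

        absorb : ∀ i j → ι (a i) RK.* (ι (e i j) RK.* γ j) RK.≈ ι (a i RF.* e i j) RK.* γ j
        absorb i j = RK.trans (RK.sym (RK.*-assoc _ _ _)) (RK.*-congʳ (RK.sym (ιH.*-homo _ _)))

      -- By `pair-columns` the pairing has the column sums as its coordinates in the basis γ, and
      -- coordinates of 0 vanish.
      pair≈0⇒columns≈0 : ∀ v → pair a v RK.≈ RK.0# → ∀ j → column-sum v j RF.≈ RF.0#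
      pair≈0⇒columns≈0 v eq = K/F.IsBasis.independent isBasis (column-sum v) (RK.trans (RK.sym (pair-columns v)) eq)

      columns≈0⇒pair≈0 : ∀ v → (∀ j → column-sum v j RF.≈ RF.0#) → pair a v RK.≈ RK.0#
      columns≈0⇒pair≈0 v eq = RK.trans (pair-columns v) (RK.trans
        (ΣK.sum-cong-≋ (λ j → RK.trans (RK.*-congʳ {γ j} (RK.trans (ιH.⟦⟧-cong (eq j)) ιH.0#-homo)) (RK.zeroˡ (γ j))))
        (ΣK.sum-replicate-zero m))

      σ-orthogonal : ∀ v → pair a v RK.≈ RK.0# → ∀ {w} → σ v w → ΣF.sum (λ i → a i RF.* w i) RF.≈ RF.0#
      σ-orthogonal v eq {w} (x , w≈) = begin
        ΣF.sum (λ i → a i RF.* w i)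
          ≈⟨ ΣF.sum-cong-≋ (λ i → RF.*-congˡ {a i} (RF.trans (w≈ i) (RF.reflexive (linearCombination-at F-rawRing n x (λ j i → expand v i j) i)))) ⟩
        ΣF.sum (λ i → a i RF.* ΣF.sum (λ j → x j RF.* expand v i j))
          ≈⟨ ΣF.sum-cong-≋ (λ i → ΣF.*-distribˡ-sum (a i) (λ j → x j RF.* expand v i j)) ⟩
        ΣF.sum (λ i → ΣF.sum (λ j → a i RF.* (x j RF.* expand v i j)))
          ≈⟨ ΣF.∑-comm (λ i j → a i RF.* (x j RF.* expand v i j)) ⟩
        ΣF.sum (λ j → ΣF.sum (λ i → a i RF.* (x j RF.* expand v i j)))
          ≈⟨ ΣF.sum-cong-≋ (λ j → ΣF.sum-cong-≋ (λ i → SF.solve 3 (λ a x e → a SF.:* (x SF.:* e) SF.:= x SF.:* (a SF.:* e)) RF.refl (a i) (x j) (expand v i j))) ⟩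
        ΣF.sum (λ j → ΣF.sum (λ i → x j RF.* (a i RF.* expand v i j)))
          ≈⟨ ΣF.sum-cong-≋ (λ j → ΣF.*-distribˡ-sum (x j) (λ i → a i RF.* expand v i j)) ⟨
        ΣF.sum (λ j → x j RF.* column-sum v j)
          ≈⟨ ΣF.sum-cong-≋ (λ j → RF.trans (RF.*-congˡ {x j} (pair≈0⇒columns≈0 v eq j)) (RF.zeroʳ (x j))) ⟩
        ΣF.sum (λ (j : Fin m) → RF.0#)
          ≈⟨ ΣF.sum-replicate-zero m ⟩
        RF.0# ∎
        where open import Relation.Binary.Reasoning.Setoid RF.setoid

    unit : ∀ {k} → Fin k → Fin k → ∣F∣
    unit zero    zero    = RF.1#
    unit zero    (suc j) = RF.0#
    unit (suc i) zero    = RF.0#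
    unit (suc i) (suc j) = unit i j

    sum-unit : ∀ {k} (h : Fin k → ∣F∣) c i → ΣF.sum (λ j → c RF.* unit j i RF.* h j) RF.≈ c RF.* h i
    sum-unit {suc k} h c zero = RF.trans (RF.+-cong (RF.*-congʳ (RF.*-identityʳ c)) (RF.trans
      (ΣF.sum-cong-≋ {k} (λ j → RF.trans (RF.*-congʳ (RF.zeroʳ c)) (RF.zeroˡ (h (suc j))))) (ΣF.sum-replicate-zero k))) (RF.+-identityʳ _)
    sum-unit {suc k} h c (suc i) = RF.trans (RF.+-cong (RF.trans (RF.*-congʳ (RF.zeroʳ c)) (RF.zeroˡ (h zero)))
      (sum-unit (h ∘ suc) c i)) (RF.+-identityˡ _)

    -- The scalar c is 1 for minimality and a coefficient of the solved linear system for
    -- nondegeneracy.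
    column∈σ : ∀ v c j → σ v (λ i → c RF.* expand v i j)
    column∈σ v c j = (λ s → c RF.* unit s j) , λ i → RF.sym (RF.trans
      (RF.reflexive (linearCombination-at F-rawRing n (λ s → c RF.* unit s j) (λ s i → expand v i s) i))
      (sum-unit (expand v i) c j))

    -- A relation of v is orthogonal to the support of v, hence to every column of the expansion of
    -- v′, since these lie in the smaller support.
    σ-⊆⇒pair : ∀ {v v′} → (∀ {w} → σ v′ w → σ v w) → ∀ a → pair a v RK.≈ RK.0# → pair a v′ RK.≈ RK.0#
    σ-⊆⇒pair {v} {v′} σ⊆ a eq = columns≈0⇒pair≈0 a v′ (λ j → RF.trans
      (ΣF.sum-cong-≋ (λ i → RF.*-congˡ {a i} (RF.sym (RF.*-identityˡ (expand v′ i j)))))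
      (σ-orthogonal a v eq (σ⊆ (column∈σ v′ RF.1# j))))

    toV≡𝟎⇒≈0 : ∀ a → toV a ≡ 𝟎 → ∀ j → a j RK.≈ RK.0#
    toV≡𝟎⇒≈0 a eq j = RK.trans (RK.sym (KK.from-to (a j))) (≡0⇒from≈0 (component j))
      where
      component : ∀ j → KK.to (a j) ≡ K′.0#
      component zero             = at₀ eq
      component (suc zero)       = at₁ eq
      component (suc (suc zero)) = at₂ eq

    codeword≈0⇒ : ∀ a v → (∀ i → v i RK.≈ codeword a i) → (∀ b → pair (FF.from ∘ b) v RK.≈ RK.0#) → toV a ≡ 𝟎
    codeword≈0⇒ a v v≈ eq = spanning λ b → from≈0⇒≡0
      (RK.trans (RK.sym (pair-codeword b (toV a) v (λ i → RK.trans (v≈ i) (codeword-∙ a i)))) (eq b))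

    pair-zero : ∀ a v → (∀ i → v i RK.≈ RK.0#) → pair a v RK.≈ RK.0#
    pair-zero a v eq = RK.trans (ΣK.sum-cong-≋ (λ i → RK.trans (RK.*-congˡ {ι (a i)} (eq i)) (RK.zeroʳ (ι (a i))))) (ΣK.sum-replicate-zero n)

  code : Code n 3
  code = record
    { codewords    = K^.Span n g
    ; isSubspace   = record
      { respects-≈ = λ { x≈y (a , x≈) → a , λ i → RK.trans (RK.sym (x≈y i)) (x≈ i) }
      ; 0-closed   = (λ _ → RK.0#) , λ i →
          SK.solve 3 (λ x y z → SK.:0 SK.:= SK.:0 SK.:* x SK.:+ (SK.:0 SK.:* y SK.:+ (SK.:0 SK.:* z SK.:+ SK.:0))) RK.refl _ _ _
      ; +-closed   = λ { (a , x≈) (b , y≈) → (λ j → a j RK.+ b j) , λ i → RK.trans (RK.+-cong (x≈ i) (y≈ i))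
          (SK.solve 9 (λ a b c d e f x y z →
            (a SK.:* x SK.:+ (b SK.:* y SK.:+ (c SK.:* z SK.:+ SK.:0))) SK.:+ (d SK.:* x SK.:+ (e SK.:* y SK.:+ (f SK.:* z SK.:+ SK.:0))) SK.:=
            (a SK.:+ d) SK.:* x SK.:+ ((b SK.:+ e) SK.:* y SK.:+ ((c SK.:+ f) SK.:* z SK.:+ SK.:0))) RK.refl _ _ _ _ _ _ _ _ _) }
      ; *-closed   = λ { s (a , x≈) → (λ j → s RK.* a j) , λ i → RK.trans (RK.*-congˡ (x≈ i))
          (SK.solve 7 (λ s a b c x y z → s SK.:* (a SK.:* x SK.:+ (b SK.:* y SK.:+ (c SK.:* z SK.:+ SK.:0))) SK.:=
            (s SK.:* a) SK.:* x SK.:+ ((s SK.:* b) SK.:* y SK.:+ ((s SK.:* c) SK.:* z SK.:+ SK.:0))) RK.refl _ _ _ _ _ _ _) }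
      }
    ; hasDimension = g , record
      { member      = row∈code
      ; independent = λ a eq → toV≡𝟎⇒≈0 a (codeword≈0⇒ a (codeword a) (λ _ → RK.refl) (λ b → pair-zero _ (codeword a) eq))
      ; spans       = id
      }
    }
    where
    row∈code : ∀ j → K^.Span n g (g j)
    row∈code zero = (λ { zero → RK.1# ; (suc _) → RK.0# }) , λ i →
      SK.solve 3 (λ x y z → x SK.:= SK.:1 SK.:* x SK.:+ (SK.:0 SK.:* y SK.:+ (SK.:0 SK.:* z SK.:+ SK.:0))) RK.refl _ _ _
    row∈code (suc zero) = (λ { zero → RK.0# ; (suc zero) → RK.1# ; (suc (suc _)) → RK.0# }) , λ i →
      SK.solve 3 (λ x y z → y SK.:= SK.:0 SK.:* x SK.:+ (SK.:1 SK.:* y SK.:+ (SK.:0 SK.:* z SK.:+ SK.:0))) RK.refl _ _ _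
    row∈code (suc (suc zero)) = (λ { zero → RK.0# ; (suc zero) → RK.0# ; (suc (suc _)) → RK.1# }) , λ i →
      SK.solve 3 (λ x y z → z SK.:= SK.:0 SK.:* x SK.:+ (SK.:0 SK.:* y SK.:+ (SK.:1 SK.:* z SK.:+ SK.:0))) RK.refl _ _ _

  isMinimal : IsMinimal code
  isMinimal {v} {v′} (a , v≈) (b , v′≈) σ⊆ = by-cases (Finite._≟_ V-finite (toV a) 𝟎)
    where
    v-∙ : ∀ i → v i RK.≈ KK.from (toV a ∙ u i)
    v-∙ i = RK.trans (v≈ i) (codeword-∙ a i)

    v′-∙ : ∀ i → v′ i RK.≈ KK.from (toV b ∙ u i)
    v′-∙ i = RK.trans (v′≈ i) (codeword-∙ b i)

    transfer : ∀ x → toV a ∙ comb x u ≡ K′.0# → toV b ∙ comb x u ≡ K′.0#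
    transfer x eq = from≈0⇒≡0 (RK.trans (RK.sym (pair-codeword x (toV b) v′ v′-∙))
      (σ-⊆⇒pair σ⊆ (FF.from ∘ x) (RK.trans (pair-codeword x (toV a) v v-∙) (≡0⇒from≈0 eq))))

    0∙ : ∀ x → 𝟎 ∙ x ≡ K′.0#
    0∙ (x₀ , x₁ , x₂) = K′.solve 3 (λ x y z → K′.:0 K′.:* x K′.:+ K′.:0 K′.:* y K′.:+ K′.:0 K′.:* z K′.:= K′.:0) refl x₀ x₁ x₂

    ⊙-∙ : ∀ s x y → (s ⊙ x) ∙ y ≡ s K′.* (x ∙ y)
    ⊙-∙ s (x₀ , x₁ , x₂) (y₀ , y₁ , y₂) = K′.solve 7 (λ s x₀ x₁ x₂ y₀ y₁ y₂ →
      s K′.:* x₀ K′.:* y₀ K′.:+ s K′.:* x₁ K′.:* y₁ K′.:+ s K′.:* x₂ K′.:* y₂ K′.:=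
      s K′.:* (x₀ K′.:* y₀ K′.:+ x₁ K′.:* y₁ K′.:+ x₂ K′.:* y₂)) refl s x₀ x₁ x₂ y₀ y₁ y₂

    from-cutting : ∃[ s ] toV b ≡ s ⊙ toV a → ∃[ α ] (∀ i → v′ i RK.≈ α RK.* v i)
    from-cutting (s , eq) = KK.from s , λ i → RK.trans (v′-∙ i) (RK.trans
      (RK.reflexive (cong KK.from (trans (cong (_∙ u i) eq) (⊙-∙ s (toV a) (u i)))))
      (RK.trans (KK.from-to _) (RK.*-congˡ (RK.sym (v-∙ i)))))

    by-cases : Dec (toV a ≡ 𝟎) → ∃[ α ] (∀ i → v′ i RK.≈ α RK.* v i)
    by-cases (no  a≢𝟎) = from-cutting (cutting a≢𝟎 transfer)
    -- For v = 0 every a is a relation of v and therefore of v′, so v′ = 0 and the scalar 0 serves.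
    by-cases (yes a≡𝟎) = from-cutting (K′.0# , trans b≡𝟎 (sym (0⊙ (toV a))))
      where
      b≡𝟎 : toV b ≡ 𝟎
      b≡𝟎 = spanning λ x → transfer x (trans (cong (_∙ comb x u) a≡𝟎) (0∙ (comb x u)))

  -- The expansions of the three generators already suffice. Side by side they form an n × 3m
  -- matrix; a relation among its rows is an F-relation among the u i, so the rows are independent
  -- and the columns span.
  isNondegenerate : IsNondegenerate code
  isNondegenerate w = from-solution (LF.independent⇒solvable rows rows-independent (FF.to ∘ w))
    where
    row : Fin (3 ℕ.* m) → Fin 3
    row t = proj₁ (Fin.remQuot {3} m t)

    col : Fin (3 ℕ.* m) → Fin m
    col t = proj₂ (Fin.remQuot {3} m t)

    rows : Fin n → Fin (3 ℕ.* m) → F′.Carrier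
    rows i t = FF.to (expand (g (row t)) i (col t))

    from-sum : ∀ {k} (h : Fin k → F′.Carrier) → FF.from (ΣF′.sum h) RF.≈ ΣF.sum (FF.from ∘ h)
    from-sum {zero}  h = FF.from-to _
    from-sum {suc k} h = RF.trans (FF.from-to _) (RF.+-congˡ (from-sum (h ∘ suc)))

    π-comb : ∀ {k} j (a : Fin k → F′.Carrier) (u : Fin k → V) → π j (comb a u) ≡ lin a (π j ∘ u)
    π-comb {zero}  zero             a u = refl
    π-comb {zero}  (suc zero)       a u = refl
    π-comb {zero}  (suc (suc zero)) a u = refl
    π-comb {suc k} zero             a u = cong (K′._+_ _) (π-comb zero (a ∘ suc) (u ∘ suc))
    π-comb {suc k} (suc zero)       a u = cong (K′._+_ _) (π-comb (suc zero) (a ∘ suc) (u ∘ suc))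
    π-comb {suc k} (suc (suc zero)) a u = cong (K′._+_ _) (π-comb (suc (suc zero)) (a ∘ suc) (u ∘ suc))

    rows-independent : LF.IndependentRows rows
    rows-independent a vanish = independent a (triple (component zero) (component (suc zero)) (component (suc (suc zero))))
      where
      column-at : ∀ j s → column-sum (FF.from ∘ a) (g j) s RF.≈ FF.from (ΣF′.sum (λ i → a i F′.* rows i (Fin.combine j s)))
      column-at j s = RF.sym (RF.trans (from-sum (λ i → a i F′.* rows i (Fin.combine j s)))
        (ΣF.sum-cong-≋ (λ i → RF.trans (FF.from-to _) (RF.*-congˡ (RF.trans (FF.from-to _)
          (RF.reflexive (cong (λ (j , s) → expand (g j) i s) (Fin.remQuot-combine j s))))))))

      columns-vanish : ∀ j s → column-sum (FF.from ∘ a) (g j) s RF.≈ RF.0#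
      columns-vanish j s = RF.trans (column-at j s) (RF.trans (RF.reflexive (cong FF.from (vanish (Fin.combine j s)))) (FF.from-to _))

      component : ∀ j → π j (comb a u) ≡ K′.0#
      component j = from≈0⇒≡0 (RK.trans (RK.reflexive (cong KK.from (π-comb j a u)))
        (RK.trans (from-lin a (π j ∘ u)) (columns≈0⇒pair≈0 (FF.from ∘ a) (g j) (columns-vanish j))))

    column : (Fin (3 ℕ.* m) → F′.Carrier) → Fin (3 ℕ.* m) → Fin n → ∣F∣
    column y t i = FF.from (y t) RF.* expand (g (row t)) i (col t)

    column-product : ∀ y t i → FF.from (rows i t F′.* y t) RF.≈ column y t i
    column-product y t i = RF.trans (FF.from-to _) (RF.trans (RF.*-congʳ (FF.from-to _)) (RF.*-comm _ _))

    from-solution : ∃[ y ] (∀ i → LF.⟨ rows i , y ⟩ ≡ FF.to (w i)) → F^.FamilySum n (Code.codewords code) σ w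
    from-solution (y , correct) = 3 ℕ.* m , (λ t → g (row t)) , column y ,
      (λ t → K^.IsBasis.member (proj₂ (Code.hasDimension code)) (row t) , column∈σ (g (row t)) (FF.from (y t)) (col t)) ,
      λ i → RF.sym (begin
        RawMonoidDefinitions.sum (RawLeftModule.+ᴹ-rawMonoid (coordinateSpace F-rawRing n)) (column y) i
          ≡⟨ vectorSum-at F-rawRing n (column y) i ⟩
        ΣF.sum (λ t → column y t i)
          ≈⟨ ΣF.sum-cong-≋ (λ t → column-product y t i) ⟨
        ΣF.sum (λ t → FF.from (rows i t F′.* y t))
          ≈⟨ from-sum (λ t → rows i t F′.* y t) ⟨
        FF.from LF.⟨ rows i , y ⟩
          ≡⟨ cong FF.from (correct i) ⟩
        FF.from (FF.to (w i))
          ≈⟨ FF.from-to (w i) ⟩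
        w i ∎)
      where open import Relation.Binary.Reasoning.Setoid RF.setoid

open import Data.Nat.Base using (_+_; _≤_; _%_)

theorem6p7 : ∀ {c ℓ₁ ℓ₂ c′ ℓ₁′ ℓ₂′ : Level} (q m : ℕ) → IsPrimePower q →
    m % 6 ≢ 3 → m % 6 ≢ 5 → 4 ≤ m →
    (E : FiniteFieldExtension q m c ℓ₁ ℓ₂ c′ ℓ₁′ ℓ₂′) →
    (Γ : FiniteFieldExtension.OrderedBasis E) →
    Σ[ C ∈ FiniteFieldExtension.Code E (m + 2) 3 ]
    (RankSupport.IsNondegenerate E Γ C × RankSupport.IsMinimal E Γ C)
theorem6p7 q m (p , e , pr , _ , q≡p^e) ≢3 ≢5 4≤m E Γ = code , isNondegenerate , isMinimal
  where
  open Transfer E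

  X : Extension m
  X = record { prime = pr ; e = e ; size-F = q≡p^e ; size-K = refl ; F→K = F→K }

  family : Scattered.CuttingFamily F→K m refl (m + 2)
  family = subst (Scattered.CuttingFamily F→K m refl) (ℕ.+-comm 2 m)
    (cutting-family X ≢3 ≢5 4≤m)

  open CodeFromFamily E Γ (m + 2) family
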